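{- For all integers $\alpha\ge 1$, $$\frac{1}{8^{\alpha}}L_{\alpha}\in\mathbb{Z}[x],$$ i.e. $L_\alpha/8^\alpha$ is a polynomial in the function $x$ with integer coefficients.
   Context: Let $q=e^{2\pi i\tau}$ with $\tau\in\mathbb{H}$ (the upper half plane); all functions below may be identified with their $q$-expansions. Write $(q^a;q^b)_\infty=\prod_{m=0}^\infty(1-q^{a+bm})$. The integers $d_7(n)$ are defined by $$\sum_{n=0}^{\infty}d_7(n)q^n = \prod_{m=1}^{\infty}\frac{(1-q^{2m})^7}{(1-q^m)^{22}}.$$ For $\alpha\ge 1$ let $\lambda_\alpha$ be the minimal positive integer $y$ with $3y\equiv 1\pmod{4^\alpha}$, and define $$L_{\alpha} := \frac{(q;q)^{26}_{\infty}(q^4;q^4)^{2}_{\infty}}{(q^2;q^2)^{13}_{\infty}}\sum_{n=0}^{\infty}d_7(4^{\alpha}n+\lambda_{\alpha})q^{n+1}.$$ The function $x$ is $$x := q\,\frac{(q^2;q^2)^2_{\infty}(q^8;q^8)^4_{\infty}}{(q;q)^4_{\infty}(q^4;q^4)^2_{\infty}}.$$ -}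

module Defs where

open import Algebra.Bundles using (RawRing)
import Algebra.Definitions.RawSemiring as RawSemiringDefinitions
open import Data.Bool.Base using (if_then_else_)
open import Data.Empty using (⊥-elim)
open import Data.Fin.Base using (toℕ)
open import Data.Integer.Base as ℤ using (ℤ; +_; 0ℤ; 1ℤ)
import Data.Integer.Divisibility as ℤ
import Data.Integer.Properties as ℤ
open import Data.List.Base using (List; foldr)
open import Data.Nat.Base as ℕ using (ℕ; zero; suc; _≤_; _≡ᵇ_; _∸_; s≤s; z≤n)
open import Data.Nat.Divisibility as ℕ using (divides)
import Data.Nat.Properties as ℕ
open import Data.Nat.Solver using (module +-*-Solver)
open import Data.Product.Base using (∃; _,_; proj₁)
open import Data.Rational.Base as ℚ using (ℚ)
open import Function.Base using (_∘_)
open import Level using (0ℓ)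
open import Relation.Binary.PropositionalEquality

open RawSemiringDefinitions (RawRing.rawSemiring ℤ.+-*-rawRing)
  using () renaming (sum to sumℤ)

------------------------------------------------------------------------
-- Formal power series in q over ℤ, given by their coefficients

PowerSeries : Set
PowerSeries = ℕ → ℤ

constant : ℤ → PowerSeries
constant c zero    = c
constant c (suc _) = 0ℤ

powerSeriesRawRing : RawRing 0ℓ 0ℓ
powerSeriesRawRing = record
  { Carrier = PowerSeries
  ; _≈_     = _≗_
  ; _+_     = λ f g n → f n ℤ.+ g n
  ; _*_     = λ f g n → sumℤ {suc n} λ i → f (toℕ i) ℤ.* g (n ∸ toℕ i)
  ; -_      = λ f n → ℤ.- f n
  ; 0#      = constant 0ℤ
  ; 1#      = constant 1ℤ
  }

open RawRing powerSeriesRawRing public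
  using (_+_; _*_; -_; 0#; 1#)
open RawSemiringDefinitions (RawRing.rawSemiring powerSeriesRawRing) public
  using (_^_; sum; product)

infix 9 q^_

q^_ : ℕ → PowerSeries
(q^ k) n = if n ≡ᵇ k then 1ℤ else 0ℤ

-- The inverse of a series with constant term 1, as the geometric series
-- ∑ₖ (1 - f)ᵏ.  As 1 - f is divisible by q, only the terms with k ≤ n
-- contribute to the coefficient of qⁿ.
-- Meaningless when the constant term of f is not 1.

infix 9 _⁻¹

_⁻¹ : PowerSeries → PowerSeries
(f ⁻¹) n = sum {suc n} (λ k → (1# + - f) ^ toℕ k) n

-- The infinite product ∏_{m ≥ 0} f m, for a family with f m ≡ 1 mod q^(m+1).
-- Under that condition the factors with m ≥ n do not affect the coefficient
-- of qⁿ, so it can be read off from the partial product over m ≤ n.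

∏∞ : (ℕ → PowerSeries) → PowerSeries
∏∞ f n = product {suc n} (f ∘ toℕ) n

-- (q^a ; q^b)_∞, for a, b ≥ 1.

qPochhammer : ℕ → ℕ → PowerSeries
qPochhammer a b = ∏∞ λ m → 1# + - q^ (a ℕ.+ b ℕ.* m)

------------------------------------------------------------------------
-- Integer polynomials in a power series

evaluate : List ℤ → PowerSeries → PowerSeries
evaluate p f = foldr (λ c r → constant c + f * r) 0# p

-- F ∈ℤ[ f ]: the series F, a priori with rational coefficients, is p(f) for
-- some polynomial p over ℤ (listed from the constant coefficient upwards).

infix 4 _∈ℤ[_]

_∈ℤ[_] : (ℕ → ℚ) → PowerSeries → Set
F ∈ℤ[ f ] = ∃ λ p → ∀ n → F n ≡ evaluate p f n ℚ./ 1

1/8^_·_ : ℕ → PowerSeries → (ℕ → ℚ)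
(1/8^ α · f) n = (f n ℚ./ (8 ℕ.^ α)) {{ℕ.m^n≢0 8 α}}

------------------------------------------------------------------------
-- The functions under study

d₇ : ℕ → ℤ
d₇ = ∏∞ λ k → let m = suc k in
  (1# + - q^ (2 ℕ.* m)) ^ 7 * ((1# + - q^ m) ^ 22) ⁻¹

infix 4 3*_≡1mod4^_

3*_≡1mod4^_ : ℕ → ℕ → Set
3* y ≡1mod4^ α = + (4 ℕ.^ α) ℤ.∣ + (3 ℕ.* y) ℤ.- 1ℤ

record IsLeastInverse (α y : ℕ) : Set where
  field
    positive : 1 ≤ y
    inverse  : 3* y ≡1mod4^ α
    least    : ∀ z → 1 ≤ z → 3* z ≡1mod4^ α → y ≤ z

leastInverse : ∀ α → ∃ (IsLeastInverse α)
leastInverse α = suc (k α) , record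
  { positive = s≤s z≤n
  ; inverse  = divides 2 (ℕ.suc-injective (3y≡1+2·4^α α))
  ; least    = least
  }
  where
  open +-*-Solver

  k : ℕ → ℕ
  k zero    = 0
  k (suc a) = 4 ℕ.* k a ℕ.+ 2

  3y≡1+2·4^α : ∀ a → 3 ℕ.* suc (k a) ≡ 1 ℕ.+ 2 ℕ.* 4 ℕ.^ a
  3y≡1+2·4^α zero    = refl
  3y≡1+2·4^α (suc a) = ℕ.+-cancelʳ-≡ 3 _ _ (begin
    3 ℕ.* suc (4 ℕ.* k a ℕ.+ 2) ℕ.+ 3
      ≡⟨ solve 1 (λ x → con 3 :* (con 1 :+ (con 4 :* x :+ con 2)) :+ con 3
                     := con 4 :* (con 3 :* (con 1 :+ x))) refl (k a) ⟩
    4 ℕ.* (3 ℕ.* suc (k a))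
      ≡⟨ cong (4 ℕ.*_) (3y≡1+2·4^α a) ⟩
    4 ℕ.* (1 ℕ.+ 2 ℕ.* 4 ℕ.^ a)
      ≡⟨ solve 1 (λ x → con 4 :* (con 1 :+ con 2 :* x)
                     := con 1 :+ con 2 :* (con 4 :* x) :+ con 3) refl (4 ℕ.^ a) ⟩
    1 ℕ.+ 2 ℕ.* (4 ℕ.* 4 ℕ.^ a) ℕ.+ 3 ∎)
    where open ≡-Reasoning

  least : ∀ z → 1 ≤ z → 3* z ≡1mod4^ α → suc (k α) ≤ z
  least (suc j) _ (divides 0 eq) = ⊥-elim (ℕ.m+1+n≢0 j eq)
  least (suc j) _ (divides 1 eq) = ⊥-elim (3∤1 (ℕ.∣m+n∣m⇒∣n
    (subst (3 ℕ.∣_) 6z≡3y+1 (ℕ.m∣m*n (2 ℕ.* suc j))) (ℕ.m∣m*n (suc (k α)))))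
    where
    open ≡-Reasoning

    3∤1 : 3 ℕ.∤ 1
    3∤1 3∣1 with ℕ.∣⇒≤ 3∣1
    ... | s≤s ()

    6z≡3y+1 : 3 ℕ.* (2 ℕ.* suc j) ≡ 3 ℕ.* suc (k α) ℕ.+ 1
    6z≡3y+1 = begin
      3 ℕ.* (2 ℕ.* suc j)
        ≡⟨ solve 1 (λ x → con 3 :* (con 2 :* x) := con 2 :* (con 3 :* x))
                   refl (suc j) ⟩
      2 ℕ.* (3 ℕ.* suc j)
        ≡⟨ cong (λ t → 2 ℕ.* suc t) eq ⟩
      2 ℕ.* (1 ℕ.+ 1 ℕ.* 4 ℕ.^ α)
        ≡⟨ solve 1 (λ x → con 2 :* (con 1 :+ con 1 :* x)
                       := con 1 :+ con 2 :* x :+ con 1) refl (4 ℕ.^ α) ⟩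
      1 ℕ.+ 2 ℕ.* 4 ℕ.^ α ℕ.+ 1
        ≡⟨ cong (ℕ._+ 1) (3y≡1+2·4^α α) ⟨
      3 ℕ.* suc (k α) ℕ.+ 1 ∎
  least (suc j) _ (divides (suc (suc c)) eq) = ℕ.*-cancelˡ-≤ 3 (begin
    3 ℕ.* suc (k α)
      ≡⟨ 3y≡1+2·4^α α ⟩
    1 ℕ.+ 2 ℕ.* 4 ℕ.^ α
      ≤⟨ s≤s (ℕ.*-monoˡ-≤ (4 ℕ.^ α) (s≤s (s≤s (z≤n {c})))) ⟩
    1 ℕ.+ suc (suc c) ℕ.* 4 ℕ.^ α
      ≡⟨ cong suc eq ⟨
    3 ℕ.* suc j ∎)
    where open ℕ.≤-Reasoning

λ[_] : ℕ → ℕ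
λ[ α ] = proj₁ (leastInverse α)

E : ℕ → PowerSeries
E k = qPochhammer k k

L : ℕ → PowerSeries
L α = E 1 ^ 26 * E 4 ^ 2 * (E 2 ^ 13) ⁻¹
    * (q^ 1 * λ n → d₇ (4 ℕ.^ α ℕ.* n ℕ.+ λ[ α ]))

x : PowerSeries
x = q^ 1 * (E 2 ^ 2 * E 8 ^ 4)
    * (E 1 ^ 4 * E 4 ^ 2) ⁻¹

{-# OPTIONS --safe #-}

-- Let φ, ψ be Ramanujan's theta functions and put y = qψ(q⁸)/φ(q⁴), u = 2y,
-- v = 1/(1 - u).  From φ(±q) = φ(q⁴) ± 2qψ(q⁸) and φ(q)φ(-q) = φ(-q²)² one finds
-- x = yv², while y⁴ is a series in q⁴.  Put t = x(1 + 4x) and T = 16t; then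
-- 1 + T = (φ(q)/φ(-q))⁴ and (1 - u⁴)(1 + T(q⁴)) = 1.  Passing from L_α to
-- L_{α+1} means multiplying by q P(q⁴)/P(q), where P = E₁²⁶E₄²/E₂¹³, and then
-- keeping the coefficients of q⁴ⁿ.  On t ℤ[T] the multiplication produces y²
-- times polynomials in v, which expand in u⁰, …, u³ with coefficients in
-- (1 + T(q⁴)) ℤ[T(q⁴)].  Only y²u² = 4y⁴ survives the extraction, giving back
-- 4 t ℤ[T]; as T = 8v(v - 1)(2v² - 2v + 1), a parity check for the constant
-- term of the polynomial in T improves the 4 to 8.  Hence L_α ∈ 8^α t ℤ[T].
-- The product formulas for φ and ψ are Gauss's, obtained from Shanks' finite
-- identities, which telescope by the q-binomial theorem.

module Submission where

open import Agda.Builtin.Strict using (primForce; primForceLemma)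
open import Algebra.Bundles using (CommutativeRing)
import Algebra.Properties.CommutativeSemiring.Exp as Exp
import Algebra.Solver.Ring as RingSolver
open import Algebra.Solver.Ring.AlmostCommutativeRing
  using (fromCommutativeRing; _-Raw-AlmostCommutative⟶_)
open import Algebra.Structures using (IsCommutativeRing)
open import Data.Fin.Base using (toℕ)
open import Data.Integer.Base as ℤ using (ℤ; +_; -[1+_]; 0ℤ; 1ℤ; -1ℤ; _⊖_)
import Data.Integer.Properties as ℤ
import Data.Integer.Solver as ℤSolver
open import Data.List.Base using (List; []; _∷_; foldr; map)
open import Data.Maybe.Base using (Maybe; just; nothing)
open import Data.Nat.Base as ℕ using (ℕ; zero; suc; _≤_; _<_; z≤n; s≤s)
import Data.Nat.Divisibility as ℕ
import Data.Nat.Properties as ℕ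
import Data.Nat.Solver as ℕ
open import Data.Product.Base using (∃; _,_; _×_; proj₁; proj₂)
import Data.Rational.Base as ℚ
import Data.Rational.Properties as ℚ
import Data.Rational.Unnormalised.Base as ℚᵘ
open import Data.Sum.Base using (inj₁; inj₂)
open import Function.Base using (_∘_)
open import Level using (0ℓ)
open import Relation.Binary.Core using (Rel)
open import Relation.Binary.PropositionalEquality as ≡ using (_≡_; _≗_)
import Relation.Binary.Reasoning.Setoid as SetoidReasoning
open import Relation.Nullary.Decidable using (yes; no)

-- The obstacle is the supply of factors 2. A product of y's and u's survives the extraction when it
-- contains four y's in all, and each `u` among them brings a 2: three of them if one `y` stands in
-- front, two if `y ^ 2` does. The first extraction starts from yv m²w³ with m = φ(q)/φ(-q), w = 1 +
-- 4x, and gets its 8 outright. Later ones start from t = yv²w, so the multiplier yv m³w³ gives y²v³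
-- m³w⁴ g(T), one 2 short. But m = 1 + 2(v - 1) and w = 1 + 2v(v - 1) are odd in ℤ[v] and T lies in
-- 8ℤ[v]; modulo 2 only g(0)v³ is left, and the u²-coefficient of v³ is even. The form tℤ[T]
-- reproduces itself because κy⁴ = V²(t), where κ = 1/(1 - u⁴) is the common denominator of all
-- expansions in u. Convergence is replaced by congruences: a limit is a series congruent to its
-- n-th approximant modulo qⁿ for every n. All modular input is thus reduced to finite identities in
-- q, and identities of eta quotients to comparisons of lists of exponents.

-- The properties of ℤ[[q]] that are used, with V : q ↦ q², σ : q ↦ -q and
-- U : Σ aₙqⁿ ↦ Σ a₂ₙqⁿ.  Over an abstract ring the type checker cannot unfold
-- products of power series into convolutions.
record QSeriesRing : Set₁ where
  infix  4 _≈_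
  infixl 6 _+_
  infixl 7 _*_
  infix  8 -_
  field
    Carrier : Set
    _≈_     : Rel Carrier _
    _+_ _*_ : Carrier → Carrier → Carrier
    -_      : Carrier → Carrier
    ι       : ℤ → Carrier
    isCommutativeRing : IsCommutativeRing _≈_ _+_ _*_ -_ (ι 0ℤ) (ι 1ℤ)
    ι-+ : ∀ a b → ι (a ℤ.+ b) ≈ ι a + ι b
    ι-* : ∀ a b → ι (a ℤ.* b) ≈ ι a * ι b
    ι-‿ : ∀ a → ι (ℤ.- a) ≈ - ι a

  commutativeRing : CommutativeRing _ _
  commutativeRing = record { isCommutativeRing = isCommutativeRing }

  open CommutativeRing commutativeRing public
    hiding (Carrier; _≈_; _+_; _*_; -_; isCommutativeRing; zero)
  open Exp commutativeSemiring public
    using (_^_; ^-congˡ; ^-homo-*; ^-assocʳ; ^-distrib-*)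

  field
    q : Carrier
    separated : ∀ f → (∀ n → ∃ λ h → f ≈ q ^ n * h) → f ≈ 0#
    unit : ∀ f → ∃ λ g → (1# + - (q * f)) * g ≈ 1#

    V σ U : Carrier → Carrier

    V-cong : ∀ {f g} → f ≈ g → V f ≈ V g
    V-+    : ∀ f g → V (f + g) ≈ V f + V g
    V-*    : ∀ f g → V (f * g) ≈ V f * V g
    V-ι    : ∀ c → V (ι c) ≈ ι c
    V-q    : V q ≈ q * q
    V-injective : ∀ {f g} → V f ≈ V g → f ≈ g

    σ-cong : ∀ {f g} → f ≈ g → σ f ≈ σ g
    σ-+    : ∀ f g → σ (f + g) ≈ σ f + σ g
    σ-*    : ∀ f g → σ (f * g) ≈ σ f * σ g
    σ-ι    : ∀ c → σ (ι c) ≈ ι c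
    σ-q    : σ q ≈ - q
    σ-V    : ∀ f → σ (V f) ≈ V f

    U-cong : ∀ {f g} → f ≈ g → U f ≈ U g
    U-+    : ∀ f g → U (f + g) ≈ U f + U g
    U-V*   : ∀ f g → U (V f * g) ≈ f * U g
    U-1    : U 1# ≈ 1#
    U-q    : U q ≈ 0#

-- Exponent arithmetic for squares and triangular numbers.

double : ℕ → ℕ
double zero    = zero
double (suc n) = suc (suc (double n))

triangle : ℕ → ℕ
triangle zero    = zero
triangle (suc n) = triangle n ℕ.+ suc n

double≡+ : ∀ n → double n ≡ n ℕ.+ n
double≡+ zero    = ≡.refl
double≡+ (suc n) = ≡.cong suc (≡.trans (≡.cong suc (double≡+ n)) (≡.sym (ℕ.+-suc n n)))

module _ where
  open ℕ.+-*-Solver renaming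
    (solve to solveℕ; con to conℕ; _:=_ to _:≡_; _:+_ to _⊹_; _:*_ to _⊛_)
    hiding (_:^_; _:-_; :-_)

  -- Exponent of the first of the two triangular terms that `pairSum` takes together.
  triangle-double : ∀ n → triangle (double n) ≡ suc (double n) ℕ.* n
  triangle-double zero    = ≡.refl
  triangle-double (suc n) = ≡.trans
    (≡.cong (λ t → t ℕ.+ suc (double n) ℕ.+ suc (suc (double n))) (triangle-double n))
    (≡.subst (λ d → suc d ℕ.* n ℕ.+ suc d ℕ.+ suc (suc d) ≡ suc (suc (suc d)) ℕ.* suc n)
      (≡.sym (double≡+ n))
      (solveℕ 1 (λ n → let d = n ⊹ n in
        (conℕ 1 ⊹ d) ⊛ n ⊹ (conℕ 1 ⊹ d) ⊹ (conℕ 2 ⊹ d) :≡ (conℕ 3 ⊹ d) ⊛ (conℕ 1 ⊹ n))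
        ≡.refl n))

  -- Matches the odd squares in the theta series with the exponents of qψ(q⁸).
  8·triangle+1 : ∀ n → suc (8 ℕ.* triangle n) ≡ suc (double n) ℕ.* suc (double n)
  8·triangle+1 zero    = ≡.refl
  8·triangle+1 (suc n) = ≡.trans
    (solveℕ 2 (λ t n → conℕ 1 ⊹ conℕ 8 ⊛ (t ⊹ (conℕ 1 ⊹ n)) :≡
                       conℕ 1 ⊹ conℕ 8 ⊛ t ⊹ conℕ 8 ⊛ (conℕ 1 ⊹ n)) ≡.refl (triangle n) n)
    (≡.trans (≡.cong (ℕ._+ 8 ℕ.* suc n) (8·triangle+1 n))
    (≡.subst (λ d → suc d ℕ.* suc d ℕ.+ 8 ℕ.* suc n ≡ suc (suc (suc d)) ℕ.* suc (suc (suc d)))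
      (≡.sym (double≡+ n))
      (solveℕ 1 (λ n → let d = n ⊹ n in
        (conℕ 1 ⊹ d) ⊛ (conℕ 1 ⊹ d) ⊹ conℕ 8 ⊛ (conℕ 1 ⊹ n) :≡ (conℕ 3 ⊹ d) ⊛ (conℕ 3 ⊹ d))
        ≡.refl n)))

  double-square : ∀ n → let k = n ℕ.* n in
    double n ℕ.* double n ≡ (k ℕ.+ k) ℕ.+ (k ℕ.+ k)
  double-square n = ≡.subst (λ d → d ℕ.* d ≡ (n ℕ.* n ℕ.+ n ℕ.* n) ℕ.+ (n ℕ.* n ℕ.+ n ℕ.* n))
    (≡.sym (double≡+ n))
    (solveℕ 1 (λ n → (n ⊹ n) ⊛ (n ⊹ n) :≡ (n ⊛ n ⊹ n ⊛ n) ⊹ (n ⊛ n ⊹ n ⊛ n)) ≡.refl n)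

  8·≡ : ∀ k → let l = k ℕ.+ k in (l ℕ.+ l) ℕ.+ (l ℕ.+ l) ≡ 8 ℕ.* k
  8·≡ = solveℕ 1 (λ k → let l = k ⊹ k in (l ⊹ l) ⊹ (l ⊹ l) :≡ conℕ 8 ⊛ k) ≡.refl

infixl 6 _⊞_

-- The shorter list is padded with zeros; this adds coefficient lists for `horner` and exponent
-- vectors for `eta`.
_⊞_ : List ℤ → List ℤ → List ℤ
[]       ⊞ bs       = bs
(a ∷ as) ⊞ []       = a ∷ as
(a ∷ as) ⊞ (b ∷ bs) = (a ℤ.+ b) ∷ (as ⊞ bs)

module Theory (S : QSeriesRing) where
  open QSeriesRing S
  open SetoidReasoning setoid

  private
    ι-homomorphism : ℤ.+-*-rawRing -Raw-AlmostCommutative⟶ fromCommutativeRing commutativeRing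
    ι-homomorphism = record
      { ⟦_⟧ = ι ; +-homo = ι-+ ; *-homo = ι-* ; -‿homo = ι-‿ ; 0-homo = refl ; 1-homo = refl }

    ι-≟ : ∀ a b → Maybe (ι a ≈ ι b)
    ι-≟ a b with a ℤ.≟ b
    ... | yes ≡.refl = just refl
    ... | no  _      = nothing

  open RingSolver ℤ.+-*-rawRing (fromCommutativeRing commutativeRing) ι-homomorphism ι-≟ public
    using (solve; con; _:=_; _:+_; _:*_; _:^_; :-_; _:-_)

  -- Leaves to the ring solver the identity a - b = k (l - r), with both sides
  -- moved so that only the hypotheses themselves occur in it.
  linear : ∀ {a b l r} k → l ≈ r → a + k * r ≈ b + k * l → a ≈ b
  linear {a} {b} {l} {r} k l≈r eq = begin
    a                        ≈⟨ add-sub a (k * r) ⟩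
    a + k * r + - (k * r)    ≈⟨ +-congʳ eq ⟩
    b + k * l + - (k * r)    ≈⟨ +-congʳ (+-congˡ (*-congˡ l≈r)) ⟩
    b + k * r + - (k * r)    ≈⟨ add-sub b (k * r) ⟨
    b                        ∎
    where
    add-sub : ∀ a c → a ≈ a + c + - c
    add-sub = solve 2 (λ a c → a := a :+ c :- c) refl

  unit-cancel : ∀ {u i a b} → u * i ≈ 1# → u * a ≈ u * b → a ≈ b
  unit-cancel {u} {i} {a} {b} ui≈1 ua≈ub =
    linear a (sym ui≈1) (linear b ui≈1 (linear i ua≈ub
      (solve 4 (λ u i a b →
        a :+ a :* (u :* i) :+ b :* con 1ℤ :+ i :* (u :* b) :=
        b :+ a :* con 1ℤ :+ b :* (u :* i) :+ i :* (u :* a)) refl u i a b)))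

  module Endomorphism
    (φ      : Carrier → Carrier)
    (φ-cong : ∀ {f g} → f ≈ g → φ f ≈ φ g)
    (φ-+    : ∀ f g → φ (f + g) ≈ φ f + φ g)
    (φ-*    : ∀ f g → φ (f * g) ≈ φ f * φ g)
    (φ-ι    : ∀ c → φ (ι c) ≈ ι c)
    where

    φ-‿ : ∀ f → φ (- f) ≈ - φ f
    φ-‿ f = begin
      φ (- f)              ≈⟨ φ-cong (neg f) ⟩
      φ (ι -1ℤ * f)        ≈⟨ φ-* _ f ⟩
      φ (ι -1ℤ) * φ f      ≈⟨ *-congʳ (φ-ι -1ℤ) ⟩
      ι -1ℤ * φ f          ≈⟨ neg (φ f) ⟨
      - φ f                ∎
      where
      neg : ∀ f → - f ≈ ι -1ℤ * f
      neg = solve 1 (λ f → :- f := con -1ℤ :* f) refl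

    φ-^ : ∀ f n → φ (f ^ n) ≈ φ f ^ n
    φ-^ f zero    = φ-ι 1ℤ
    φ-^ f (suc n) = trans (φ-* f (f ^ n)) (*-congˡ (φ-^ f n))

    φ-ι* : ∀ c f → φ (ι c * f) ≈ ι c * φ f
    φ-ι* c f = trans (φ-* (ι c) f) (*-congʳ (φ-ι c))

    φ-1- : ∀ f → φ (1# + - f) ≈ 1# + - φ f
    φ-1- f = trans (φ-+ 1# (- f)) (+-cong (φ-ι 1ℤ) (φ-‿ f))

  open Endomorphism V V-cong V-+ V-* V-ι public
    renaming (φ-‿ to V-‿; φ-^ to V-^; φ-ι* to V-ι*; φ-1- to V-1-)
  open Endomorphism σ σ-cong σ-+ σ-* σ-ι public
    renaming (φ-‿ to σ-‿; φ-^ to σ-^; φ-ι* to σ-ι*; φ-1- to σ-1-)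

  V-q^ : ∀ n → V (q ^ n) ≈ q ^ n * q ^ n
  V-q^ n = begin
    V (q ^ n)      ≈⟨ V-^ q n ⟩
    V q ^ n        ≈⟨ ^-congˡ n V-q ⟩
    (q * q) ^ n    ≈⟨ ^-distrib-* q q n ⟩
    q ^ n * q ^ n  ∎

  σ-q^ : ∀ n → σ (q ^ n) ≈ ι -1ℤ ^ n * q ^ n
  σ-q^ n = begin
    σ (q ^ n)           ≈⟨ σ-^ q n ⟩
    σ q ^ n             ≈⟨ ^-congˡ n (trans σ-q (solve 1 (λ f → :- f := con -1ℤ :* f) refl q)) ⟩
    (ι -1ℤ * q) ^ n     ≈⟨ ^-distrib-* (ι -1ℤ) q n ⟩
    ι -1ℤ ^ n * q ^ n   ∎

  -- Congruences modulo powers of q.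

  infix 4 _≋_mod_

  record _≋_mod_ (f g : Carrier) (n : ℕ) : Set where
    constructor _by_
    field
      quotient : Carrier
      equality : f ≈ g + q ^ n * quotient

  module _ {n : ℕ} where

    ≋-reflexive : ∀ {f g} → f ≈ g → f ≋ g mod n
    ≋-reflexive {f} {g} f≈g = 0# by trans f≈g (solve 2 (λ g Q → g := g :+ Q :* con 0ℤ) refl g (q ^ n))

    ≋-refl : ∀ {f} → f ≋ f mod n
    ≋-refl = ≋-reflexive refl

    ≋-sym : ∀ {f g} → f ≋ g mod n → g ≋ f mod n
    ≋-sym {f} {g} (h by eq) = (- h) by linear (- 1#) eq
      (solve 4 (λ f g Q h → g :+ :- con 1ℤ :* (g :+ Q :* h) :=
                            f :+ Q :* :- h :+ :- con 1ℤ :* f) refl f g (q ^ n) h)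

    ≋-trans : ∀ {f g k} → f ≋ g mod n → g ≋ k mod n → f ≋ k mod n
    ≋-trans {f} {g} {k} (h by eq) (h′ by eq′) = (h + h′) by trans eq (trans (+-congʳ eq′)
      (solve 4 (λ k Q h h′ → k :+ Q :* h′ :+ Q :* h := k :+ Q :* (h :+ h′)) refl k (q ^ n) h h′))

    ≋-+ : ∀ {f g f′ g′} → f ≋ g mod n → f′ ≋ g′ mod n → f + f′ ≋ g + g′ mod n
    ≋-+ {f} {g} {f′} {g′} (h by eq) (h′ by eq′) = (h + h′) by trans (+-cong eq eq′)
      (solve 5 (λ g g′ Q h h′ → (g :+ Q :* h) :+ (g′ :+ Q :* h′) := g :+ g′ :+ Q :* (h :+ h′))
        refl g g′ (q ^ n) h h′)

    ≋-‿ : ∀ {f g} → f ≋ g mod n → - f ≋ - g mod n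
    ≋-‿ {f} {g} (h by eq) = (- h) by trans (-‿cong eq)
      (solve 3 (λ g Q h → :- (g :+ Q :* h) := :- g :+ Q :* :- h) refl g (q ^ n) h)

    ≋-* : ∀ {f g f′ g′} → f ≋ g mod n → f′ ≋ g′ mod n → f * f′ ≋ g * g′ mod n
    ≋-* {f} {g} {f′} {g′} (h by eq) (h′ by eq′) = (g * h′ + h * g′ + q ^ n * h * h′) by
      trans (*-cong eq eq′)
        (solve 5 (λ g g′ Q h h′ → (g :+ Q :* h) :* (g′ :+ Q :* h′) :=
                                  g :* g′ :+ Q :* (g :* h′ :+ h :* g′ :+ Q :* h :* h′))
          refl g g′ (q ^ n) h h′)

    ≋-V : ∀ {f g} → f ≋ g mod n → V f ≋ V g mod n
    ≋-V {f} {g} (h by eq) = (q ^ n * V h) by (begin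
      V f                              ≈⟨ V-cong eq ⟩
      V (g + q ^ n * h)                ≈⟨ V-+ g _ ⟩
      V g + V (q ^ n * h)              ≈⟨ +-congˡ (V-* (q ^ n) h) ⟩
      V g + V (q ^ n) * V h            ≈⟨ +-congˡ (*-congʳ (V-q^ n)) ⟩
      V g + q ^ n * q ^ n * V h        ≈⟨ +-congˡ (*-assoc _ _ _) ⟩
      V g + q ^ n * (q ^ n * V h)      ∎)

    ≋-σ : ∀ {f g} → f ≋ g mod n → σ f ≋ σ g mod n
    ≋-σ {f} {g} (h by eq) = (ι -1ℤ ^ n * σ h) by (begin
      σ f                                  ≈⟨ σ-cong eq ⟩
      σ (g + q ^ n * h)                    ≈⟨ σ-+ g _ ⟩
      σ g + σ (q ^ n * h)                  ≈⟨ +-congˡ (σ-* (q ^ n) h) ⟩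
      σ g + σ (q ^ n) * σ h                ≈⟨ +-congˡ (*-congʳ (σ-q^ n)) ⟩
      σ g + ι -1ℤ ^ n * q ^ n * σ h        ≈⟨ +-congˡ
        (solve 3 (λ s Q h → s :* Q :* h := Q :* (s :* h)) refl (ι -1ℤ ^ n) (q ^ n) (σ h)) ⟩
      σ g + q ^ n * (ι -1ℤ ^ n * σ h)      ∎)

  ≋-weaken : ∀ {f g} m {n} → f ≋ g mod (m ℕ.+ n) → f ≋ g mod n
  ≋-weaken {f} {g} m {n} (h by eq) = (q ^ m * h) by trans eq (+-congˡ (trans (*-congʳ (^-homo-* q m n))
    (solve 3 (λ P Q h → P :* Q :* h := Q :* (P :* h)) refl (q ^ m) (q ^ n) h)))

  ≋⇒≈ : ∀ {f g} → (∀ n → f ≋ g mod n) → f ≈ g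
  ≋⇒≈ {f} {g} f≋g = linear 1# (separated (f + - g) difference)
    (solve 2 (λ f g → f :+ con 1ℤ :* con 0ℤ := g :+ con 1ℤ :* (f :- g)) refl f g)
    where
    difference : ∀ n → ∃ λ h → f + - g ≈ q ^ n * h
    difference n = let h by eq = f≋g n in h , trans (+-congʳ eq)
      (solve 2 (λ g k → g :+ k :- g := k) refl g (q ^ n * h))

  -- Finite q-products and the q-binomial theorem.

  poch : Carrier → Carrier → ℕ → Carrier
  poch a p zero    = 1#
  poch a p (suc n) = poch a p n * (1# + - (a * p ^ n))

  euler : ℕ → Carrier
  euler = poch q q

  partial : (ℕ → Carrier) → Carrier → ℕ → Carrier
  partial c w zero    = 0#
  partial c w (suc n) = partial c w n + c n * w ^ n

  partial-cong : ∀ c {w w′} → w ≈ w′ → ∀ n → partial c w n ≈ partial c w′ n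
  partial-cong c w≈w′ zero    = refl
  partial-cong c w≈w′ (suc n) = +-cong (partial-cong c w≈w′ n) (*-congˡ (^-congˡ n w≈w′))

  -- Used with w a high power of q: modulo that power only the constant coefficient of the sum
  -- remains, which yields the limits of the finite identities.
  partial-head : ∀ c w n → ∃ λ h → partial c w (suc n) ≈ c 0 + w * h
  partial-head c w zero    = 0# ,
    solve 2 (λ c w → con 0ℤ :+ c :* con 1ℤ := c :+ w :* con 0ℤ) refl (c 0) w
  partial-head c w (suc n) = let h , eq = partial-head c w n in
    h + c (suc n) * w ^ n , trans (+-congʳ eq)
      (solve 5 (λ c w h d W → c :+ w :* h :+ d :* (w :* W) := c :+ w :* (h :+ d :* W))
        refl (c 0) w h (c (suc n)) (w ^ n))

  -- The q-binomial theorem f(pw)(1 - βw) = f(w)(1 - γw), with remainder.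
  q-binomial : ∀ c p β γ →
    (∀ s → c (suc s) * (1# + - (p ^ suc s)) ≈ c s * (γ + - (β * p ^ s))) →
    ∀ w m → partial c (p * w) m * (1# + - (β * w)) ≈
            partial c w m * (1# + - (γ * w)) + c m * (1# + - (p ^ m)) * w ^ m
  q-binomial c p β γ step w zero =
    solve 4 (λ c β γ w → con 0ℤ :* (con 1ℤ :- β :* w) :=
      con 0ℤ :* (con 1ℤ :- γ :* w) :+ c :* (con 1ℤ :- con 1ℤ) :* con 1ℤ)
      refl (c 0) β γ w
  q-binomial c p β γ step w (suc m) =
    linear 1# (q-binomial c p β γ step w m)
      (linear (- (w * w ^ m)) (step m)
        (linear (c m * (1# + - (β * w))) (^-distrib-* p w m)
          (solve 11 (λ X Y c c′ p P w W PW β γ →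
            (X :+ c :* PW) :* (con 1ℤ :- β :* w)
              :+ con 1ℤ :* (Y :* (con 1ℤ :- γ :* w) :+ c :* (con 1ℤ :- P) :* W)
              :+ :- (w :* W) :* (c :* (γ :- β :* P))
              :+ c :* (con 1ℤ :- β :* w) :* (P :* W) :=
            (Y :+ c :* W) :* (con 1ℤ :- γ :* w) :+ c′ :* (con 1ℤ :- p :* P) :* (w :* W)
              :+ con 1ℤ :* (X :* (con 1ℤ :- β :* w))
              :+ :- (w :* W) :* (c′ :* (con 1ℤ :- p :* P))
              :+ c :* (con 1ℤ :- β :* w) :* PW)
            refl (partial c (p * w) m) (partial c w m) (c m) (c (suc m)) p (p ^ m) w (w ^ m)
            ((p * w) ^ m) β γ)))

  -- Shanks' finite forms of Gauss's identities E₁²/E₂ = 1 + 2 Σ (-1)ⁿ q^(n²)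
  -- and E₂²/E₁ = Σ q^(n(n+1)/2)

  alternatingSquares : ℕ → Carrier
  alternatingSquares zero    = 1#
  alternatingSquares (suc n) =
    alternatingSquares n + ι (+ 2) * (ι -1ℤ ^ suc n * q ^ (suc n ℕ.* suc n))

  private module Squares where

    inv : ℕ → Carrier
    inv s = proj₁ (unit (q ^ s))

    -- (-1)^s (-1;q)_s / (q;q)_s, the q-binomial coefficients for p = q, β = 1, γ = -1.
    c : ℕ → Carrier
    c zero    = 1#
    c (suc s) = c s * (ι -1ℤ + - (1# * q ^ s)) * inv s

    c-step : ∀ s → c (suc s) * (1# + - (q ^ suc s)) ≈ c s * (ι -1ℤ + - (1# * q ^ s))
    c-step s = linear (c s * (ι -1ℤ + - (1# * q ^ s))) (proj₂ (unit (q ^ s)))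
      (solve 3 (λ a i Q → a :* i :* (con 1ℤ :- Q) :+ a :* con 1ℤ :=
                          a :+ a :* ((con 1ℤ :- Q) :* i))
        refl (c s * (ι -1ℤ + - (1# * q ^ s))) (inv s) (q ^ suc s))

    -- (-1;q)_n (1 + qⁿ) = 2 (-q;q)_n, because (-1;q)_n begins with the factor 2.
    c-closed : ∀ n → euler n * (c n * (1# + q ^ n)) ≈ ι (+ 2) * ι -1ℤ ^ n * poch (- q) q n
    c-closed zero = solve 0
      (con 1ℤ :* (con 1ℤ :* (con 1ℤ :+ con 1ℤ)) := con (+ 2) :* con 1ℤ :* con 1ℤ) refl
    c-closed (suc n) =
      linear (- (1# + q * q ^ n)) (c-closed n)
        (linear (euler n * (1# + q * q ^ n)) (c-step n)
          (solve 7 (λ N c c′ q Q s P →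
            N :* (con 1ℤ :- q :* Q) :* (c′ :* (con 1ℤ :+ q :* Q))
              :+ :- (con 1ℤ :+ q :* Q) :* (con (+ 2) :* s :* P)
              :+ N :* (con 1ℤ :+ q :* Q) :* (c :* (con -1ℤ :- con 1ℤ :* Q)) :=
            con (+ 2) :* (con -1ℤ :* s) :* (P :* (con 1ℤ :- (:- q :* Q)))
              :+ :- (con 1ℤ :+ q :* Q) :* (N :* (c :* (con 1ℤ :+ Q)))
              :+ N :* (con 1ℤ :+ q :* Q) :* (c′ :* (con 1ℤ :- q :* Q)))
            refl (euler n) (c n) (c (suc n)) q (q ^ n) (ι -1ℤ ^ n) (poch (- q) q n)))

    -- At w = qⁿ⁺¹ the q-binomial theorem trades 1 - w for 1 + w, which extends both products by one
    -- factor. Its remainder and the new last term of the sum make c (n+1) (1 + w) wⁿ⁺¹, and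
    -- `c-closed` turns this into the next square term.
    finite : ∀ n → poch (- q) q n * alternatingSquares n ≈ euler n * partial c (q ^ suc n) (suc n)
    finite zero = solve 1 (λ q → con 1ℤ :* con 1ℤ :=
      con 1ℤ :* (con 0ℤ :+ con 1ℤ :* con 1ℤ)) refl q
    finite (suc n) =
      linear (1# + W) (finite n)
      (linear (- euler n) (q-binomial c q 1# (ι -1ℤ) c-step W (suc n))
      (linear (- (euler n * (1# + - W) * c (suc n))) (^-distrib-* q W (suc n))
      (linear ((1# + W) * Wⁿ) (c-closed n)
      (linear (- (euler n * (1# + W) * Wⁿ)) (c-step n)
      (linear (poch (- q) q n * (1# + W) * ι (+ 2) * (ι -1ℤ ^ suc n)) (sym (^-assocʳ q (suc n) (suc n)))
      (solve 13 (λ P T q Q s W² N X Y c c′ Wq Wⁿ → let W = q :* Q in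
        P :* (con 1ℤ :- (:- q :* Q)) :* (T :+ con (+ 2) :* (con -1ℤ :* s :* W²))
          :+ (con 1ℤ :+ W) :* (N :* Y)
          :+ :- N :* (Y :* (con 1ℤ :- con -1ℤ :* W) :+ c′ :* (con 1ℤ :- W) :* Wⁿ)
          :+ (:- (N :* (con 1ℤ :- W) :* c′)) :* (W :* Wⁿ)
          :+ (con 1ℤ :+ W) :* Wⁿ :* (con (+ 2) :* s :* P)
          :+ (:- (N :* (con 1ℤ :+ W) :* Wⁿ)) :* (c :* (con -1ℤ :- con 1ℤ :* Q))
          :+ P :* (con 1ℤ :+ W) :* con (+ 2) :* (con -1ℤ :* s) :* Wⁿ :=
        N :* (con 1ℤ :- q :* Q) :* (X :+ c′ :* Wq)
          :+ (con 1ℤ :+ W) :* (P :* T)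
          :+ :- N :* (X :* (con 1ℤ :- con 1ℤ :* W))
          :+ (:- (N :* (con 1ℤ :- W) :* c′)) :* Wq
          :+ (con 1ℤ :+ W) :* Wⁿ :* (N :* (c :* (con 1ℤ :+ Q)))
          :+ (:- (N :* (con 1ℤ :+ W) :* Wⁿ)) :* (c′ :* (con 1ℤ :- q :* Q))
          :+ P :* (con 1ℤ :+ W) :* con (+ 2) :* (con -1ℤ :* s) :* W²)
        refl (poch (- q) q n) (alternatingSquares n) q (q ^ n) (ι -1ℤ ^ n) (q ^ (suc n ℕ.* suc n))
          (euler n) (partial c (q * W) (suc n)) (partial c W (suc n)) (c n) (c (suc n))
          ((q * W) ^ suc n) Wⁿ))))))
      where
      W  = q ^ suc n
      Wⁿ = W ^ suc n

  private module Triangles where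

    p : Carrier
    p = q * q

    inv : ℕ → Carrier
    inv s = proj₁ (unit (q * p ^ s))

    -- (q;q²)_s / (q²;q²)_s, the q-binomial coefficients for p = q², β = q, γ = 1.
    c : ℕ → Carrier
    c zero    = 1#
    c (suc s) = c s * (1# + - (q * p ^ s)) * inv s

    c-step : ∀ s → c (suc s) * (1# + - (p ^ suc s)) ≈ c s * (1# + - (q * p ^ s))
    c-step s = linear (c s * (1# + - (q * p ^ s))) (proj₂ (unit (q * p ^ s)))
      (solve 4 (λ a i q P → a :* i :* (con 1ℤ :- q :* q :* P) :+ a :* con 1ℤ :=
                            a :+ a :* ((con 1ℤ :- q :* (q :* P)) :* i))
        refl (c s * (1# + - (q * p ^ s))) (inv s) q (p ^ s))

    c-closed : ∀ n → poch p p n * c n ≈ poch q p n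
    c-closed zero    = *-identityˡ 1#
    c-closed (suc n) =
      linear (1# + - (q * p ^ n)) (c-closed n) (linear (poch p p n) (c-step n)
        (solve 6 (λ N c c′ q P O →
          N :* (con 1ℤ :- q :* q :* P) :* c′ :+ (con 1ℤ :- q :* P) :* O
            :+ N :* (c :* (con 1ℤ :- q :* P)) :=
          O :* (con 1ℤ :- q :* P) :+ (con 1ℤ :- q :* P) :* (N :* c)
            :+ N :* (c′ :* (con 1ℤ :- q :* q :* P)))
          refl (poch p p n) (c n) (c (suc n)) q (p ^ n) (poch q p n)))

    -- The summand is q^(n(2n+1)) + q^((n+1)(2n+1)): triangular numbers in consecutive pairs, one
    -- pair for each factor of (q;q²)_n.
    pairSum : ℕ → Carrier
    pairSum zero    = 0#
    pairSum (suc n) = pairSum n + (q * p ^ n) ^ n * (1# + q * p ^ n)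

    -- With w = q²ⁿ⁺¹ the q-binomial remainder and the new last term combine to c n (1 - w²) wⁿ.
    -- Here 1 - w extends (q;q²)_n, and (1 + w) wⁿ is the next summand of `pairSum`.
    finite : ∀ n → pairSum n * poch q p n ≈ poch p p n * partial c (q * p ^ n) n
    finite zero    = solve 0 (con 0ℤ :* con 1ℤ := con 1ℤ :* con 0ℤ) refl
    finite (suc n) = trans
      (linear (1# + - w) (finite n)
      (linear (- poch p p n) (q-binomial c p q 1# c-step w n)
      (linear (- (poch p p n * c n * (1# + - (q * w)))) (^-distrib-* p w n)
      (linear (- ((1# + - (w * w)) * w ^ n)) (c-closed n)
        (solve 10 (λ A q P wⁿ O N X Y c pwⁿ → let w = q :* P in
          (A :+ wⁿ :* (con 1ℤ :+ q :* P)) :* (O :* (con 1ℤ :- q :* P))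
            :+ (con 1ℤ :- w) :* (N :* Y)
            :+ (:- N) :* (Y :* (con 1ℤ :- con 1ℤ :* w) :+ c :* (con 1ℤ :- P) :* wⁿ)
            :+ (:- (N :* c :* (con 1ℤ :- q :* w))) :* (P :* wⁿ)
            :+ (:- ((con 1ℤ :- w :* w) :* wⁿ)) :* O :=
          (N :* (con 1ℤ :- q :* q :* P)) :* (X :+ c :* pwⁿ)
            :+ (con 1ℤ :- w) :* (A :* O)
            :+ (:- N) :* (X :* (con 1ℤ :- q :* w))
            :+ (:- (N :* c :* (con 1ℤ :- q :* w))) :* pwⁿ
            :+ (:- ((con 1ℤ :- w :* w) :* wⁿ)) :* (N :* c))
          refl (pairSum n) q (p ^ n) (w ^ n) (poch q p n) (poch p p n)
          (partial c (p * w) n) (partial c w n) (c n) ((p * w) ^ n))))))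
      (*-congˡ (partial-cong c
        (solve 2 (λ q P → q :* q :* (q :* P) := q :* (q :* q :* P)) refl q (p ^ n)) (suc n)))
      where w = q * p ^ n

  -- Dissection of the theta series and identities of finite Euler products.

  ≋-weaken-double : ∀ {f g} n → f ≋ g mod double n → f ≋ g mod n
  ≋-weaken-double {f} {g} n f≋g =
    ≋-weaken n (≡.subst (λ k → f ≋ g mod k) (double≡+ n) f≋g)

  q^-cong : ∀ {m n} → m ≡ n → q ^ m ≈ q ^ n
  q^-cong ≡.refl = refl

  q^-double : ∀ n → q ^ double n ≈ (q * q) ^ n
  q^-double zero    = refl
  q^-double (suc n) = trans (*-congˡ (*-congˡ (q^-double n))) (sym (*-assoc q q _))

  V-q^+ : ∀ n → V (q ^ n) ≈ q ^ (n ℕ.+ n)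
  V-q^+ n = trans (V-q^ n) (sym (^-homo-* q n n))

  triangles : ℕ → Carrier
  triangles zero    = 0#
  triangles (suc n) = triangles n + q ^ triangle n

  pairSum≈triangles : ∀ n → Triangles.pairSum n ≈ triangles (double n)
  pairSum≈triangles zero    = refl
  pairSum≈triangles (suc n) = begin
    pairSum n + (q * p ^ n) ^ n * (1# + q * p ^ n)
      ≈⟨ +-cong (pairSum≈triangles n)
          (*-cong (^-congˡ n (w≈ n)) (+-congˡ (w≈ n))) ⟩
    triangles (double n) + (q ^ suc (double n)) ^ n * (1# + q ^ suc (double n))
      ≈⟨ +-congˡ (*-congʳ (^-assocʳ q (suc (double n)) n)) ⟩
    triangles (double n) + q ^ (suc (double n) ℕ.* n) * (1# + q ^ suc (double n))
      ≈⟨ +-congˡ (*-congʳ (q^-cong (triangle-double n))) ⟨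
    triangles (double n) + q ^ triangle (double n) * (1# + q ^ suc (double n))
      ≈⟨ solve 3 (λ T t w → T :+ t :* (con 1ℤ :+ w) := T :+ t :+ t :* w) refl
          (triangles (double n)) (q ^ triangle (double n)) (q ^ suc (double n)) ⟩
    triangles (double n) + q ^ triangle (double n)
      + q ^ triangle (double n) * q ^ suc (double n)
      ≈⟨ +-congˡ (^-homo-* q (triangle (double n)) (suc (double n))) ⟨
    triangles (suc (suc (double n)))  ∎
    where
    open Triangles
    w≈ : ∀ n → q * p ^ n ≈ q ^ suc (double n)
    w≈ n = *-congˡ (sym (q^-double n))

  -1^double : ∀ n → ι -1ℤ ^ double n ≈ 1#
  -1^double zero    = refl
  -1^double (suc n) = trans (*-congˡ (*-congˡ (-1^double n)))
    (solve 0 (con -1ℤ :* (con -1ℤ :* con 1ℤ) := con 1ℤ) refl)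

  -1^-square : ∀ n → ι -1ℤ ^ n * ι -1ℤ ^ n ≈ 1#
  -1^-square zero    = *-identityˡ 1#
  -1^-square (suc n) = trans
    (solve 1 (λ s → con -1ℤ :* s :* (con -1ℤ :* s) := s :* s) refl (ι -1ℤ ^ n))
    (-1^-square n)

  -- n² and n have the same parity, so q ↦ -q removes the signs of the alternating theta series.
  -1^n² : ∀ n → ι -1ℤ ^ (n ℕ.* n) ≈ ι -1ℤ ^ n
  -1^n² zero    = refl
  -1^n² (suc n) = begin
    ι -1ℤ * ι -1ℤ ^ (n ℕ.+ n ℕ.* suc n)
      ≡⟨ ≡.cong (λ k → ι -1ℤ * ι -1ℤ ^ (n ℕ.+ k)) (ℕ.*-suc n n) ⟩
    ι -1ℤ * ι -1ℤ ^ (n ℕ.+ (n ℕ.+ n ℕ.* n))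
      ≈⟨ *-congˡ (trans (^-homo-* (ι -1ℤ) n _) (*-congˡ (^-homo-* (ι -1ℤ) n _))) ⟩
    ι -1ℤ * (s * (s * ι -1ℤ ^ (n ℕ.* n)))
      ≈⟨ *-congˡ (*-congˡ (*-congˡ (-1^n² n))) ⟩
    ι -1ℤ * (s * (s * s))
      ≈⟨ *-congˡ (trans (*-congˡ (-1^-square n)) (*-identityʳ s)) ⟩
    ι -1ℤ * s  ∎
    where s = ι -1ℤ ^ n

  -- Indices split by parity: (2k)² = 4k² with sign +, and (2k + 1)² = 8 · k(k + 1)/2 + 1 with sign
  -- -. The limit is φ(-q) = φ(q⁴) - 2qψ(q⁸).
  dissection : ∀ n → alternatingSquares (double n) ≈
    V (V (σ (alternatingSquares n))) + - (ι (+ 2) * (q * V (V (V (triangles n)))))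
  dissection zero = sym (begin
    V (V (σ 1#)) + - (ι (+ 2) * (q * V (V (V 0#))))
      ≈⟨ +-cong
          (trans (V-cong (trans (V-cong (σ-ι 1ℤ)) (V-ι 1ℤ))) (V-ι 1ℤ))
          (-‿cong (*-congˡ (*-congˡ
            (trans (V-cong (trans (V-cong (V-ι 0ℤ)) (V-ι 0ℤ))) (V-ι 0ℤ))))) ⟩
    1# + - (ι (+ 2) * (q * 0#))
      ≈⟨ solve 1 (λ q → con 1ℤ :- con (+ 2) :* (q :* con 0ℤ) := con 1ℤ) refl q ⟩
    1#  ∎)
  dissection (suc n) = begin
    T + ι (+ 2) * (ι -1ℤ * s * q ^ (a ℕ.* a))
      + ι (+ 2) * (ι -1ℤ * (ι -1ℤ * s) * q ^ (b ℕ.* b))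
      ≈⟨ +-cong (+-cong (dissection n) (*-congˡ (*-cong (*-congˡ (-1^double n)) odd)))
                (*-congˡ (*-cong (*-congˡ (*-congˡ (-1^double n))) even)) ⟩
    V²T′ + - (ι (+ 2) * (q * V³S)) + ι (+ 2) * (ι -1ℤ * 1# * (q * V³t))
      + ι (+ 2) * (ι -1ℤ * (ι -1ℤ * 1#) * V²Q)
      ≈⟨ solve 5 (λ T S q t Q →
          T :- con (+ 2) :* (q :* S) :+ con (+ 2) :* (con -1ℤ :* con 1ℤ :* (q :* t))
            :+ con (+ 2) :* (con -1ℤ :* (con -1ℤ :* con 1ℤ) :* Q) :=
          T :+ con (+ 2) :* Q :- con (+ 2) :* (q :* (S :+ t))) refl V²T′ V³S q V³t V²Q ⟩
    V²T′ + ι (+ 2) * V²Q + - (ι (+ 2) * (q * (V³S + V³t)))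
      ≈⟨ +-cong squares (-‿cong (*-congˡ (*-congˡ (sym (
          trans (V-cong (trans (V-cong (V-+ _ _)) (V-+ _ _))) (V-+ _ _)))))) ⟩
    V (V (σ (alternatingSquares (suc n))))
      + - (ι (+ 2) * (q * V (V (V (triangles (suc n))))))  ∎
    where
    a = suc (double n)
    b = suc a
    k = suc n ℕ.* suc n
    s = ι -1ℤ ^ double n
    s′ = ι -1ℤ ^ suc n
    T = alternatingSquares (double n)
    V²T′ = V (V (σ (alternatingSquares n)))
    V³S = V (V (V (triangles n)))
    V³t = V (V (V (q ^ triangle n)))
    V²Q = V (V (q ^ k))

    V²-q^ : ∀ m → V (V (q ^ m)) ≈ q ^ ((m ℕ.+ m) ℕ.+ (m ℕ.+ m))
    V²-q^ m = trans (V-cong (V-q^+ m)) (V-q^+ (m ℕ.+ m))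

    odd : q ^ (a ℕ.* a) ≈ q * V³t
    odd = begin
      q ^ (a ℕ.* a)                  ≈⟨ q^-cong (8·triangle+1 n) ⟨
      q * q ^ (8 ℕ.* triangle n)     ≈⟨ *-congˡ (q^-cong (8·≡ (triangle n))) ⟨
      q * q ^ (l ℕ.+ l)              ≈⟨ *-congˡ (trans (V-cong (V²-q^ (triangle n))) (V-q^+ l)) ⟨
      q * V³t                        ∎
      where l = let t = triangle n in (t ℕ.+ t) ℕ.+ (t ℕ.+ t)

    even : q ^ (b ℕ.* b) ≈ V²Q
    even = trans (q^-cong (double-square (suc n))) (sym (V²-q^ k))

    squares : V²T′ + ι (+ 2) * V²Q ≈ V (V (σ (alternatingSquares (suc n))))
    squares = sym (begin
      V (V (σ (alternatingSquares n + ι (+ 2) * (s′ * q ^ k))))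
        ≈⟨ V-cong (V-cong (trans (σ-+ _ _) (+-congˡ σ-term))) ⟩
      V (V (σ (alternatingSquares n) + ι (+ 2) * q ^ k))
        ≈⟨ trans (V-cong (V-+ _ _)) (V-+ _ _) ⟩
      V²T′ + V (V (ι (+ 2) * q ^ k))
        ≈⟨ +-congˡ (trans (V-cong (V-ι* _ _)) (V-ι* _ _)) ⟩
      V²T′ + ι (+ 2) * V²Q  ∎)
      where
      σ-term : σ (ι (+ 2) * (s′ * q ^ k)) ≈ ι (+ 2) * q ^ k
      σ-term = begin
        σ (ι (+ 2) * (s′ * q ^ k))
          ≈⟨ trans (σ-ι* _ _) (*-congˡ (trans (σ-* _ _) (*-congʳ
              (trans (σ-^ (ι -1ℤ) (suc n)) (^-congˡ (suc n) (σ-ι -1ℤ)))))) ⟩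
        ι (+ 2) * (s′ * σ (q ^ k))
          ≈⟨ *-congˡ (*-congˡ (trans (σ-q^ k) (*-congʳ (-1^n² (suc n))))) ⟩
        ι (+ 2) * (s′ * (s′ * q ^ k))
          ≈⟨ *-congˡ (*-assoc _ _ _) ⟨
        ι (+ 2) * (s′ * s′ * q ^ k)
          ≈⟨ *-congˡ (trans (*-congʳ (-1^-square (suc n))) (*-identityˡ _)) ⟩
        ι (+ 2) * q ^ k  ∎

  -- In the limit, E₁(q) E₁(-q) E₄ = E₂³.
  euler-conjugate : ∀ n → let N = euler (double n) in
    N * σ N * V (V (euler n)) ≈ V (euler n) * V (euler n) * V N
  euler-conjugate zero = trans
    (*-cong (*-congˡ (σ-ι 1ℤ)) (trans (V-cong (V-ι 1ℤ)) (V-ι 1ℤ)))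
    (sym (*-cong (*-cong (V-ι 1ℤ) (V-ι 1ℤ)) (V-ι 1ℤ)))
  euler-conjugate (suc n) = begin
    N * (1# + - (q * Q)) * (1# + - (q * (q * Q)))
      * σ (N * (1# + - (q * Q)) * (1# + - (q * (q * Q)))) * V (V (M * (1# + - (q * R))))
      ≈⟨ *-cong
           (*-cong
             (*-cong (*-congˡ (+-congˡ (-‿cong (*-congˡ Q≈))))
                     (+-congˡ (-‿cong (*-congˡ (*-congˡ Q≈)))))
             (trans (σ-* _ _) (*-cong (trans (σ-* _ _) (*-congˡ σ-odd)) σ-even)))
           (trans (V-cong V-M) (trans (V-* _ _) (*-congˡ V²-1-qR))) ⟩
    N * (1# + - (q * (R * R))) * (1# + - (q * (q * (R * R))))
      * (σ N * (1# + q * (R * R)) * (1# + - (q * (q * (R * R)))))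
      * (V (V M) * (1# + - (q * q * (q * q) * (R * R * (R * R)))))
      ≈⟨ linear
           ((1# + - (q * (R * R))) * (1# + - (q * (q * (R * R)))) * (1# + q * (R * R))
             * (1# + - (q * (q * (R * R)))) * (1# + - (q * q * (q * q) * (R * R * (R * R)))))
           (euler-conjugate n)
           (solve 7 (λ N q R N′ V²M VM VN → let x = q :* (R :* R) ; y = q :* (q :* (R :* R))
                                                z = q :* q :* (q :* q) :* (R :* R :* (R :* R))
                                                k = (con 1ℤ :- x) :* (con 1ℤ :- y) :* (con 1ℤ :+ x)
                                                      :* (con 1ℤ :- y) :* (con 1ℤ :- z) in
             N :* (con 1ℤ :- x) :* (con 1ℤ :- y) :* (N′ :* (con 1ℤ :+ x) :* (con 1ℤ :- y))
               :* (V²M :* (con 1ℤ :- z)) :+ k :* (VM :* VM :* VN) :=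
             VM :* (con 1ℤ :- q :* q :* (R :* R)) :* (VM :* (con 1ℤ :- q :* q :* (R :* R)))
               :* (VN :* (con 1ℤ :- x :* x) :* (con 1ℤ :- y :* y)) :+ k :* (N :* N′ :* V²M))
             refl N q R (σ N) (V (V M)) (V M) (V N)) ⟩
    V M * (1# + - (q * q * (R * R))) * (V M * (1# + - (q * q * (R * R))))
      * (V N * (1# + - (q * (R * R) * (q * (R * R))))
             * (1# + - (q * (q * (R * R)) * (q * (q * (R * R))))))
      ≈⟨ *-cong (*-cong V-M V-M)
           (trans (V-* _ _) (*-cong (trans (V-* _ _) (*-congˡ V-odd)) V-even)) ⟨
    V (M * (1# + - (q * R))) * V (M * (1# + - (q * R)))
      * V (N * (1# + - (q * Q)) * (1# + - (q * (q * Q))))  ∎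
    where
    N = euler (double n)
    M = euler n
    Q = q ^ double n
    R = q ^ n

    Q≈ : Q ≈ R * R
    Q≈ = trans (q^-double n) (^-distrib-* q q n)

    σ-odd : σ (1# + - (q * Q)) ≈ 1# + q * (R * R)
    σ-odd = begin
      σ (1# + - (q * Q))                         ≈⟨ σ-1- (q * Q) ⟩
      1# + - σ (q ^ suc (double n))              ≈⟨ +-congˡ (-‿cong (σ-q^ (suc (double n)))) ⟩
      1# + - (ι -1ℤ * ι -1ℤ ^ double n * (q * Q))
        ≈⟨ +-congˡ (-‿cong (*-cong (*-congˡ (-1^double n)) (*-congˡ Q≈))) ⟩
      1# + - (ι -1ℤ * 1# * (q * (R * R)))
        ≈⟨ solve 2 (λ q R → con 1ℤ :- con -1ℤ :* con 1ℤ :* (q :* (R :* R)) :=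
                           con 1ℤ :+ q :* (R :* R)) refl q R ⟩
      1# + q * (R * R)  ∎

    σ-even : σ (1# + - (q * (q * Q))) ≈ 1# + - (q * (q * (R * R)))
    σ-even = begin
      σ (1# + - (q * (q * Q)))                   ≈⟨ σ-1- (q * (q * Q)) ⟩
      1# + - σ (q ^ double (suc n))              ≈⟨ +-congˡ (-‿cong (σ-q^ (double (suc n)))) ⟩
      1# + - (ι -1ℤ ^ double (suc n) * (q * (q * Q)))
        ≈⟨ +-congˡ (-‿cong (*-cong (-1^double (suc n)) (*-congˡ (*-congˡ Q≈)))) ⟩
      1# + - (1# * (q * (q * (R * R))))          ≈⟨ +-congˡ (-‿cong (*-identityˡ _)) ⟩
      1# + - (q * (q * (R * R)))                 ∎

    V-1-q^ : ∀ m → V (1# + - (q ^ m)) ≈ 1# + - (q ^ m * q ^ m)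
    V-1-q^ m = trans (V-1- _) (+-congˡ (-‿cong (V-q^ m)))

    V-M : V (M * (1# + - (q * R))) ≈ V M * (1# + - (q * q * (R * R)))
    V-M = trans (V-* _ _) (*-congˡ (trans (V-1-q^ (suc n))
      (+-congˡ (-‿cong (solve 2 (λ q R → q :* R :* (q :* R) := q :* q :* (R :* R)) refl q R)))))

    V²-1-qR : V (1# + - (q * q * (R * R))) ≈ 1# + - (q * q * (q * q) * (R * R * (R * R)))
    V²-1-qR = trans (V-1- _) (+-congˡ (-‿cong
      (trans (V-* _ _) (*-cong (trans (V-* q q) (*-cong V-q V-q))
        (trans (V-* R R) (*-cong (V-q^ n) (V-q^ n)))))))

    V-odd : V (1# + - (q * Q)) ≈ 1# + - (q * (R * R) * (q * (R * R)))
    V-odd = trans (V-1-q^ (suc (double n))) (+-congˡ (-‿cong (*-cong (*-congˡ Q≈) (*-congˡ Q≈))))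

    V-even : V (1# + - (q * (q * Q))) ≈ 1# + - (q * (q * (R * R)) * (q * (q * (R * R))))
    V-even = trans (V-1-q^ (double (suc n)))
      (+-congˡ (-‿cong (*-cong (*-congˡ (*-congˡ Q≈)) (*-congˡ (*-congˡ Q≈)))))

  V-euler : ∀ n → V (euler n) ≈ poch (q * q) (q * q) n
  V-euler zero    = V-ι 1ℤ
  V-euler (suc n) = trans (V-* _ _) (*-cong (V-euler n) (trans (V-1- _)
    (+-congˡ (-‿cong (trans (V-* q (q ^ n))
      (*-cong V-q (trans (V-q^ n) (sym (^-distrib-* q q n)))))))))

  -- The factors 1 - qʲ with j up to 2n split by the parity of j.
  euler-double : ∀ n → euler (double n) ≈ V (euler n) * poch q (q * q) n
  euler-double n = trans (go n) (*-congʳ (sym (V-euler n)))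
    where
    go : ∀ n → euler (double n) ≈ poch (q * q) (q * q) n * poch q (q * q) n
    go zero    = sym (*-identityˡ 1#)
    go (suc n) = trans
      (*-cong (*-cong (go n) (+-congˡ (-‿cong (*-congˡ (q^-double n)))))
              (+-congˡ (-‿cong (*-congˡ (*-congˡ (q^-double n))))))
      (solve 4 (λ A B q P →
        A :* B :* (con 1ℤ :- q :* P) :* (con 1ℤ :- q :* (q :* P)) :=
        A :* (con 1ℤ :- q :* q :* P) :* (B :* (con 1ℤ :- q :* P)))
        refl (poch (q * q) (q * q) n) (poch q (q * q) n) q ((q * q) ^ n))

  -- 1 - q²ʲ = (1 - qʲ)(1 + qʲ), factor by factor.
  V-euler-± : ∀ n → V (euler n) ≈ euler n * poch (- q) q n
  V-euler-± zero    = trans (V-ι 1ℤ) (sym (*-identityˡ 1#))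
  V-euler-± (suc n) = trans (V-* _ _) (trans
    (*-cong (V-euler-± n) (trans (V-1- _) (+-congˡ (-‿cong (V-q^ (suc n))))))
    (solve 4 (λ N P q Q →
      N :* P :* (con 1ℤ :- q :* Q :* (q :* Q)) :=
      N :* (con 1ℤ :- q :* Q) :* (P :* (con 1ℤ :- :- q :* Q)))
      refl (euler n) (poch (- q) q n) q (q ^ n)))

  -- Membership in ℤ[g] and parity.

  infixl 6 _⊕_
  infixl 7 _⊗_

  -- A derivation instead of a coefficient list: ring operations are constructors and substitution
  -- is plain recursion. A list is extracted only at the end, by `coefficients`.
  data Polynomial (g : Carrier) : Carrier → Set where
    const : ∀ c → Polynomial g (ι c)
    gen   : Polynomial g g
    _⊕_   : ∀ {f f′} → Polynomial g f → Polynomial g f′ → Polynomial g (f + f′)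
    _⊗_   : ∀ {f f′} → Polynomial g f → Polynomial g f′ → Polynomial g (f * f′)
    resp  : ∀ {f f′} → f ≈ f′ → Polynomial g f → Polynomial g f′

  Polynomial-∘ : ∀ {g g′ f} → Polynomial g′ g → Polynomial g f → Polynomial g′ f
  Polynomial-∘ g∈ (const c)     = const c
  Polynomial-∘ g∈ gen           = g∈
  Polynomial-∘ g∈ (f∈ ⊕ f∈′)    = Polynomial-∘ g∈ f∈ ⊕ Polynomial-∘ g∈ f∈′
  Polynomial-∘ g∈ (f∈ ⊗ f∈′)    = Polynomial-∘ g∈ f∈ ⊗ Polynomial-∘ g∈ f∈′
  Polynomial-∘ g∈ (resp eq f∈)  = resp eq (Polynomial-∘ g∈ f∈)

  constantTerm : ∀ {g f} → Polynomial g f →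
    ∃ λ c → ∃ λ h → Polynomial g h × f ≈ ι c + g * h
  constantTerm {g} (const c) = c , 0# , const 0ℤ ,
    solve 2 (λ c g → c := c :+ g :* con 0ℤ) refl (ι c) g
  constantTerm {g} gen = 0ℤ , 1# , const 1ℤ ,
    solve 1 (λ g → g := con 0ℤ :+ g :* con 1ℤ) refl g
  constantTerm {g} (f∈ ⊕ f∈′) =
    let c , h , h∈ , eq = constantTerm f∈ ; c′ , h′ , h∈′ , eq′ = constantTerm f∈′
    in c ℤ.+ c′ , h + h′ , h∈ ⊕ h∈′ , trans (+-cong eq eq′)
      (trans (solve 5 (λ c c′ g h h′ → c :+ g :* h :+ (c′ :+ g :* h′) := c :+ c′ :+ g :* (h :+ h′))
        refl (ι c) (ι c′) g h h′) (+-congʳ (sym (ι-+ c c′))))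
  constantTerm {g} (f∈ ⊗ f∈′) =
    let c , h , h∈ , eq = constantTerm f∈ ; c′ , h′ , h∈′ , eq′ = constantTerm f∈′
    in c ℤ.* c′ , ι c * h′ + h * ι c′ + h * (g * h′) ,
      const c ⊗ h∈′ ⊕ h∈ ⊗ const c′ ⊕ h∈ ⊗ (gen ⊗ h∈′) , trans (*-cong eq eq′)
      (trans (solve 5 (λ c c′ g h h′ → (c :+ g :* h) :* (c′ :+ g :* h′) :=
          c :* c′ :+ g :* (c :* h′ :+ h :* c′ :+ h :* (g :* h′)))
        refl (ι c) (ι c′) g h h′) (+-congʳ (sym (ι-* c c′))))
  constantTerm (resp eq f∈) =
    let c , h , h∈ , eq′ = constantTerm f∈ in c , h , h∈ , trans (sym eq) eq′

  -- Congruence to 1 modulo 2ℤ[g]; the cofactor must itself be a polynomial in g so that it can be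
  -- expanded in `u` later.
  Odd : Carrier → Carrier → Set
  Odd g f = ∃ λ h → Polynomial g h × f ≈ 1# + ι (+ 2) * h

  odd-* : ∀ {g f f′} → Odd g f → Odd g f′ → Odd g (f * f′)
  odd-* (h , h∈ , eq) (h′ , h∈′ , eq′) =
    h + h′ + ι (+ 2) * (h * h′) , h∈ ⊕ h∈′ ⊕ const (+ 2) ⊗ (h∈ ⊗ h∈′) ,
    trans (*-cong eq eq′)
      (solve 2 (λ h h′ → (con 1ℤ :+ con (+ 2) :* h) :* (con 1ℤ :+ con (+ 2) :* h′) :=
        con 1ℤ :+ con (+ 2) :* (h :+ h′ :+ con (+ 2) :* (h :* h′))) refl h h′)

  odd-^ : ∀ {g f} n → Odd g f → Odd g (f ^ n)
  odd-^ zero    f-odd = 0# , const 0ℤ , solve 0 (con 1ℤ := con 1ℤ :+ con (+ 2) :* con 0ℤ) refl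
  odd-^ (suc n) f-odd = odd-* f-odd (odd-^ n f-odd)

  odd⇒polynomial : ∀ {g f} → Odd g f → Polynomial g f
  odd⇒polynomial (h , h∈ , eq) = resp (sym eq) (const 1ℤ ⊕ const (+ 2) ⊗ h∈)

  -- The substitution q ↦ q⁴ and the extraction of every fourth coefficient.

  V² U² : Carrier → Carrier
  V² f = V (V f)
  U² f = U (U f)

  V²-cong : ∀ {f g} → f ≈ g → V² f ≈ V² g
  V²-cong f≈g = V-cong (V-cong f≈g)

  V²-+ : ∀ f g → V² (f + g) ≈ V² f + V² g
  V²-+ f g = trans (V-cong (V-+ f g)) (V-+ _ _)

  V²-* : ∀ f g → V² (f * g) ≈ V² f * V² g
  V²-* f g = trans (V-cong (V-* f g)) (V-* _ _)

  V²-ι : ∀ c → V² (ι c) ≈ ι c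
  V²-ι c = trans (V-cong (V-ι c)) (V-ι c)

  U²-cong : ∀ {f g} → f ≈ g → U² f ≈ U² g
  U²-cong f≈g = U-cong (U-cong f≈g)

  U²-+ : ∀ f g → U² (f + g) ≈ U² f + U² g
  U²-+ f g = trans (U-cong (U-+ f g)) (U-+ _ _)

  -- Series in q⁴ act as scalars for the extraction.
  U²-V²* : ∀ f g → U² (V² f * g) ≈ f * U² g
  U²-V²* f g = trans (U-cong (U-V* (V f) g)) (U-V* f (U g))

  U²-V² : ∀ f → U² (V² f) ≈ f
  U²-V² f = begin
    U² (V² f)        ≈⟨ U²-cong (*-identityʳ _) ⟨
    U² (V² f * 1#)   ≈⟨ U²-V²* f 1# ⟩
    f * U² 1#        ≈⟨ *-congˡ (trans (U-cong U-1) U-1) ⟩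
    f * 1#           ≈⟨ *-identityʳ f ⟩
    f                ∎

  U-0 : U 0# ≈ 0#
  U-0 = begin
    U 0#               ≈⟨ U-cong (trans (*-congʳ (V-ι 0ℤ)) (zeroˡ 1#)) ⟨
    U (V 0# * 1#)      ≈⟨ U-V* 0# 1# ⟩
    0# * U 1#          ≈⟨ zeroˡ _ ⟩
    0#                 ∎

  U²-q : U² q ≈ 0#
  U²-q = trans (U-cong U-q) U-0

  -- q² = V q, so one `U` brings it back to q and the next annihilates it.
  U²-q² : U² (q * q) ≈ 0#
  U²-q² = begin
    U² (q * q)         ≈⟨ U²-cong (trans (*-identityʳ _) V-q) ⟨
    U² (V q * 1#)      ≈⟨ U-cong (trans (U-V* q 1#) (trans (*-congˡ U-1) (*-identityʳ q))) ⟩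
    U q                ≈⟨ U-q ⟩
    0#                 ∎

  U²-q³ : U² (q * q * q) ≈ 0#
  U²-q³ = begin
    U² (q * q * q)     ≈⟨ U²-cong (*-congʳ V-q) ⟨
    U² (V q * q)       ≈⟨ U-cong (trans (U-V* q q) (trans (*-congˡ U-q) (zeroʳ q))) ⟩
    U 0#               ≈⟨ U-0 ⟩
    0#                 ∎

  -- Coefficient lists of polynomials.

  horner : Carrier → List ℤ → Carrier
  horner g = foldr (λ c r → ι c + g * r) 0#

  horner-⊞ : ∀ g as bs → horner g as + horner g bs ≈ horner g (as ⊞ bs)
  horner-⊞ g []       bs       = +-identityˡ _
  horner-⊞ g (a ∷ as) []       = +-identityʳ _
  horner-⊞ g (a ∷ as) (b ∷ bs) = begin
    ι a + g * horner g as + (ι b + g * horner g bs)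
      ≈⟨ solve 5 (λ a b g p r → a :+ g :* p :+ (b :+ g :* r) := a :+ b :+ g :* (p :+ r))
          refl (ι a) (ι b) g (horner g as) (horner g bs) ⟩
    ι a + ι b + g * (horner g as + horner g bs)
      ≈⟨ +-cong (sym (ι-+ a b)) (*-congˡ (horner-⊞ g as bs)) ⟩
    horner g ((a ∷ as) ⊞ (b ∷ bs))  ∎

  horner-scale : ∀ g c as → ι c * horner g as ≈ horner g (map (c ℤ.*_) as)
  horner-scale g c []       = zeroʳ _
  horner-scale g c (a ∷ as) = begin
    ι c * (ι a + g * horner g as)
      ≈⟨ solve 4 (λ c a g p → c :* (a :+ g :* p) := c :* a :+ g :* (c :* p))
          refl (ι c) (ι a) g (horner g as) ⟩
    ι c * ι a + g * (ι c * horner g as)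
      ≈⟨ +-cong (sym (ι-* c a)) (*-congˡ (horner-scale g c as)) ⟩
    horner g (map (c ℤ.*_) (a ∷ as))  ∎

  -- f acts on lists, a product as the composite of its factors, so two lists are never multiplied.
  -- `coefficients` applies this action to the list of 1.
  horner-* : ∀ {g f} → Polynomial g f → ∀ as → ∃ λ bs → f * horner g as ≈ horner g bs
  horner-* {g} (const c) as = map (c ℤ.*_) as , horner-scale g c as
  horner-* {g} gen as = 0ℤ ∷ as , sym (+-identityˡ _)
  horner-* {g} (_⊕_ {f} {f′} f∈ f∈′) as =
    let bs , eq = horner-* f∈ as ; bs′ , eq′ = horner-* f∈′ as
    in bs ⊞ bs′ , trans (distribʳ (horner g as) f f′) (trans (+-cong eq eq′) (horner-⊞ g bs bs′))
  horner-* {g} (_⊗_ {f} {f′} f∈ f∈′) as =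
    let bs , eq = horner-* f∈′ as ; cs , eq′ = horner-* f∈ bs
    in cs , trans (*-assoc f f′ _) (trans (*-congˡ eq) eq′)
  horner-* (resp eq f∈) as = let bs , eq′ = horner-* f∈ as in bs , trans (*-congʳ (sym eq)) eq′

  coefficients : ∀ {g f} → Polynomial g f → ∃ λ as → f ≈ horner g as
  coefficients {g} {f} f∈ = let as , eq = horner-* f∈ (1ℤ ∷ []) in as , trans
    (solve 2 (λ f g → f := f :* (con 1ℤ :+ g :* con 0ℤ)) refl f g) eq

  -- The Euler product and Gauss's identities as limits.

  ∏ : (ℕ → Carrier) → ℕ → Carrier
  ∏ f zero    = 1#
  ∏ f (suc n) = ∏ f n * f n

  ≋-^ : ∀ {f g n} k → f ≋ g mod n → f ^ k ≋ g ^ k mod n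
  ≋-^ zero    f≋g = ≋-refl
  ≋-^ (suc k) f≋g = ≋-* f≋g (≋-^ k f≋g)

  -- e stands for E₁ = (q ; q)_∞.
  module EulerProduct (e : Carrier) (e-limit : ∀ n → e ≋ euler n mod n) where

    e₂ e₄ : Carrier
    e₂ = V e
    e₄ = V e₂

    e-limit-double : ∀ n → e ≋ euler (double n) mod n
    e-limit-double n = ≋-weaken-double n (e-limit (double n))

    e-conjugate : e * σ e * e₄ ≈ e₂ * e₂ * e₂
    e-conjugate = ≋⇒≈ λ n → ≋-trans
      (≋-* (≋-* (e-limit-double n) (≋-σ (e-limit-double n))) (≋-V (≋-V (e-limit n))))
      (≋-trans (≋-reflexive (euler-conjugate n))
        (≋-sym (≋-* (≋-* (≋-V (e-limit n)) (≋-V (e-limit n))) (≋-V (e-limit-double n)))))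

    -- Multiplying Shanks' identity by (q;q)_n completes (-q;q)_n to (q²;q²)_n, and the sum on the
    -- right reduces to its first term 1 modulo qⁿ⁺¹.
    alternatingSquares-limit : ∀ n → alternatingSquares n * e₂ ≋ e * e mod n
    alternatingSquares-limit n = ≋-trans (≋-* ≋-refl (≋-V (e-limit n)))
      (≋-trans (≋-weaken 1 finite)
        (≋-sym (≋-* (e-limit n) (e-limit n))))
      where
      finite : alternatingSquares n * V (euler n) ≋ euler n * euler n mod suc n
      finite = let h , eq = partial-head Squares.c (q ^ suc n) n in
        (euler n * euler n * h) by
        linear (alternatingSquares n) (V-euler-± n)
          (linear (euler n) (Squares.finite n)
          (linear (euler n * euler n) eq
          (solve 7 (λ T VN N P Y Q h →
            T :* VN :+ T :* (N :* P) :+ N :* (N :* Y) :+ N :* N :* (con 1ℤ :+ Q :* h) :=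
            N :* N :+ Q :* (N :* N :* h) :+ T :* VN :+ N :* (P :* T) :+ N :* N :* Y)
            refl (alternatingSquares n) (V (euler n)) (euler n) (poch (- q) q n)
            (partial Squares.c (q ^ suc n) (suc n)) (q ^ suc n) h)))

    -- As for the squares, now with a factor (q²;q²)_n, at n + 1 in place of n, that completes
    -- (q;q²)_n to (q;q)_2n.
    triangles-limit : ∀ n → triangles (double (suc n)) * e ≋ e₂ * e₂ mod suc n
    triangles-limit n = ≋-trans (≋-* ≋-refl (e-limit-double (suc n)))
      (≋-trans finite (≋-sym (≋-* (≋-V (e-limit (suc n))) (≋-V (e-limit (suc n))))))
      where
      open Triangles using (p; c; pairSum)
      finite : triangles (double (suc n)) * euler (double (suc n)) ≋
               V (euler (suc n)) * V (euler (suc n)) mod suc n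
      finite = let h , eq = partial-head c (q * p ^ suc n) n ; N = V (euler (suc n)) in
        (q * q ^ suc n * N * N * h) by
        linear (euler (double (suc n))) (sym (pairSum≈triangles (suc n)))
          (linear (pairSum (suc n)) (euler-double (suc n))
          (linear N (Triangles.finite (suc n))
          (linear (- (N * partial c (q * p ^ suc n) (suc n))) (V-euler (suc n))
          (linear (N * N) eq
          (linear (N * N * q * h) (^-distrib-* q q (suc n))
          (solve 11 (λ t E A N O Y q P h Q N′ →
            t :* E :+ E :* A :+ A :* (N :* O) :+ N :* (N′ :* Y) :+ (:- (N :* Y)) :* N′
              :+ N :* N :* (con 1ℤ :+ q :* P :* h) :+ N :* N :* q :* h :* (Q :* Q) :=
            N :* N :+ Q :* (q :* Q :* N :* N :* h) :+ E :* t :+ A :* E :+ N :* (A :* O)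
              :+ (:- (N :* Y)) :* N :+ N :* N :* Y :+ N :* N :* q :* h :* P)
            refl (triangles (double (suc n))) (euler (double (suc n))) (pairSum (suc n)) N
            (poch q p (suc n)) (partial c (q * p ^ suc n) (suc n)) q (p ^ suc n) h (q ^ suc n)
            (poch p p (suc n))))))))

    private
      -- `e-limit 1` writes e as 1 - q(1 - h), the shape that `unit` inverts.
      e-unit : ∃ λ i → e * i ≈ 1#
      e-unit =
        let h by eq = e-limit 1
            i , eq′ = unit (1# + - h)
        in i , linear i eq (linear 1# eq′
          (solve 4 (λ e q h i →
            e :* i :+ i :* (con 1ℤ :* (con 1ℤ :- q :* con 1ℤ) :+ q :* con 1ℤ :* h)
              :+ con 1ℤ :* con 1ℤ :=
            con 1ℤ :+ i :* e :+ con 1ℤ :* ((con 1ℤ :- q :* (con 1ℤ :- h)) :* i))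
            refl e q h i))

    e⁻¹ : Carrier
    e⁻¹ = proj₁ e-unit

    e*e⁻¹ : e * e⁻¹ ≈ 1#
    e*e⁻¹ = proj₂ e-unit

    -- Calculus of eta quotients.

    e^_ : ℤ → Carrier
    e^ (+ n)    = e ^ n
    e^ -[1+ n ] = e⁻¹ ^ suc n

    e^-⊖ : ∀ m n → e^ (m ⊖ n) ≈ e ^ m * e⁻¹ ^ n
    e^-⊖ m       zero    = sym (*-identityʳ _)
    e^-⊖ zero    (suc n) = sym (*-identityˡ _)
    e^-⊖ (suc m) (suc n) = begin
      e^ (suc m ⊖ suc n)               ≡⟨ ≡.cong e^_ (ℤ.[1+m]⊖[1+n]≡m⊖n m n) ⟩
      e^ (m ⊖ n)                       ≈⟨ e^-⊖ m n ⟩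
      e ^ m * e⁻¹ ^ n                  ≈⟨ linear (- (e ^ m * e⁻¹ ^ n)) e*e⁻¹
        (solve 4 (λ e i E I →
          E :* I :+ :- (E :* I) :* con 1ℤ := e :* E :* (i :* I) :+ :- (E :* I) :* (e :* i))
          refl e e⁻¹ (e ^ m) (e⁻¹ ^ n)) ⟩
      e * e ^ m * (e⁻¹ * e⁻¹ ^ n)      ∎

    e^-+ : ∀ a b → e^ (a ℤ.+ b) ≈ e^ a * e^ b
    e^-+ (+ m)    (+ n)    = ^-homo-* e m n
    e^-+ (+ m)    -[1+ n ] = e^-⊖ m (suc n)
    e^-+ -[1+ m ] (+ n)    = trans (e^-⊖ n (suc m)) (*-comm _ _)
    e^-+ -[1+ m ] -[1+ n ] = begin
      e⁻¹ ^ suc (suc (m ℕ.+ n))        ≡⟨ ≡.cong (λ k → e⁻¹ ^ suc k) (ℕ.+-suc m n) ⟨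
      e⁻¹ ^ (suc m ℕ.+ suc n)          ≈⟨ ^-homo-* e⁻¹ (suc m) (suc n) ⟩
      e⁻¹ ^ suc m * e⁻¹ ^ suc n        ∎

    -- E₁ᵃ E₂ᵇ E₄ᶜ ⋯ for the list a, b, c, … of exponents.
    eta : List ℤ → Carrier
    eta []       = 1#
    eta (a ∷ as) = e^ a * V (eta as)

    ⊟_ : List ℤ → List ℤ
    ⊟ []       = []
    ⊟ (a ∷ as) = (ℤ.- a) ∷ (⊟ as)

    eta-* : ∀ as bs → eta as * eta bs ≈ eta (as ⊞ bs)
    eta-* []       bs       = *-identityˡ _
    eta-* (a ∷ as) []       = *-identityʳ _
    eta-* (a ∷ as) (b ∷ bs) = begin
      e^ a * V (eta as) * (e^ b * V (eta bs))
        ≈⟨ solve 4 (λ a A b B → a :* A :* (b :* B) := a :* b :* (A :* B)) refl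
            (e^ a) (V (eta as)) (e^ b) (V (eta bs)) ⟩
      e^ a * e^ b * (V (eta as) * V (eta bs))
        ≈⟨ *-cong (e^-+ a b) (V-* _ _) ⟨
      e^ (a ℤ.+ b) * V (eta as * eta bs)
        ≈⟨ *-congˡ (V-cong (eta-* as bs)) ⟩
      eta ((a ∷ as) ⊞ (b ∷ bs))  ∎

    eta-⊟ : ∀ as → eta as * eta (⊟ as) ≈ 1#
    eta-⊟ as = trans (eta-* as (⊟ as)) (go as)
      where
      go : ∀ as → eta (as ⊞ ⊟ as) ≈ 1#
      go []       = refl
      go (a ∷ as) = begin
        e^ (a ℤ.+ ℤ.- a) * V (eta (as ⊞ ⊟ as))
          ≈⟨ *-cong (reflexive (≡.cong e^_ (ℤ.+-inverseʳ a))) (trans (V-cong (go as)) (V-ι 1ℤ)) ⟩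
        1# * 1#  ≈⟨ *-identityˡ 1# ⟩
        1#       ∎

    V-eta : ∀ as → V (eta as) ≈ eta (0ℤ ∷ as)
    V-eta as = sym (*-identityˡ _)

    -- Lists that differ by trailing zeros denote the same quotient. After trimming, an identity of
    -- eta quotients is settled by computing both lists.
    trim : List ℤ → List ℤ
    trim []       = []
    trim (a ∷ as) = cons a (trim as)
      where
      cons : ℤ → List ℤ → List ℤ
      cons (+ zero) [] = []
      cons a        as = a ∷ as

    eta-trim : ∀ as → eta (trim as) ≈ eta as
    eta-trim []       = refl
    eta-trim (a ∷ as) with trim as | eta-trim as
    eta-trim (+ zero    ∷ as) | []     | eq = begin
      1#             ≈⟨ V-ι 1ℤ ⟨
      V 1#           ≈⟨ V-cong eq ⟩
      V (eta as)     ≈⟨ *-identityˡ _ ⟨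
      1# * V (eta as) ∎
    eta-trim (+ suc n   ∷ as) | []     | eq = *-congˡ (V-cong eq)
    eta-trim (-[1+ n ]  ∷ as) | []     | eq = *-congˡ (V-cong eq)
    eta-trim (+ zero    ∷ as) | _ ∷ _  | eq = *-congˡ (V-cong eq)
    eta-trim (+ suc n   ∷ as) | _ ∷ _  | eq = *-congˡ (V-cong eq)
    eta-trim (-[1+ n ]  ∷ as) | _ ∷ _  | eq = *-congˡ (V-cong eq)

    eta-≡ : ∀ as bs → trim as ≡ trim bs → eta as ≈ eta bs
    eta-≡ as bs eq = begin
      eta as         ≈⟨ eta-trim as ⟨
      eta (trim as)  ≡⟨ ≡.cong eta eq ⟩
      eta (trim bs)  ≈⟨ eta-trim bs ⟩
      eta bs         ∎

    infixr 7 _⊠_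

    _⊠_ : ℕ → List ℤ → List ℤ
    zero  ⊠ as = []
    suc n ⊠ as = as ⊞ n ⊠ as

    eta-^ : ∀ n as → eta as ^ n ≈ eta (n ⊠ as)
    eta-^ zero    as = refl
    eta-^ (suc n) as = trans (*-congˡ (eta-^ n as)) (eta-* as (n ⊠ as))

    -- Theta functions and their relations.

    -- φ(-q), φ(q) and ψ(q) for the theta functions φ(q) = Σ q^(n²) (over
    -- all integers n) and ψ(q) = Σ q^(n(n+1)/2) (over n ≥ 0), as eta quotients.

    φ⁻ φ⁺ ψ : Carrier
    φ⁻ = eta (+ 2 ∷ -1ℤ ∷ [])
    φ⁺ = eta (-[1+ 1 ] ∷ + 5 ∷ -[1+ 1 ] ∷ [])
    ψ  = eta (-1ℤ ∷ + 2 ∷ [])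

    private
      e≈ : e ≈ eta (+ 1 ∷ [])
      e≈ = sym (trans (*-cong (*-identityʳ e) (V-ι 1ℤ)) (*-identityʳ e))

      e₂≈ : e₂ ≈ eta (+ 0 ∷ + 1 ∷ [])
      e₂≈ = trans (V-cong e≈) (V-eta (+ 1 ∷ []))

      e₄≈ : e₄ ≈ eta (+ 0 ∷ + 0 ∷ + 1 ∷ [])
      e₄≈ = trans (V-cong e₂≈) (V-eta (+ 0 ∷ + 1 ∷ []))

      eta-*₃ : ∀ as bs cs → trim (as ⊞ bs) ≡ trim cs → eta as * eta bs ≈ eta cs
      eta-*₃ as bs cs eq = trans (eta-* as bs) (eta-≡ (as ⊞ bs) cs eq)

      ≋-unit-cancel : ∀ {f g u i n} → u * i ≈ 1# → f * u ≋ g * u mod n → f ≋ g mod n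
      ≋-unit-cancel {f} {g} {u} {i} ui≈1 fu≋gu =
        ≋-trans (≋-reflexive (cancel f)) (≋-trans (≋-* fu≋gu ≋-refl) (≋-sym (≋-reflexive (cancel g))))
        where
        cancel : ∀ f → f ≈ f * u * i
        cancel f = sym (trans (*-assoc f u i) (trans (*-congˡ ui≈1) (*-identityʳ f)))

      e*e≈ : e * e ≈ φ⁻ * e₂
      e*e≈ = trans (*-cong e≈ e≈) (trans (eta-* (+ 1 ∷ []) (+ 1 ∷ []))
        (sym (trans (*-congˡ e₂≈) (eta-*₃ (+ 2 ∷ -1ℤ ∷ []) (+ 0 ∷ + 1 ∷ []) (+ 2 ∷ []) ≡.refl))))

      e₂*e₂≈ : e₂ * e₂ ≈ ψ * e
      e₂*e₂≈ = trans (*-cong e₂≈ e₂≈) (trans (eta-* (+ 0 ∷ + 1 ∷ []) (+ 0 ∷ + 1 ∷ []))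
        (sym (trans (*-congˡ e≈) (eta-* (-1ℤ ∷ + 2 ∷ []) (+ 1 ∷ [])))))

    φ⁻-series : ∀ n → alternatingSquares n ≋ φ⁻ mod n
    φ⁻-series n = ≋-unit-cancel (trans (*-congʳ e₂≈) (eta-⊟ (+ 0 ∷ + 1 ∷ [])))
      (≋-trans (alternatingSquares-limit n) (≋-reflexive e*e≈))

    ψ-series : ∀ n → triangles (double (suc n)) ≋ ψ mod suc n
    ψ-series n = ≋-unit-cancel e*e⁻¹ (≋-trans (triangles-limit n) (≋-reflexive e₂*e₂≈))

    -- Both sides are multiplied by E₁²E₂E₄². As σ fixes E₂ and φ(-q)E₂ = E₁², the left one becomes
    -- (E₁(q)E₁(-q)E₄)², which is E₂⁶ by `e-conjugate`.
    σ-φ⁻ : σ φ⁻ ≈ φ⁺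
    σ-φ⁻ = unit-cancel {eta u} {eta (⊟ u)} (eta-⊟ u) (begin
      eta u * σ φ⁻                           ≈⟨ *-congʳ u≈ ⟩
      e₂ * (e * e₄) * (e * e₄) * σ φ⁻
        ≈⟨ solve 4 (λ a b c f → a :* (b :* c) :* (b :* c) :* f := f :* a :* ((b :* c) :* (b :* c)))
            refl e₂ e e₄ (σ φ⁻) ⟩
      σ φ⁻ * e₂ * ((e * e₄) * (e * e₄))      ≈⟨ *-congʳ (begin
        σ φ⁻ * e₂                              ≈⟨ *-congˡ (σ-V e) ⟨
        σ φ⁻ * σ e₂                            ≈⟨ σ-* _ _ ⟨
        σ (φ⁻ * e₂)                            ≈⟨ σ-cong e*e≈ ⟨
        σ (e * e)                              ≈⟨ σ-* e e ⟩
        σ e * σ e                              ∎) ⟩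
      σ e * σ e * ((e * e₄) * (e * e₄))
        ≈⟨ solve 3 (λ b s c → s :* s :* (b :* c :* (b :* c)) := b :* s :* c :* (b :* s :* c)) refl e (σ e) e₄ ⟩
      e * σ e * e₄ * (e * σ e * e₄)          ≈⟨ *-cong e-conjugate e-conjugate ⟩
      e₂ * e₂ * e₂ * (e₂ * e₂ * e₂)
        ≈⟨ solve 1 (λ a → a :* a :* a :* (a :* a :* a) := a :^ 6) refl e₂ ⟩
      e₂ ^ 6                                 ≈⟨ ^-congˡ 6 e₂≈ ⟩
      eta (+ 0 ∷ + 1 ∷ []) ^ 6               ≈⟨ eta-^ 6 (+ 0 ∷ + 1 ∷ []) ⟩
      eta (+ 0 ∷ + 6 ∷ [])
        ≈⟨ eta-*₃ u (-[1+ 1 ] ∷ + 5 ∷ -[1+ 1 ] ∷ []) (+ 0 ∷ + 6 ∷ []) ≡.refl ⟨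
      eta u * φ⁺  ∎)
      where
      u = + 2 ∷ + 1 ∷ + 2 ∷ []
      u≈ : eta u ≈ e₂ * (e * e₄) * (e * e₄)
      u≈ = sym (begin
        e₂ * (e * e₄) * (e * e₄)
          ≈⟨ *-cong (*-cong e₂≈ ee₄≈) ee₄≈ ⟩
        eta (+ 0 ∷ + 1 ∷ []) * eta (+ 1 ∷ + 0 ∷ + 1 ∷ []) * eta (+ 1 ∷ + 0 ∷ + 1 ∷ [])
          ≈⟨ *-congʳ (eta-* (+ 0 ∷ + 1 ∷ []) (+ 1 ∷ + 0 ∷ + 1 ∷ [])) ⟩
        eta (+ 1 ∷ + 1 ∷ + 1 ∷ []) * eta (+ 1 ∷ + 0 ∷ + 1 ∷ [])
          ≈⟨ eta-* (+ 1 ∷ + 1 ∷ + 1 ∷ []) (+ 1 ∷ + 0 ∷ + 1 ∷ []) ⟩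
        eta u  ∎)
        where
        ee₄≈ : e * e₄ ≈ eta (+ 1 ∷ + 0 ∷ + 1 ∷ [])
        ee₄≈ = trans (*-cong e≈ e₄≈) (eta-* (+ 1 ∷ []) (+ 0 ∷ + 0 ∷ + 1 ∷ []))

    φ⁻-dissection : φ⁻ ≈ V (V φ⁺) + - (ι (+ 2) * (q * V (V (V ψ))))
    φ⁻-dissection = ≋⇒≈ λ n → let N = double (suc n) in
      ≋-trans (≋-sym (≋-weaken 1 (≋-weaken-double (suc n) (≋-weaken-double N (φ⁻-series (double N))))))
      (≋-trans (≋-reflexive (dissection N))
        (≋-+ (≋-V (≋-V (≋-trans (≋-σ (≋-weaken 1 (≋-weaken-double (suc n) (φ⁻-series N)))) (≋-reflexive σ-φ⁻))))
             (≋-‿ (≋-* ≋-refl (≋-* ≋-refl (≋-V (≋-V (≋-V (≋-weaken 1 (ψ-series n))))))))))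

    -- In terms of theta functions: v = φ(q⁴)/φ(-q), m = φ(q)/φ(-q),
    -- w = φ(q²)²/φ(-q)², y = qψ(q⁸)/φ(q⁴), x = qψ(q⁴)²/φ(-q)².

    y₀ y v m w x z : Carrier
    y₀ = eta (+ 2 ∷ -[1+ 5 ] ∷ + 4 ∷ [])
    y  = q * V (V y₀)
    v  = eta (-[1+ 1 ] ∷ + 1 ∷ -[1+ 1 ] ∷ + 5 ∷ -[1+ 1 ] ∷ [])
    m  = eta (-[1+ 3 ] ∷ + 6 ∷ -[1+ 1 ] ∷ [])
    w  = eta (-[1+ 3 ] ∷ -[1+ 1 ] ∷ + 10 ∷ -[1+ 3 ] ∷ [])
    x  = q * eta (-[1+ 3 ] ∷ + 2 ∷ -[1+ 1 ] ∷ + 4 ∷ [])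
    z  = q * y₀ ^ 4

    private
      φ⁻¹ : Carrier
      φ⁻¹ = eta (-[1+ 1 ] ∷ + 1 ∷ [])

      φ⁻*φ⁻¹ : φ⁻ * φ⁻¹ ≈ 1#
      φ⁻*φ⁻¹ = eta-⊟ (+ 2 ∷ -1ℤ ∷ [])

      V²-eta : ∀ as → V (V (eta as)) ≈ eta (0ℤ ∷ 0ℤ ∷ as)
      V²-eta as = trans (V-cong (V-eta as)) (V-eta (0ℤ ∷ as))

      V³-eta : ∀ as → V (V (V (eta as))) ≈ eta (0ℤ ∷ 0ℤ ∷ 0ℤ ∷ as)
      V³-eta as = trans (V-cong (V²-eta as)) (V-eta (0ℤ ∷ 0ℤ ∷ as))

      y≈ : y ≈ q * eta (+ 0 ∷ + 0 ∷ + 2 ∷ -[1+ 5 ] ∷ + 4 ∷ [])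
      y≈ = *-congˡ (V²-eta (+ 2 ∷ -[1+ 5 ] ∷ + 4 ∷ []))

      q*eta-* : ∀ {f} as bs cs → f ≈ q * eta as → trim (as ⊞ bs) ≡ trim cs → f * eta bs ≈ q * eta cs
      q*eta-* as bs cs f≈ eq = trans (*-congʳ f≈) (trans (*-assoc _ _ _) (*-congˡ (eta-*₃ as bs cs eq)))

      yv≈ : y * v ≈ q * eta (-[1+ 1 ] ∷ + 1 ∷ + 0 ∷ -1ℤ ∷ + 2 ∷ [])
      yv≈ = q*eta-* (+ 0 ∷ + 0 ∷ + 2 ∷ -[1+ 5 ] ∷ + 4 ∷ [])
        (-[1+ 1 ] ∷ + 1 ∷ -[1+ 1 ] ∷ + 5 ∷ -[1+ 1 ] ∷ [])
        (-[1+ 1 ] ∷ + 1 ∷ + 0 ∷ -1ℤ ∷ + 2 ∷ []) y≈ ≡.refl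

      yv≈ψ/φ⁻ : y * v ≈ q * (V (V (V ψ)) * φ⁻¹)
      yv≈ψ/φ⁻ = trans yv≈ (*-congˡ (sym (trans (*-congʳ (V³-eta (-1ℤ ∷ + 2 ∷ [])))
        (eta-*₃ (+ 0 ∷ + 0 ∷ + 0 ∷ -1ℤ ∷ + 2 ∷ []) (-[1+ 1 ] ∷ + 1 ∷ [])
          (-[1+ 1 ] ∷ + 1 ∷ + 0 ∷ -1ℤ ∷ + 2 ∷ []) ≡.refl))))

      φ⁺-dissection : φ⁺ ≈ V (V φ⁺) + ι (+ 2) * (q * V (V (V ψ)))
      φ⁺-dissection = begin
        φ⁺       ≈⟨ σ-φ⁻ ⟨
        σ φ⁻     ≈⟨ σ-cong φ⁻-dissection ⟩
        σ (V (V φ⁺) + - (ι (+ 2) * (q * V (V (V ψ)))))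
          ≈⟨ trans (σ-+ _ _) (+-cong (σ-V _) (trans (σ-‿ _) (-‿cong (trans (σ-ι* _ _)
              (*-congˡ (trans (σ-* _ _) (*-cong σ-q (σ-V _)))))))) ⟩
        V (V φ⁺) + - (ι (+ 2) * (- q * V (V (V ψ))))
          ≈⟨ solve 3 (λ a q b → a :- con (+ 2) :* (:- q :* b) := a :+ con (+ 2) :* (q :* b)) refl
              (V (V φ⁺)) q (V (V (V ψ))) ⟩
        V (V φ⁺) + ι (+ 2) * (q * V (V (V ψ)))  ∎

      -- At q² this reads φ(-q²)² = φ(q)φ(-q), a difference of squares by the two dissections;
      -- `V-injective` then undoes q ↦ q².
      φ⁻² : φ⁻ * φ⁻ ≈ V φ⁺ * V φ⁺ + - (ι (+ 4) * (q * (V (V ψ) * V (V ψ))))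
      φ⁻² = V-injective (begin
        V (φ⁻ * φ⁻)      ≈⟨ trans (V-* _ _) (*-cong Vφ⁻ Vφ⁻) ⟩
        eta Vφs * eta Vφs
          ≈⟨ eta-* Vφs Vφs ⟩
        eta (+ 0 ∷ + 4 ∷ -[1+ 1 ] ∷ [])
          ≈⟨ eta-*₃ (+ 2 ∷ -1ℤ ∷ []) (-[1+ 1 ] ∷ + 5 ∷ -[1+ 1 ] ∷ []) (+ 0 ∷ + 4 ∷ -[1+ 1 ] ∷ []) ≡.refl ⟨
        φ⁻ * φ⁺
          ≈⟨ *-cong φ⁻-dissection φ⁺-dissection ⟩
        (a + - (ι (+ 2) * (q * b))) * (a + ι (+ 2) * (q * b))
          ≈⟨ solve 3 (λ a q b → (a :- con (+ 2) :* (q :* b)) :* (a :+ con (+ 2) :* (q :* b)) :=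
                               a :* a :- con (+ 4) :* (q :* q :* (b :* b))) refl a q b ⟩
        a * a + - (ι (+ 4) * (q * q * (b * b)))
          ≈⟨ trans (V-+ _ _) (+-cong (V-* _ _) (trans (V-‿ _) (-‿cong (trans (V-ι* _ _)
              (*-congˡ (trans (V-* _ _) (*-cong V-q (V-* _ _)))))))) ⟨
        V (V φ⁺ * V φ⁺ + - (ι (+ 4) * (q * (V (V ψ) * V (V ψ)))))  ∎)
        where
        a = V (V φ⁺)
        b = V (V (V ψ))
        Vφs = + 0 ∷ + 2 ∷ -1ℤ ∷ []
        Vφ⁻ : V φ⁻ ≈ eta Vφs
        Vφ⁻ = V-eta (+ 2 ∷ -1ℤ ∷ [])

    -- φ(q⁴) = φ(-q) + 2qψ(q⁸) divided by φ(-q), since yv = qψ(q⁸)/φ(-q).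
    v≈ : v ≈ 1# + ι (+ 2) * (y * v)
    v≈ = begin
      v
        ≈⟨ trans (*-congʳ (V²-eta (-[1+ 1 ] ∷ + 5 ∷ -[1+ 1 ] ∷ [])))
             (eta-* (+ 0 ∷ + 0 ∷ -[1+ 1 ] ∷ + 5 ∷ -[1+ 1 ] ∷ []) (-[1+ 1 ] ∷ + 1 ∷ [])) ⟨
      V (V φ⁺) * φ⁻¹
        ≈⟨ linear (- φ⁻¹) φ⁻-dissection (linear 1# φ⁻*φ⁻¹ (linear (- ι (+ 2)) yv≈ψ/φ⁻
            (solve 6 (λ a i f q b yv →
              a :* i :+ (:- i) :* (a :- con (+ 2) :* (q :* b)) :+ con 1ℤ :* con 1ℤ
                :+ (:- con (+ 2)) :* (q :* (b :* i)) :=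
              con 1ℤ :+ con (+ 2) :* yv :+ (:- i) :* f :+ con 1ℤ :* (f :* i)
                :+ (:- con (+ 2)) :* yv)
              refl (V (V φ⁺)) φ⁻¹ φ⁻ q (V (V (V ψ))) (y * v)))) ⟩
      1# + ι (+ 2) * (y * v)  ∎

    -- The dissections give φ(q) - φ(-q) = 4qψ(q⁸), to be divided by φ(-q).
    m≈ : m ≈ 1# + ι (+ 4) * (y * v)
    m≈ = begin
      m
        ≈⟨ eta-* (-[1+ 1 ] ∷ + 5 ∷ -[1+ 1 ] ∷ []) (-[1+ 1 ] ∷ + 1 ∷ []) ⟨
      φ⁺ * φ⁻¹
        ≈⟨ linear φ⁻¹ φ⁺-dissection (linear (- φ⁻¹) φ⁻-dissection (linear 1# φ⁻*φ⁻¹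
            (linear (- ι (+ 4)) yv≈ψ/φ⁻
            (solve 7 (λ a i f q b yv p →
              p :* i :+ i :* (a :+ con (+ 2) :* (q :* b)) :+ (:- i) :* (a :- con (+ 2) :* (q :* b))
                :+ con 1ℤ :* con 1ℤ :+ (:- con (+ 4)) :* (q :* (b :* i)) :=
              con 1ℤ :+ con (+ 4) :* yv :+ i :* p :+ (:- i) :* f :+ con 1ℤ :* (f :* i)
                :+ (:- con (+ 4)) :* yv)
              refl (V (V φ⁺)) φ⁻¹ φ⁻ q (V (V (V ψ))) (y * v) φ⁺)))) ⟩
      1# + ι (+ 4) * (y * v)  ∎

    -- The relation `φ⁻²` divided by φ(-q)².
    w≈ : w ≈ 1# + ι (+ 4) * x
    w≈ = begin
      w
        ≈⟨ w-quotient ⟨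
      V φ⁺ * V φ⁺ * (φ⁻¹ * φ⁻¹)
        ≈⟨ linear (- (φ⁻¹ * φ⁻¹)) φ⁻² (linear (1# + φ⁻ * φ⁻¹) φ⁻*φ⁻¹ (linear (- ι (+ 4)) x-quotient
            (solve 6 (λ a i f q b x →
              a :* a :* (i :* i) :+ (:- (i :* i)) :* (a :* a :- con (+ 4) :* (q :* (b :* b)))
                :+ (con 1ℤ :+ f :* i) :* con 1ℤ :+ (:- con (+ 4)) :* (q :* (b :* b :* (i :* i))) :=
              con 1ℤ :+ con (+ 4) :* x :+ (:- (i :* i)) :* (f :* f)
                :+ (con 1ℤ :+ f :* i) :* (f :* i) :+ (:- con (+ 4)) :* x)
              refl (V φ⁺) φ⁻¹ φ⁻ q (V (V ψ)) x))) ⟩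
      1# + ι (+ 4) * x  ∎
      where
      ii = -[1+ 3 ] ∷ + 2 ∷ []
      i*i≈ : φ⁻¹ * φ⁻¹ ≈ eta ii
      i*i≈ = eta-* (-[1+ 1 ] ∷ + 1 ∷ []) (-[1+ 1 ] ∷ + 1 ∷ [])

      w-quotient : V φ⁺ * V φ⁺ * (φ⁻¹ * φ⁻¹) ≈ w
      w-quotient = trans
        (*-cong (trans (*-cong Vφ⁺ Vφ⁺) (eta-* fs fs)) i*i≈)
        (eta-* (fs ⊞ fs) ii)
        where
        fs = + 0 ∷ -[1+ 1 ] ∷ + 5 ∷ -[1+ 1 ] ∷ []
        Vφ⁺ : V φ⁺ ≈ eta fs
        Vφ⁺ = V-eta (-[1+ 1 ] ∷ + 5 ∷ -[1+ 1 ] ∷ [])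

      x-quotient : x ≈ q * (V (V ψ) * V (V ψ) * (φ⁻¹ * φ⁻¹))
      x-quotient = *-congˡ (sym (trans
        (*-cong (trans (*-cong V²ψ V²ψ) (eta-* ps ps)) i*i≈)
        (eta-* (ps ⊞ ps) ii)))
        where
        ps = + 0 ∷ + 0 ∷ -1ℤ ∷ + 2 ∷ []
        V²ψ : V (V ψ) ≈ eta ps
        V²ψ = V²-eta (-1ℤ ∷ + 2 ∷ [])

    -- The eta identity ψ(q)² = φ(q)ψ(q²), taken at q⁴.
    x≈ : x ≈ y * v * v
    x≈ = sym (q*eta-* (-[1+ 1 ] ∷ + 1 ∷ + 0 ∷ -1ℤ ∷ + 2 ∷ [])
      (-[1+ 1 ] ∷ + 1 ∷ -[1+ 1 ] ∷ + 5 ∷ -[1+ 1 ] ∷ [])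
      (-[1+ 3 ] ∷ + 2 ∷ -[1+ 1 ] ∷ + 4 ∷ []) yv≈ ≡.refl)

    -- Both sides are the same eta quotient. Since m⁴ = 1 + T, it says z(1 + T) = t, and at q⁴ it
    -- becomes κy⁴ = V²(t).
    z*m⁴≈ : z * m ^ 4 ≈ x * w
    z*m⁴≈ = begin
      q * y₀ ^ 4 * m ^ 4
        ≈⟨ trans (*-assoc _ _ _) (*-congˡ (*-cong (eta-^ 4 ys) (eta-^ 4 ms))) ⟩
      q * (eta (4 ⊠ ys) * eta (4 ⊠ ms))
        ≈⟨ *-congˡ (trans (eta-* (4 ⊠ ys) (4 ⊠ ms)) (eta-≡ (4 ⊠ ys ⊞ 4 ⊠ ms) (xs ⊞ ws) ≡.refl)) ⟩
      q * eta (xs ⊞ ws)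
        ≈⟨ trans (*-assoc _ _ _) (*-congˡ (eta-* xs ws)) ⟨
      x * w  ∎
      where
      ys = + 2 ∷ -[1+ 5 ] ∷ + 4 ∷ []
      ms = -[1+ 3 ] ∷ + 6 ∷ -[1+ 1 ] ∷ []
      ws = -[1+ 3 ] ∷ -[1+ 1 ] ∷ + 10 ∷ -[1+ 3 ] ∷ []
      xs = -[1+ 3 ] ∷ + 2 ∷ -[1+ 1 ] ∷ + 4 ∷ []

    -- Expansions in powers of u over series in q⁴.

    u t T κ : Carrier
    u = ι (+ 2) * y
    t = x * w
    T = ι (+ 16) * t
    κ = V² (1# + T)

    private
      4yv≈ : ι (+ 4) * (y * v) ≈ ι (+ 2) * (v + - 1#)
      4yv≈ = linear (- ι (+ 2)) v≈
        (solve 2 (λ a v → con (+ 4) :* a :+ (:- con (+ 2)) :* (con 1ℤ :+ con (+ 2) :* a) :=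
          con (+ 2) :* (v :- con 1ℤ) :+ (:- con (+ 2)) :* v) refl (y * v) v)

      z*1+T≈t : z * (1# + T) ≈ t
      z*1+T≈t = trans (*-congˡ (sym m⁴≈)) z*m⁴≈
        where
        -- (1 + 4yv)² = 1 + 8yv(1 + 2yv) = 1 + 8yv², and yv² = x.
        m²≈ : m * m ≈ 1# + ι (+ 8) * x
        m²≈ = linear (m + (1# + ι (+ 4) * (y * v))) m≈
          (linear (- (ι (+ 8) * (y * v))) v≈
          (linear (- ι (+ 8)) x≈
          (solve 4 (λ m y v x → let yv = y :* v ; k = m :+ (con 1ℤ :+ con (+ 4) :* yv) in
            m :* m :+ k :* (con 1ℤ :+ con (+ 4) :* yv)
              :+ (:- (con (+ 8) :* yv)) :* (con 1ℤ :+ con (+ 2) :* yv)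
              :+ (:- con (+ 8)) :* (y :* v :* v) :=
            con 1ℤ :+ con (+ 8) :* x :+ k :* m :+ (:- (con (+ 8) :* yv)) :* v
              :+ (:- con (+ 8)) :* x)
            refl m y v x)))
        -- (1 + 8x)² = 1 + 16x(1 + 4x).
        m⁴≈ : m ^ 4 ≈ 1# + T
        m⁴≈ = linear (m * m + (1# + ι (+ 8) * x)) m²≈ (linear (- (ι (+ 16) * x)) w≈
          (solve 3 (λ m x w → let n = con 1ℤ :+ con (+ 8) :* x in
            m :^ 4 :+ (m :* m :+ n) :* n :+ (:- (con (+ 16) :* x)) :* (con 1ℤ :+ con (+ 4) :* x) :=
            con 1ℤ :+ con (+ 16) :* (x :* w) :+ (m :* m :+ n) :* (m :* m)
              :+ (:- (con (+ 16) :* x)) :* w) refl m x w))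

      y⁴≈ : y ^ 4 ≈ V² z
      y⁴≈ = begin
        (q * V² y₀) ^ 4       ≈⟨ ^-distrib-* q _ 4 ⟩
        q ^ 4 * V² y₀ ^ 4     ≈⟨ *-cong q⁴≈ (trans (V-cong (V-^ y₀ 4)) (V-^ (V y₀) 4)) ⟨
        V² q * V² (y₀ ^ 4)    ≈⟨ V²-* q (y₀ ^ 4) ⟨
        V² z                  ∎
        where
        q⁴≈ : V² q ≈ q ^ 4
        q⁴≈ = trans (V-cong V-q) (trans (V-* q q) (trans (*-cong V-q V-q)
          (solve 1 (λ q → q :* q :* (q :* q) := q :^ 4) refl q)))

      κ≈ : κ ≈ 1# + V² T
      κ≈ = trans (V²-+ 1# T) (+-congʳ (V²-ι 1ℤ))

      u⁴κ≈ : u ^ 4 * κ ≈ V² T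
      u⁴κ≈ = begin
        u ^ 4 * κ
          ≈⟨ solve 2 (λ y k → (con (+ 2) :* y) :^ 4 :* k := con (+ 16) :* (y :^ 4 :* k)) refl y κ ⟩
        ι (+ 16) * (y ^ 4 * κ)
          ≈⟨ *-congˡ (trans (*-congʳ y⁴≈) (sym (V²-* z (1# + T)))) ⟩
        ι (+ 16) * V² (z * (1# + T))
          ≈⟨ trans (V²-* _ _) (*-cong (V²-ι (+ 16)) (V²-cong (sym z*1+T≈t))) ⟨
        V² T  ∎

    -- The expansion of f in powers of u over the image of V², which contains u⁴.
    -- The factor κ keeps the coefficients polynomial in T, as V²(T) = κu⁴.
    record Section (f c₀ c₁ c₂ c₃ : Carrier) : Set where
      constructor section
      field expansion : f ≈ κ * (V² c₀ + V² c₁ * u + V² c₂ * u ^ 2 + V² c₃ * u ^ 3)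
    open Section

    section-resp : ∀ {f f′ c₀ c₁ c₂ c₃} → f ≈ f′ → Section f c₀ c₁ c₂ c₃ → Section f′ c₀ c₁ c₂ c₃
    section-resp f≈f′ (section eq) = section (trans (sym f≈f′) eq)

    -- 1/(1 - u) = (1 + u + u² + u³)/(1 - u⁴) with 1/(1 - u⁴) = κ.
    section-v : Section v 1# 1# 1# 1#
    section-v = section (begin
      v
        ≈⟨ linear (- v) κ≈ (linear v u⁴κ≈ (linear (κ * (1# + u + u ^ 2 + u ^ 3)) v≈
          (solve 4 (λ v k y τ → let u = con (+ 2) :* y ; s = con 1ℤ :+ u :+ u :^ 2 :+ u :^ 3 in
            v :+ (:- v) :* (con 1ℤ :+ τ) :+ v :* τ :+ k :* s :* (con 1ℤ :+ con (+ 2) :* (y :* v)) :=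
            k :* (con 1ℤ :+ con 1ℤ :* u :+ con 1ℤ :* u :^ 2 :+ con 1ℤ :* u :^ 3)
              :+ (:- v) :* k :+ v :* (u :^ 4 :* k) :+ k :* s :* v)
            refl v κ y (V² T)))) ⟩
      κ * (1# + 1# * u + 1# * u ^ 2 + 1# * u ^ 3)
        ≈⟨ *-congˡ (+-cong (+-cong (+-cong 1≈ (*-congʳ 1≈)) (*-congʳ 1≈)) (*-congʳ 1≈)) ⟩
      κ * (V² 1# + V² 1# * u + V² 1# * u ^ 2 + V² 1# * u ^ 3)  ∎)
      where
      1≈ : 1# ≈ V² 1#
      1≈ = sym (V²-ι 1ℤ)

    -- Multiplication by 1 + u + u² + u³ puts the prefix sums of the coefficients into degrees 0 to
    -- 3 and the complementary sums into degrees 4 to 6. As κ = 1 + V²(T) and κu⁴ = V²(T), the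
    -- second factor κ merges them into prefix sum plus T times the whole sum.
    section-v* : ∀ {f c₀ c₁ c₂ c₃} → Section f c₀ c₁ c₂ c₃ →
      let s = T * (c₀ + c₁ + c₂ + c₃) in
      Section (v * f) (s + c₀) (s + (c₀ + c₁)) (s + (c₀ + c₁ + c₂)) (s + (c₀ + c₁ + c₂ + c₃))
    section-v* {f} {c₀} {c₁} {c₂} {c₃} (section eq) = section (begin
      v * f
        ≈⟨ *-cong (expansion section-v) eq ⟩
      κ * (V² 1# + V² 1# * u + V² 1# * u ^ 2 + V² 1# * u ^ 3) * (κ * F)
        ≈⟨ *-congʳ (*-congˡ (+-cong (+-cong (+-cong 1≈ (*-congʳ 1≈)) (*-congʳ 1≈)) (*-congʳ 1≈))) ⟩
      κ * (1# + 1# * u + 1# * u ^ 2 + 1# * u ^ 3) * (κ * F)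
        ≈⟨ linear (κ * (C₁ + C₂ * (1# + u) + C₃ * (1# + u + u ^ 2))) u⁴κ≈
          (linear (κ * (C₀ + (C₀ + C₁) * u + (C₀ + C₁ + C₂) * u ^ 2 + (C₀ + C₁ + C₂ + C₃) * u ^ 3)) κ≈
          (solve 7 (λ k u τ a b c d →
            k :* (con 1ℤ :+ con 1ℤ :* u :+ con 1ℤ :* u :^ 2 :+ con 1ℤ :* u :^ 3)
              :* (k :* (a :+ b :* u :+ c :* u :^ 2 :+ d :* u :^ 3))
              :+ k :* (b :+ c :* (con 1ℤ :+ u) :+ d :* (con 1ℤ :+ u :+ u :^ 2)) :* τ
              :+ k :* (a :+ (a :+ b) :* u :+ (a :+ b :+ c) :* u :^ 2 :+ (a :+ b :+ c :+ d) :* u :^ 3)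
                  :* (con 1ℤ :+ τ) :=
            (let s = τ :* (a :+ b :+ c :+ d) in
            k :* (s :+ a :+ (s :+ (a :+ b)) :* u :+ (s :+ (a :+ b :+ c)) :* u :^ 2
                :+ (s :+ (a :+ b :+ c :+ d)) :* u :^ 3))
              :+ k :* (b :+ c :* (con 1ℤ :+ u) :+ d :* (con 1ℤ :+ u :+ u :^ 2)) :* (u :^ 4 :* k)
              :+ k :* (a :+ (a :+ b) :* u :+ (a :+ b :+ c) :* u :^ 2 :+ (a :+ b :+ c :+ d) :* u :^ 3)
                  :* k)
            refl κ u (V² T) C₀ C₁ C₂ C₃)) ⟩
      κ * (s + C₀ + (s + (C₀ + C₁)) * u + (s + (C₀ + C₁ + C₂)) * u ^ 2
        + (s + (C₀ + C₁ + C₂ + C₃)) * u ^ 3)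
        ≈⟨ *-congˡ (+-cong (+-cong (+-cong (with-s refl) (*-congʳ (with-s Σ₂)))
             (*-congʳ (with-s Σ₃))) (*-congʳ (with-s Σ₄))) ⟨
      κ * _  ∎)
      where
      C₀ = V² c₀
      C₁ = V² c₁
      C₂ = V² c₂
      C₃ = V² c₃
      F = C₀ + C₁ * u + C₂ * u ^ 2 + C₃ * u ^ 3
      s = V² T * (C₀ + C₁ + C₂ + C₃)
      1≈ : V² 1# ≈ 1#
      1≈ = V²-ι 1ℤ
      Σ₂ : V² (c₀ + c₁) ≈ C₀ + C₁
      Σ₂ = V²-+ c₀ c₁
      Σ₃ : V² (c₀ + c₁ + c₂) ≈ C₀ + C₁ + C₂
      Σ₃ = trans (V²-+ _ c₂) (+-congʳ Σ₂)
      Σ₄ : V² (c₀ + c₁ + c₂ + c₃) ≈ C₀ + C₁ + C₂ + C₃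
      Σ₄ = trans (V²-+ _ c₃) (+-congʳ Σ₃)
      with-s : ∀ {c C} → V² c ≈ C → V² (T * (c₀ + c₁ + c₂ + c₃) + c) ≈ s + C
      with-s c≈C = trans (V²-+ _ _) (+-cong (trans (V²-* _ _) (*-congˡ Σ₄)) c≈C)

    record PolynomialSection (f : Carrier) : Set where
      field
        {c₀ c₁ c₂ c₃} : Carrier
        c₀∈ : Polynomial T c₀
        c₁∈ : Polynomial T c₁
        c₂∈ : Polynomial T c₂
        c₃∈ : Polynomial T c₃
        is-section : Section f c₀ c₁ c₂ c₃
    open PolynomialSection

    -- Polynomial sections are closed under integer combinations and under multiplication by v,
    -- hence under the action of ℤ[v].
    Polynomial-* : ∀ {f g} → Polynomial v f → PolynomialSection g → PolynomialSection (f * g)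
    Polynomial-* {g = g} (const c) s = record
      { c₀∈ = const c ⊗ c₀∈ s
      ; c₁∈ = const c ⊗ c₁∈ s
      ; c₂∈ = const c ⊗ c₂∈ s
      ; c₃∈ = const c ⊗ c₃∈ s
      ; is-section = section (begin
          ι c * g
            ≈⟨ *-congˡ (expansion (is-section s)) ⟩
          ι c * _
            ≈⟨ solve 7 (λ k a b d f u κ → k :* (κ :* (a :+ b :* u :+ d :* u :^ 2 :+ f :* u :^ 3)) :=
                 κ :* (k :* a :+ k :* b :* u :+ k :* d :* u :^ 2 :+ k :* f :* u :^ 3))
                 refl (ι c) (V² (c₀ s)) (V² (c₁ s)) (V² (c₂ s)) (V² (c₃ s)) u κ ⟩
          κ * _
            ≈⟨ *-congˡ (+-cong (+-cong (+-cong (scale _) (*-congʳ (scale _)))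
                 (*-congʳ (scale _))) (*-congʳ (scale _))) ⟨
          κ * _  ∎)
      }
      where
      scale : ∀ a → V² (ι c * a) ≈ ι c * V² a
      scale a = trans (V²-* (ι c) a) (*-congʳ (V²-ι c))
    Polynomial-* gen s = record
      { c₀∈ = S∈ ⊕ c₀∈ s
      ; c₁∈ = S∈ ⊕ (c₀∈ s ⊕ c₁∈ s)
      ; c₂∈ = S∈ ⊕ (c₀∈ s ⊕ c₁∈ s ⊕ c₂∈ s)
      ; c₃∈ = S∈ ⊕ (c₀∈ s ⊕ c₁∈ s ⊕ c₂∈ s ⊕ c₃∈ s)
      ; is-section = section-v* (is-section s)
      }
      where S∈ = gen ⊗ (c₀∈ s ⊕ c₁∈ s ⊕ c₂∈ s ⊕ c₃∈ s)
    Polynomial-* {g = g} (_⊕_ {f} {f′} f∈ f∈′) s =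
      let s₁ = Polynomial-* f∈ s ; s₂ = Polynomial-* f∈′ s in record
      { c₀∈ = c₀∈ s₁ ⊕ c₀∈ s₂
      ; c₁∈ = c₁∈ s₁ ⊕ c₁∈ s₂
      ; c₂∈ = c₂∈ s₁ ⊕ c₂∈ s₂
      ; c₃∈ = c₃∈ s₁ ⊕ c₃∈ s₂
      ; is-section = section (begin
          (f + f′) * g
            ≈⟨ distribʳ g f f′ ⟩
          f * g + f′ * g
            ≈⟨ +-cong (expansion (is-section s₁)) (expansion (is-section s₂)) ⟩
          κ * _ + κ * _
            ≈⟨ solve 10 (λ κ u a b c d a′ b′ c′ d′ →
                 κ :* (a :+ b :* u :+ c :* u :^ 2 :+ d :* u :^ 3)
                   :+ κ :* (a′ :+ b′ :* u :+ c′ :* u :^ 2 :+ d′ :* u :^ 3) :=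
                 κ :* (a :+ a′ :+ (b :+ b′) :* u :+ (c :+ c′) :* u :^ 2 :+ (d :+ d′) :* u :^ 3))
                 refl κ u (V² (c₀ s₁)) (V² (c₁ s₁)) (V² (c₂ s₁)) (V² (c₃ s₁))
                          (V² (c₀ s₂)) (V² (c₁ s₂)) (V² (c₂ s₂)) (V² (c₃ s₂)) ⟩
          κ * _
            ≈⟨ *-congˡ (+-cong (+-cong (+-cong (V²-+ _ _) (*-congʳ (V²-+ _ _)))
                 (*-congʳ (V²-+ _ _))) (*-congʳ (V²-+ _ _))) ⟨
          κ * _  ∎)
      }
    Polynomial-* {g = g} (_⊗_ {f} {f′} f∈ f∈′) s =
      let s′ = Polynomial-* f∈ (Polynomial-* f∈′ s) in record
      { c₀∈ = c₀∈ s′ ; c₁∈ = c₁∈ s′ ; c₂∈ = c₂∈ s′ ; c₃∈ = c₃∈ s′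
      ; is-section = section-resp (sym (*-assoc f f′ g)) (is-section s′)
      }
    Polynomial-* (resp eq f∈) s =
      let s′ = Polynomial-* f∈ s in record
      { c₀∈ = c₀∈ s′ ; c₁∈ = c₁∈ s′ ; c₂∈ = c₂∈ s′ ; c₃∈ = c₃∈ s′
      ; is-section = section-resp (*-congʳ eq) (is-section s′)
      }

    -- The leading v supplies the common factor κ; the constant 1 by itself would need the
    -- coefficient 1/(1 + T).
    polynomialSection : ∀ {f} → Polynomial v f → PolynomialSection (v * f)
    polynomialSection {f} f∈ =
      let s = Polynomial-* f∈ (record { c₀∈ = const 1ℤ ; c₁∈ = const 1ℤ ; c₂∈ = const 1ℤ
                                      ; c₃∈ = const 1ℤ ; is-section = section-v })
      in record { c₀∈ = c₀∈ s ; c₁∈ = c₁∈ s ; c₂∈ = c₂∈ s ; c₃∈ = c₃∈ s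
                ; is-section = section-resp (*-comm f v) (is-section s) }

    private
      -- y = q V²(y₀): multiplied by series in q⁴, the powers y, y², y³ have exponents 1, 2, 3
      -- modulo 4 only.
      U²-V²*y : ∀ a → U² (V² a * y) ≈ 0#
      U²-V²*y a = begin
        U² (V² a * (q * V² y₀))
          ≈⟨ U²-cong (trans (solve 3 (λ a q b → a :* (q :* b) := a :* b :* q) refl (V² a) q (V² y₀))
              (*-congʳ (sym (V²-* a y₀)))) ⟩
        U² (V² (a * y₀) * q)            ≈⟨ U²-V²* _ _ ⟩
        a * y₀ * U² q                   ≈⟨ *-congˡ U²-q ⟩
        a * y₀ * 0#                     ≈⟨ zeroʳ _ ⟩
        0#                              ∎

      U²-V²*y² : ∀ a → U² (V² a * y ^ 2) ≈ 0#
      U²-V²*y² a = begin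
        U² (V² a * (q * V² y₀) ^ 2)
          ≈⟨ U²-cong (trans (solve 3 (λ a q b → a :* (q :* b) :^ 2 := a :* b :* b :* (q :* q))
                              refl (V² a) q (V² y₀))
              (*-congʳ (sym (trans (V²-* _ y₀) (*-congʳ (V²-* a y₀)))))) ⟩
        U² (V² (a * y₀ * y₀) * (q * q)) ≈⟨ U²-V²* _ _ ⟩
        a * y₀ * y₀ * U² (q * q)        ≈⟨ *-congˡ U²-q² ⟩
        a * y₀ * y₀ * 0#                ≈⟨ zeroʳ _ ⟩
        0#                              ∎

      U²-V²*y³ : ∀ a → U² (V² a * y ^ 3) ≈ 0#
      U²-V²*y³ a = begin
        U² (V² a * (q * V² y₀) ^ 3)
          ≈⟨ U²-cong (trans (solve 3 (λ a q b → a :* (q :* b) :^ 3 := a :* b :* b :* b :* (q :* q :* q))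
                              refl (V² a) q (V² y₀))
              (*-congʳ (sym (trans (V²-* _ y₀) (*-congʳ (trans (V²-* _ y₀) (*-congʳ (V²-* a y₀)))))))) ⟩
        U² (V² (a * y₀ * y₀ * y₀) * (q * q * q)) ≈⟨ U²-V²* _ _ ⟩
        a * y₀ * y₀ * y₀ * U² (q * q * q)        ≈⟨ *-congˡ U²-q³ ⟩
        a * y₀ * y₀ * y₀ * 0#                    ≈⟨ zeroʳ _ ⟩
        0#                                       ∎

      V²*y⁴ : ∀ a → V² a * y ^ 4 ≈ V² (a * z)
      V²*y⁴ a = trans (*-congˡ y⁴≈) (sym (V²-* a z))

      κ-section : ∀ c a → V² (ι a * ((1# + T) * c)) ≈ ι a * (κ * V² c)
      κ-section c a = trans (V²-* _ _) (*-cong (V²-ι a) (V²-* (1# + T) c))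

    -- The term with y · u³ = 8y⁴ is the one with exponents divisible by 4, and κy⁴ = V²(t).
    U²-y* : ∀ {f c₀ c₁ c₂ c₃} → Section f c₀ c₁ c₂ c₃ → U² (y * f) ≈ ι (+ 8) * (t * c₃)
    U²-y* {f} {c₀} {c₁} {c₂} {c₃} (section eq) = begin
      U² (y * f)
        ≈⟨ U²-cong (trans (*-congˡ eq)
            (solve 6 (λ κ y a b c d → let u = con (+ 2) :* y in
              y :* (κ :* (a :+ b :* u :+ c :* u :^ 2 :+ d :* u :^ 3)) :=
              con (+ 1) :* (κ :* a) :* y :+ con (+ 2) :* (κ :* b) :* y :^ 2
                :+ con (+ 4) :* (κ :* c) :* y :^ 3 :+ con (+ 8) :* (κ :* d) :* y :^ 4)
              refl κ y (V² c₀) (V² c₁) (V² c₂) (V² c₃))) ⟩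
      U² (ι (+ 1) * (κ * V² c₀) * y + ι (+ 2) * (κ * V² c₁) * y ^ 2
        + ι (+ 4) * (κ * V² c₂) * y ^ 3 + ι (+ 8) * (κ * V² c₃) * y ^ 4)
        ≈⟨ U²-cong (+-cong (+-cong (+-cong (*-congʳ (κ-section c₀ (+ 1))) (*-congʳ (κ-section c₁ (+ 2))))
            (*-congʳ (κ-section c₂ (+ 4)))) (trans (sym (V²*y⁴ _)) (*-congʳ (κ-section c₃ (+ 8))))) ⟨
      U² (V² k₀ * y + V² k₁ * y ^ 2 + V² k₂ * y ^ 3 + V² (k₃ * z))
        ≈⟨ trans (U²-+ _ _) (+-cong (trans (U²-+ _ _) (+-cong (trans (U²-+ _ _) (+-cong
            (U²-V²*y k₀) (U²-V²*y² k₁))) (U²-V²*y³ k₂))) (U²-V² _)) ⟩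
      0# + 0# + 0# + k₃ * z
        ≈⟨ linear (ι (+ 8) * c₃) z*1+T≈t
            (solve 4 (λ z T t c → con 0ℤ :+ con 0ℤ :+ con 0ℤ :+ con (+ 8) :* ((con 1ℤ :+ T) :* c) :* z
                  :+ con (+ 8) :* c :* t :=
                con (+ 8) :* (t :* c) :+ con (+ 8) :* c :* (z :* (con 1ℤ :+ T)))
              refl z T t c₃) ⟩
      ι (+ 8) * (t * c₃)  ∎
      where
      k₀ = ι (+ 1) * ((1# + T) * c₀)
      k₁ = ι (+ 2) * ((1# + T) * c₁)
      k₂ = ι (+ 4) * ((1# + T) * c₂)
      k₃ = ι (+ 8) * ((1# + T) * c₃)

    -- The top term y²u³ = 8y⁴ · y dies like y itself, y⁴ being a series in q⁴.
    U²-y²* : ∀ {f c₀ c₁ c₂ c₃} → Section f c₀ c₁ c₂ c₃ → U² (y ^ 2 * f) ≈ ι (+ 4) * (t * c₂)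
    U²-y²* {f} {c₀} {c₁} {c₂} {c₃} (section eq) = begin
      U² (y ^ 2 * f)
        ≈⟨ U²-cong (trans (*-congˡ eq)
            (solve 6 (λ κ y a b c d → let u = con (+ 2) :* y in
              y :^ 2 :* (κ :* (a :+ b :* u :+ c :* u :^ 2 :+ d :* u :^ 3)) :=
              con (+ 1) :* (κ :* a) :* y :^ 2 :+ con (+ 2) :* (κ :* b) :* y :^ 3
                :+ con (+ 4) :* (κ :* c) :* y :^ 4 :+ con (+ 8) :* (κ :* d) :* y :^ 4 :* y)
              refl κ y (V² c₀) (V² c₁) (V² c₂) (V² c₃))) ⟩
      U² (ι (+ 1) * (κ * V² c₀) * y ^ 2 + ι (+ 2) * (κ * V² c₁) * y ^ 3
        + ι (+ 4) * (κ * V² c₂) * y ^ 4 + ι (+ 8) * (κ * V² c₃) * y ^ 4 * y)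
        ≈⟨ U²-cong (+-cong (+-cong (+-cong (*-congʳ (κ-section c₀ (+ 1))) (*-congʳ (κ-section c₁ (+ 2))))
            (trans (sym (V²*y⁴ _)) (*-congʳ (κ-section c₂ (+ 4)))))
            (*-congʳ (trans (sym (V²*y⁴ _)) (*-congʳ (κ-section c₃ (+ 8)))))) ⟨
      U² (V² k₀ * y ^ 2 + V² k₁ * y ^ 3 + V² (k₂ * z) + V² (k₃ * z) * y)
        ≈⟨ trans (U²-+ _ _) (+-cong (trans (U²-+ _ _) (+-cong (trans (U²-+ _ _) (+-cong
            (U²-V²*y² k₀) (U²-V²*y³ k₁))) (U²-V² _))) (U²-V²*y _)) ⟩
      0# + 0# + k₂ * z + 0#
        ≈⟨ linear (ι (+ 4) * c₂) z*1+T≈t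
            (solve 4 (λ z T t c → con 0ℤ :+ con 0ℤ :+ con (+ 4) :* ((con 1ℤ :+ T) :* c) :* z :+ con 0ℤ
                  :+ con (+ 4) :* c :* t :=
                con (+ 4) :* (t :* c) :+ con (+ 4) :* c :* (z :* (con 1ℤ :+ T)))
              refl z T t c₂) ⟩
      ι (+ 4) * (t * c₂)  ∎
      where
      k₀ = ι (+ 1) * ((1# + T) * c₀)
      k₁ = ι (+ 2) * ((1# + T) * c₁)
      k₂ = ι (+ 4) * ((1# + T) * c₂)
      k₃ = ι (+ 8) * ((1# + T) * c₃)

    -- In general U²(y² f) only gains a factor 4; for f = v³ the coefficient
    -- 16T² + 22T + 6 of u² supplies the missing 2.
    section-v³ : ∃ λ c → Polynomial T c × U² (y ^ 2 * (v * (v * v))) ≈ ι (+ 8) * (t * c)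
    section-v³ = ι (+ 8) * (T * T) + ι (+ 11) * T + ι (+ 3) ,
      const (+ 8) ⊗ (gen ⊗ gen) ⊕ const (+ 11) ⊗ gen ⊕ const (+ 3) ,
      trans (U²-y²* (section-v* (section-v* section-v)))
        (solve 2 (λ t T → let
            s = T :* (con 1ℤ :+ con 1ℤ :+ con 1ℤ :+ con 1ℤ)
            d₀ = s :+ con 1ℤ
            d₁ = s :+ (con 1ℤ :+ con 1ℤ)
            d₂ = s :+ (con 1ℤ :+ con 1ℤ :+ con 1ℤ)
            d₃ = s :+ (con 1ℤ :+ con 1ℤ :+ con 1ℤ :+ con 1ℤ) in
          con (+ 4) :* (t :* (T :* (d₀ :+ d₁ :+ d₂ :+ d₃) :+ (d₀ :+ d₁ :+ d₂))) :=
          con (+ 8) :* (t :* (con (+ 8) :* (T :* T) :+ con (+ 11) :* T :+ con (+ 3))))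
          refl t T)

    -- m = 1 + 4yv, where 2yv = v - 1.
    m-odd : Odd v m
    m-odd = v + - 1# , resp (+-congˡ (ι-‿ 1ℤ)) (gen ⊕ const -1ℤ) , trans m≈ (+-congˡ 4yv≈)

    w-odd : Odd v w
    w-odd = v * (v + - 1#) , gen ⊗ (gen ⊕ resp (ι-‿ 1ℤ) (const -1ℤ)) , trans w≈ (+-congˡ (begin
      ι (+ 4) * x                     ≈⟨ *-congˡ x≈ ⟩
      ι (+ 4) * (y * v * v)           ≈⟨ *-assoc _ _ _ ⟨
      ι (+ 4) * (y * v) * v           ≈⟨ *-congʳ 4yv≈ ⟩
      ι (+ 2) * (v + - 1#) * v        ≈⟨ trans (*-assoc _ _ _) (*-congˡ (*-comm _ v)) ⟩
      ι (+ 2) * (v * (v + - 1#))      ∎))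

    -- 16xw = 4w · 4x and 4x = 2v(v - 1), by comparing the two expressions for w.
    T-polynomial : ∃ λ k → Polynomial v k × T ≈ ι (+ 8) * k
    T-polynomial = v * (v + - 1#) * w ,
      proj₁ (proj₂ w-odd) ⊗ odd⇒polynomial w-odd ,
      linear (ι (+ 4) * w) 4x≈
        (solve 3 (λ x w k → con (+ 16) :* (x :* w) :+ con (+ 4) :* w :* (con (+ 2) :* k) :=
          con (+ 8) :* (k :* w) :+ con (+ 4) :* w :* (con (+ 4) :* x)) refl x w (v * (v + - 1#)))
      where
      4x≈ : ι (+ 4) * x ≈ ι (+ 2) * (v * (v + - 1#))
      4x≈ = linear (- 1#) w≈ (linear 1# (proj₂ (proj₂ w-odd))
        (solve 3 (λ x k w → con (+ 4) :* x :+ (:- con 1ℤ) :* (con 1ℤ :+ con (+ 4) :* x)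
            :+ con 1ℤ :* (con 1ℤ :+ con (+ 2) :* k) :=
          con (+ 2) :* k :+ (:- con 1ℤ) :* w :+ con 1ℤ :* w) refl x (v * (v + - 1#)) w))

    -- Induction on α, with P the prefactor of L and D the generating function of d₇.

    P D : Carrier
    P = eta (+ 26 ∷ -[1+ 12 ] ∷ + 2 ∷ [])
    D = eta (-[1+ 21 ] ∷ + 7 ∷ [])

    private
      ps ws ms yvs : List ℤ
      ps  = + 26 ∷ -[1+ 12 ] ∷ + 2 ∷ []
      ws  = -[1+ 3 ] ∷ -[1+ 1 ] ∷ + 10 ∷ -[1+ 3 ] ∷ []
      ms  = -[1+ 3 ] ∷ + 6 ∷ -[1+ 1 ] ∷ []
      yvs = -[1+ 1 ] ∷ + 1 ∷ + 0 ∷ -1ℤ ∷ + 2 ∷ []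

      P*U² : ∀ f → P * U² (q * f) ≈ U² (V² P * q * f)
      P*U² f = trans (sym (U²-V²* P (q * f))) (U²-cong (sym (*-assoc _ q f)))

      yvmw≈ : ∀ a b → y * v * (m ^ a * w ^ b) ≈ q * eta (yvs ⊞ (a ⊠ ms ⊞ b ⊠ ws))
      yvmw≈ a b = trans
        (*-cong yv≈ (trans (*-cong (eta-^ a ms) (eta-^ b ws)) (eta-* (a ⊠ ms) (b ⊠ ws))))
        (trans (*-assoc _ _ _) (*-congˡ (eta-* yvs (a ⊠ ms ⊞ b ⊠ ws))))

      V²P*q : V² P * q ≈ q * eta (0ℤ ∷ 0ℤ ∷ ps)
      V²P*q = trans (*-comm _ q) (*-congˡ (V²-eta ps))

    -- q P(q⁴) D is the quotient yv m²w³. With a single y in front the extraction reads off the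
    -- coefficient of u³, and u³ = 8y³ is the source of the 8.
    initial : ∃ λ g → Polynomial T g × P * U² (q * D) ≈ ι (+ 8) * (t * g)
    initial =
      let s = polynomialSection (odd⇒polynomial (odd-* (odd-^ 2 m-odd) (odd-^ 3 w-odd)))
      in PolynomialSection.c₃ s , c₃∈ s , (begin
        P * U² (q * D)
          ≈⟨ P*U² D ⟩
        U² (V² P * q * D)
          ≈⟨ U²-cong (trans (*-congʳ V²P*q) (trans (*-assoc _ _ _) (*-congˡ
              (trans (eta-* (0ℤ ∷ 0ℤ ∷ ps) ds) (eta-≡ ((0ℤ ∷ 0ℤ ∷ ps) ⊞ ds) (yvs ⊞ (2 ⊠ ms ⊞ 3 ⊠ ws)) ≡.refl))))) ⟩
        U² (q * eta (yvs ⊞ (2 ⊠ ms ⊞ 3 ⊠ ws)))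
          ≈⟨ U²-cong (yvmw≈ 2 3) ⟨
        U² (y * v * (m ^ 2 * w ^ 3))
          ≈⟨ U²-cong (*-assoc y v _) ⟩
        U² (y * (v * (m ^ 2 * w ^ 3)))
          ≈⟨ U²-y* (is-section s) ⟩
        ι (+ 8) * (t * PolynomialSection.c₃ s)  ∎)
      where
      ds : List ℤ
      ds = -[1+ 21 ] ∷ + 7 ∷ []

    -- q P(q⁴)/P(q), the factor by which L_α is multiplied before applying U².
    multiplier : V² P * q ≈ y * v * (m ^ 3 * w ^ 3) * P
    multiplier = trans V²P*q (sym (trans (*-congʳ (yvmw≈ 3 3)) (trans (*-assoc _ _ _) (*-congˡ
      (trans (eta-* (yvs ⊞ (3 ⊠ ms ⊞ 3 ⊠ ws)) ps) (eta-≡ (yvs ⊞ (3 ⊠ ms ⊞ 3 ⊠ ws) ⊞ ps) (0ℤ ∷ 0ℤ ∷ ps) ≡.refl))))))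

    -- t = yv²w raises yv m³w³ to y²v³ m³w⁴. The splittings g = a₀ + T g₁ and m³w⁴ = 1 + 2h then
    -- separate a multiple of y²v³, a part with an explicit 2, and a part with T = 8k.
    step-expansion : ∀ {f g g₁ h k} a a₀ → P * f ≈ ι a * (t * g) → g ≈ ι a₀ + T * g₁ →
      m ^ 3 * w ^ 4 ≈ 1# + ι (+ 2) * h → T ≈ ι (+ 8) * k →
      V² P * q * f ≈ ι a * (ι a₀ * (y ^ 2 * (v * (v * v)))
                          + ι (+ 2) * (y ^ 2 * (v * (v * v * h * ι a₀)))
                          + ι (+ 8) * (y ^ 2 * (v * (v * v * (m ^ 3 * w ^ 4) * k * g₁))))
    step-expansion {f} {g} {g₁} {h} {k} a a₀ Pf≈ g≈ M≈ T≈ = begin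
      V² P * q * f
        ≈⟨ trans (*-congʳ multiplier) (trans (*-assoc _ P f) (*-congˡ Pf≈)) ⟩
      y * v * (m ^ 3 * w ^ 3) * (ι a * (x * w * g))
        ≈⟨ *-congˡ (*-congˡ (*-congʳ (*-congʳ x≈))) ⟩
      y * v * (m ^ 3 * w ^ 3) * (ι a * (y * v * v * w * g))
        ≈⟨ solve 6 (λ y v N w a g → y :* v :* N :* (a :* (y :* v :* v :* w :* g)) :=
             a :* (y :^ 2 :* (v :* (v :* v)) :* (w :* N :* g))) refl y v (m ^ 3 * w ^ 3) w (ι a) g ⟩
      ι a * (Y * (w * (m ^ 3 * w ^ 3) * g))
        ≈⟨ *-congˡ (*-congˡ (*-cong (solve 3 (λ M W w → w :* (M :* W) := M :* (w :* W))
             refl (m ^ 3) (w ^ 3) w) g≈)) ⟩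
      ι a * (Y * (M * (ι a₀ + T * g₁)))
        ≈⟨ *-congˡ (*-congˡ (trans (distribˡ M _ _) (+-cong (*-congʳ M≈) (*-congˡ (*-congʳ T≈))))) ⟩
      ι a * (Y * ((1# + ι (+ 2) * h) * ι a₀ + M * (ι (+ 8) * k * g₁)))
        ≈⟨ *-congˡ (solve 7 (λ y² v M h k g a₀ →
             y² :* (v :* (v :* v)) :* ((con 1ℤ :+ con (+ 2) :* h) :* a₀ :+ M :* (con (+ 8) :* k :* g)) :=
             a₀ :* (y² :* (v :* (v :* v)))
               :+ con (+ 2) :* (y² :* (v :* (v :* v :* h :* a₀)))
               :+ con (+ 8) :* (y² :* (v :* (v :* v :* M :* k :* g))))
             refl (y ^ 2) v M h k g₁ (ι a₀)) ⟩
      ι a * _  ∎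
      where
      M = m ^ 3 * w ^ 4
      Y = y ^ 2 * (v * (v * v))

    -- The first part has its 8 from `section-v³`. `U²-y²*` adds a factor 4 to the others: 2 · 4 =
    -- 8, and 8 · 4 = 32, whence the coefficient 4 of `d₂`.
    step : ∀ {f g} a → Polynomial T g → P * f ≈ ι a * (t * g) →
      ∃ λ g′ → Polynomial T g′ × P * U² (q * f) ≈ ι (a ℤ.* + 8) * (t * g′)
    step {f} a g∈ Pf≈ =
      let a₀ , g₁ , g₁∈ , g≈ = constantTerm g∈
          M-odd              = odd-* (odd-^ 3 m-odd) (odd-^ 4 w-odd)
          h , h∈ , M≈        = M-odd
          k , k∈ , T≈        = T-polynomial
          c , c∈ , v³≈       = section-v³
          -- Rewrites g₁, a polynomial in T, as a polynomial in v, so that it can join the cofactor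
          -- of y²v.
          T∈                 = resp (sym T≈) (const (+ 8) ⊗ k∈)
          s₁ = polynomialSection (gen ⊗ gen ⊗ h∈ ⊗ const a₀)
          s₂ = polynomialSection (gen ⊗ gen ⊗ odd⇒polynomial M-odd ⊗ k∈ ⊗ Polynomial-∘ T∈ g₁∈)
          d₁ = PolynomialSection.c₂ s₁
          d₂ = PolynomialSection.c₂ s₂
      in ι a₀ * c + d₁ + ι (+ 4) * d₂ , const a₀ ⊗ c∈ ⊕ c₂∈ s₁ ⊕ const (+ 4) ⊗ c₂∈ s₂ , (begin
        P * U² (q * f)
          ≈⟨ P*U² f ⟩
        U² (V² P * q * f)
          ≈⟨ U²-cong (step-expansion a a₀ Pf≈ g≈ M≈ T≈) ⟩
        U² (ι a * _)
          ≈⟨ trans (U²-ι* a _) (*-congˡ (trans (U²-+ _ _) (+-cong (trans (U²-+ _ _) (+-cong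
              (trans (U²-ι* a₀ _) (*-congˡ v³≈))
              (trans (U²-ι* (+ 2) _) (*-congˡ (U²-y²* (is-section s₁))))))
              (trans (U²-ι* (+ 8) _) (*-congˡ (U²-y²* (is-section s₂))))))) ⟩
        ι a * (ι a₀ * (ι (+ 8) * (t * c)) + ι (+ 2) * (ι (+ 4) * (t * d₁))
          + ι (+ 8) * (ι (+ 4) * (t * d₂)))
          ≈⟨ solve 6 (λ a a₀ t c d₁ d₂ →
               a :* (a₀ :* (con (+ 8) :* (t :* c)) :+ con (+ 2) :* (con (+ 4) :* (t :* d₁))
                 :+ con (+ 8) :* (con (+ 4) :* (t :* d₂))) :=
               a :* con (+ 8) :* (t :* (a₀ :* c :+ d₁ :+ con (+ 4) :* d₂)))
               refl (ι a) (ι a₀) t c d₁ d₂ ⟩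
        ι a * ι (+ 8) * (t * (ι a₀ * c + d₁ + ι (+ 4) * d₂))
          ≈⟨ *-congʳ (ι-* a (+ 8)) ⟨
        ι (a ℤ.* + 8) * (t * (ι a₀ * c + d₁ + ι (+ 4) * d₂))  ∎)
      where
      U²-ι* : ∀ c f → U² (ι c * f) ≈ ι c * U² f
      U²-ι* c f = trans (U²-cong (*-congʳ (sym (V²-ι c)))) (U²-V²* (ι c) f)

    -- Passage to ℤ[x] and to the products in the definitions.

    t∈ : Polynomial x t
    t∈ = gen ⊗ resp (sym w≈) (const 1ℤ ⊕ const (+ 4) ⊗ gen)

    t*-polynomial : ∀ {g} → Polynomial T g → Polynomial x (t * g)
    t*-polynomial g∈ = t∈ ⊗ Polynomial-∘ (const (+ 16) ⊗ t∈) g∈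

    private
      e^≈ : ∀ n → e ^ n ≈ eta (n ⊠ (+ 1 ∷ []))
      e^≈ n = trans (^-congˡ n e≈) (eta-^ n (+ 1 ∷ []))

      e₂^≈ : ∀ n → e₂ ^ n ≈ eta (n ⊠ (+ 0 ∷ + 1 ∷ []))
      e₂^≈ n = trans (^-congˡ n e₂≈) (eta-^ n (+ 0 ∷ + 1 ∷ []))

      e₄^≈ : ∀ n → e₄ ^ n ≈ eta (n ⊠ (+ 0 ∷ + 0 ∷ + 1 ∷ []))
      e₄^≈ n = trans (^-congˡ n e₄≈) (eta-^ n (+ 0 ∷ + 0 ∷ + 1 ∷ []))

      -- Inverses are unique, so any i with u i = 1 equals the quotient with negated exponents; the
      -- geometric-series inverse enters through this property alone.
      quotient-unique : ∀ {a u i} as us → a ≈ eta as → u ≈ eta us → u * i ≈ 1# →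
                        a * i ≈ eta (as ⊞ ⊟ us)
      quotient-unique {a} {u} {i} as us a≈ u≈ ui≈1 = unit-cancel {u} {eta (⊟ us)}
        (trans (*-congʳ u≈) (eta-⊟ us)) (begin
          u * (a * i)                    ≈⟨ solve 3 (λ u a i → u :* (a :* i) := a :* (u :* i)) refl u a i ⟩
          a * (u * i)                    ≈⟨ *-cong a≈ ui≈1 ⟩
          eta as * 1#                    ≈⟨ *-congˡ (eta-⊟ us) ⟨
          eta as * (eta us * eta (⊟ us)) ≈⟨ solve 3 (λ u a i → a :* (u :* i) := u :* (a :* i)) refl (eta us) (eta as) (eta (⊟ us)) ⟩
          eta us * (eta as * eta (⊟ us)) ≈⟨ *-cong (sym u≈) (eta-* as (⊟ us)) ⟩
          u * eta (as ⊞ ⊟ us)            ∎)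

    P-product : ∀ {i} → e₂ ^ 13 * i ≈ 1# → e ^ 26 * e₄ ^ 2 * i ≈ P
    P-product {i} ui≈1 = trans
      (quotient-unique (+ 26 ∷ + 0 ∷ + 2 ∷ []) (+ 0 ∷ + 13 ∷ [])
        (trans (*-cong (e^≈ 26) (e₄^≈ 2)) (eta-* (+ 26 ∷ []) (+ 0 ∷ + 0 ∷ + 2 ∷ [])))
        (e₂^≈ 13) ui≈1) refl

    x-product : ∀ {i} → e ^ 4 * e₄ ^ 2 * i ≈ 1# → q * (e₂ ^ 2 * V e₄ ^ 4) * i ≈ x
    x-product {i} ui≈1 = trans (*-assoc q _ i) (*-congˡ
      (quotient-unique (+ 0 ∷ + 2 ∷ + 0 ∷ + 4 ∷ []) (+ 4 ∷ + 0 ∷ + 2 ∷ [])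
        (trans (*-cong (e₂^≈ 2) (trans (^-congˡ 4 (trans (V-cong e₄≈) (V-eta (+ 0 ∷ + 0 ∷ + 1 ∷ []))))
          (eta-^ 4 (+ 0 ∷ + 0 ∷ + 0 ∷ + 1 ∷ [])))) (eta-* (+ 0 ∷ + 2 ∷ []) (+ 0 ∷ + 0 ∷ + 0 ∷ + 4 ∷ [])))
        (trans (*-cong (e^≈ 4) (e₄^≈ 2)) (eta-* (+ 4 ∷ []) (+ 0 ∷ + 0 ∷ + 2 ∷ [])))
        ui≈1))

    -- With denominators cleared, d E₁²² = E₂⁷ holds factor by factor for the partial products and
    -- passes to the limit.
    D-product : ∀ {d} (g : ℕ → Carrier) →
      (∀ n → g n * (1# + - (q ^ suc n)) ^ 22 ≈ V (1# + - (q ^ suc n)) ^ 7) →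
      (∀ n → d ≋ ∏ g n mod n) → d ≈ D
    D-product {d} g g≈ d-limit = unit-cancel {e ^ 22} {eta (⊟ (+ 22 ∷ []))}
      (trans (*-congʳ (e^≈ 22)) (eta-⊟ (+ 22 ∷ []))) (begin
        e ^ 22 * d      ≈⟨ *-comm _ d ⟩
        d * e ^ 22      ≈⟨ ≋⇒≈ (λ n → ≋-trans (≋-* (d-limit n) (≋-^ 22 (e-limit n)))
                            (≋-trans (≋-reflexive (finite n)) (≋-sym (≋-^ 7 (≋-V (e-limit n)))))) ⟩
        e₂ ^ 7          ≈⟨ e₂^≈ 7 ⟩
        eta (+ 0 ∷ + 7 ∷ [])
          ≈⟨ eta-* (+ 22 ∷ []) (-[1+ 21 ] ∷ + 7 ∷ []) ⟨
        eta (+ 22 ∷ []) * D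
          ≈⟨ *-congʳ (e^≈ 22) ⟨
        e ^ 22 * D      ∎)
      where
      finite : ∀ n → ∏ g n * euler n ^ 22 ≈ V (euler n) ^ 7
      finite zero    = trans (*-identityˡ _) (trans (solve 0 (con 1ℤ :^ 22 := con 1ℤ :^ 7) refl)
        (^-congˡ 7 (sym (V-ι 1ℤ))))
      finite (suc n) = begin
        ∏ g n * g n * (euler n * b) ^ 22
          ≈⟨ *-congˡ (^-distrib-* (euler n) b 22) ⟩
        ∏ g n * g n * (euler n ^ 22 * b ^ 22)
          ≈⟨ solve 4 (λ a b c d → a :* b :* (c :* d) := a :* c :* (b :* d)) refl
              (∏ g n) (g n) (euler n ^ 22) (b ^ 22) ⟩
        ∏ g n * euler n ^ 22 * (g n * b ^ 22)
          ≈⟨ *-cong (finite n) (g≈ n) ⟩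
        V (euler n) ^ 7 * V b ^ 7
          ≈⟨ ^-distrib-* (V (euler n)) (V b) 7 ⟨
        (V (euler n) * V b) ^ 7
          ≈⟨ ^-congˡ 7 (V-* (euler n) b) ⟨
        V (euler n * b) ^ 7  ∎
        where b = 1# + - (q ^ suc n)

-- The ring of power series over ℤ.

open import Defs

shift : PowerSeries → PowerSeries
shift f n = f (suc n)

*-head : ∀ f g → (f * g) 0 ≡ f 0 ℤ.* g 0
*-head f g = ℤ.+-identityʳ _

*-local : ∀ n {f f′ g g′} → (∀ k → k ≤ n → f k ≡ f′ k) → (∀ k → k ≤ n → g k ≡ g′ k) →
          (f * g) n ≡ (f′ * g′) n
*-local zero    f≡ g≡ = ≡.cong (ℤ._+ 0ℤ) (≡.cong₂ ℤ._*_ (f≡ 0 z≤n) (g≡ 0 z≤n))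
*-local (suc n) f≡ g≡ = ≡.cong₂ ℤ._+_
  (≡.cong₂ ℤ._*_ (f≡ 0 z≤n) (g≡ (suc n) ℕ.≤-refl))
  (*-local n (λ k k≤n → f≡ (suc k) (s≤s k≤n)) (λ k k≤n → g≡ k (ℕ.m≤n⇒m≤1+n k≤n)))

*-cong : ∀ {f f′ g g′} → f ≗ f′ → g ≗ g′ → f * g ≗ f′ * g′
*-cong f≗ g≗ n = *-local n (λ k _ → f≗ k) (λ k _ → g≗ k)

*-congˡ : ∀ f {g g′} → g ≗ g′ → f * g ≗ f * g′
*-congˡ f g≗ = *-cong {f} (λ _ → ≡.refl) g≗

*-congʳ : ∀ g {f f′} → f ≗ f′ → f * g ≗ f′ * g
*-congʳ g f≗ = *-cong {g = g} f≗ λ _ → ≡.refl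

module _ where
  open ℤSolver.+-*-Solver
  open ≡.≡-Reasoning

  *-distribʳ : ∀ h f g → (f + g) * h ≗ f * h + g * h
  *-distribʳ h f g zero = solve 3 (λ f g h →
    (f :+ g) :* h :+ con 0ℤ := f :* h :+ con 0ℤ :+ (g :* h :+ con 0ℤ)) ≡.refl (f 0) (g 0) (h 0)
  *-distribʳ h f g (suc n) = ≡.trans
    (≡.cong₂ ℤ._+_ {x = (f 0 ℤ.+ g 0) ℤ.* h (suc n)} ≡.refl (*-distribʳ h (shift f) (shift g) n))
    (solve 5 (λ f g h F G → (f :+ g) :* h :+ (F :+ G) := f :* h :+ F :+ (g :* h :+ G))
      ≡.refl (f 0) (g 0) (h (suc n)) ((shift f * h) n) ((shift g * h) n))

  scale-* : ∀ a f g → (λ n → a ℤ.* f n) * g ≗ λ n → a ℤ.* (f * g) n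
  scale-* a f g zero = solve 3 (λ a f g → a :* f :* g :+ con 0ℤ := a :* (f :* g :+ con 0ℤ))
    ≡.refl a (f 0) (g 0)
  scale-* a f g (suc n) = ≡.trans
    (≡.cong₂ ℤ._+_ {x = a ℤ.* f 0 ℤ.* g (suc n)} ≡.refl (scale-* a (shift f) g n))
    (solve 4 (λ a f g F → a :* f :* g :+ a :* F := a :* (f :* g :+ F))
      ≡.refl a (f 0) (g (suc n)) ((shift f * g) n))

  -- The convolution unfolds at the left factor, as f(0)g(n+1) plus coefficient n of `shift f * g`.
  -- This is the mirror recursion; commutativity compares the two.
  *-last : ∀ f g n → (f * g) (suc n) ≡ f (suc n) ℤ.* g 0 ℤ.+ (f * shift g) n
  *-last f g zero = solve 4 (λ f g f′ g′ →
    f :* g′ :+ (f′ :* g :+ con 0ℤ) := f′ :* g :+ (f :* g′ :+ con 0ℤ))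
    ≡.refl (f 0) (g 0) (f 1) (g 1)
  *-last f g (suc n) = ≡.trans
    (≡.cong₂ ℤ._+_ {x = f 0 ℤ.* g (suc (suc n))} ≡.refl (*-last (shift f) g n))
    (solve 3 (λ a b c → a :+ (b :+ c) := b :+ (a :+ c)) ≡.refl
      (f 0 ℤ.* g (suc (suc n))) (f (suc (suc n)) ℤ.* g 0) ((shift f * shift g) n))

  *-comm : ∀ f g → f * g ≗ g * f
  *-comm f g zero    = ≡.cong (ℤ._+ 0ℤ) (ℤ.*-comm (f 0) (g 0))
  *-comm f g (suc n) = ≡.trans
    (≡.cong₂ ℤ._+_ (ℤ.*-comm (f 0) (g (suc n))) (*-comm (shift f) g n))
    (≡.sym (*-last g f n))

  *-assoc : ∀ f g h → (f * g) * h ≗ f * (g * h)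
  *-assoc f g h zero = solve 3 (λ f g h →
    (f :* g :+ con 0ℤ) :* h :+ con 0ℤ := f :* (g :* h :+ con 0ℤ) :+ con 0ℤ) ≡.refl (f 0) (g 0) (h 0)
  *-assoc f g h (suc n) = begin
    (f 0 ℤ.* g 0 ℤ.+ 0ℤ) ℤ.* h (suc n) ℤ.+ (shift (f * g) * h) n
      ≡⟨ ≡.cong (λ a → (f 0 ℤ.* g 0 ℤ.+ 0ℤ) ℤ.* h (suc n) ℤ.+ a)
          (≡.trans (*-distribʳ h (λ k → f 0 ℤ.* shift g k) (shift f * g) n)
            (≡.cong₂ ℤ._+_ (scale-* (f 0) (shift g) h n) (*-assoc (shift f) g h n))) ⟩
    (f 0 ℤ.* g 0 ℤ.+ 0ℤ) ℤ.* h (suc n)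
      ℤ.+ (f 0 ℤ.* (shift g * h) n ℤ.+ (shift f * (g * h)) n)
      ≡⟨ solve 5 (λ f g h a b → (f :* g :+ con 0ℤ) :* h :+ (f :* a :+ b) := f :* (g :* h :+ a) :+ b)
          ≡.refl (f 0) (g 0) (h (suc n)) ((shift g * h) n) ((shift f * (g * h)) n) ⟩
    (f * (g * h)) (suc n)  ∎

  zero-* : ∀ f n → ((λ _ → 0ℤ) * f) n ≡ 0ℤ
  zero-* f zero    = ≡.refl
  zero-* f (suc n) = ≡.trans (ℤ.+-identityˡ _) (zero-* f n)

  constant-* : ∀ c f → constant c * f ≗ λ n → c ℤ.* f n
  constant-* c f zero    = ℤ.+-identityʳ _
  constant-* c f (suc n) =
    ≡.trans (≡.cong₂ ℤ._+_ {x = c ℤ.* f (suc n)} ≡.refl (zero-* f n)) (ℤ.+-identityʳ _)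

constant-zero : ∀ n → constant 0ℤ n ≡ 0ℤ
constant-zero zero    = ≡.refl
constant-zero (suc n) = ≡.refl

*-identityˡ : ∀ f → 1# * f ≗ f
*-identityˡ f n = ≡.trans (constant-* 1ℤ f n) (ℤ.*-identityˡ (f n))

neg-* : ∀ f g → (- f) * g ≗ - (f * g)
neg-* f g n = ≡.trans (*-congʳ g (λ k → ≡.sym (ℤ.-1*i≡-i (f k))) n)
  (≡.trans (scale-* -1ℤ f g n) (ℤ.-1*i≡-i _))

isCommutativeRing : IsCommutativeRing _≗_ _+_ _*_ -_ 0# 1#
isCommutativeRing = record
  { isRing = record
    { +-isAbelianGroup = record
      { isGroup = record
        { isMonoid = record
          { isSemigroup = record
            { isMagma = record
              { isEquivalence = record
                { refl  = λ _ → ≡.refl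
                ; sym   = λ f≗g n → ≡.sym (f≗g n)
                ; trans = λ f≗g g≗h n → ≡.trans (f≗g n) (g≗h n)
                }
              ; ∙-cong = λ f≗ g≗ n → ≡.cong₂ ℤ._+_ (f≗ n) (g≗ n)
              }
            ; assoc = λ f g h n → ℤ.+-assoc (f n) (g n) (h n)
            }
          ; identity =
              (λ f n → ≡.trans (≡.cong (ℤ._+ f n) (constant-zero n)) (ℤ.+-identityˡ (f n))) ,
              (λ f n → ≡.trans (≡.cong₂ ℤ._+_ {x = f n} ≡.refl (constant-zero n)) (ℤ.+-identityʳ (f n)))
          }
        ; inverse =
            (λ f n → ≡.trans (ℤ.+-inverseˡ (f n)) (≡.sym (constant-zero n))) ,
            (λ f n → ≡.trans (ℤ.+-inverseʳ (f n)) (≡.sym (constant-zero n)))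
        ; ⁻¹-cong = λ f≗g n → ≡.cong ℤ.-_ (f≗g n)
        }
      ; comm = λ f g n → ℤ.+-comm (f n) (g n)
      }
    ; *-cong     = *-cong
    ; *-assoc    = *-assoc
    ; *-identity = *-identityˡ , λ f n → ≡.trans (*-comm f 1# n) (*-identityˡ f n)
    ; distrib    =
        (λ f g h n → ≡.trans (*-comm f (g + h) n) (≡.trans (*-distribʳ f g h n)
          (≡.cong₂ ℤ._+_ (*-comm g f n) (*-comm h f n)))) ,
        *-distribʳ
    }
  ; *-comm = *-comm
  }

-- Inverses as geometric series.

geometric : PowerSeries → ℕ → PowerSeries
geometric d N = sum {N} λ k → d ^ toℕ k

*-distrib-sum : ∀ d N (f : ℕ → PowerSeries) →
                sum {N} (λ k → d * f (toℕ k)) ≗ d * sum {N} (f ∘ toℕ)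
*-distrib-sum d zero    f n = ≡.sym (≡.trans (*-comm d 0# n)
  (≡.trans (constant-* 0ℤ d n) (≡.sym (constant-zero n))))
*-distrib-sum d (suc N) f n = ≡.trans
  (≡.cong₂ ℤ._+_ {x = (d * f 0) n} ≡.refl (*-distrib-sum d N (f ∘ suc) n))
  (≡.sym (≡.trans (*-comm d (f 0 + rest) n) (≡.trans (*-distribʳ d (f 0) rest n)
    (≡.cong₂ ℤ._+_ (*-comm (f 0) d n) (*-comm rest d n)))))
  where rest = sum {N} (f ∘ suc ∘ toℕ)

*-local-< : ∀ d g g′ n → d 0 ≡ 0ℤ → (∀ k → k < n → g k ≡ g′ k) → (d * g) n ≡ (d * g′) n
*-local-< d g g′ zero d₀≡0 _ = ≡.trans (head g) (≡.sym (head g′))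
  where
  head : ∀ g → (d * g) 0 ≡ 0ℤ
  head g = ≡.trans (*-head d g) (≡.cong (ℤ._* g 0) d₀≡0)
*-local-< d g g′ (suc n) d₀≡0 g≡ = ≡.cong₂ ℤ._+_
  (≡.trans (≡.cong (ℤ._* g (suc n)) d₀≡0) (≡.sym (≡.cong (ℤ._* g′ (suc n)) d₀≡0)))
  (*-local n {shift d} {shift d} (λ _ _ → ≡.refl) (λ k k≤n → g≡ k (s≤s k≤n)))

module _ {d : PowerSeries} (d₀≡0 : d 0 ≡ 0ℤ) where

  geometric-suc : ∀ N n → geometric d (suc N) n ≡ 1# n ℤ.+ (d * geometric d N) n
  geometric-suc N n = ≡.cong₂ ℤ._+_ {x = 1# n} ≡.refl (*-distrib-sum d N (d ^_) n)

  -- `_⁻¹` truncates differently for each coefficient; stability lets all truncations be read as one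
  -- series.
  geometric-stable : ∀ M N n → n < M → n < N → geometric d M n ≡ geometric d N n
  geometric-stable (suc M) (suc N) n (s≤s n≤M) (s≤s n≤N) = ≡.trans (geometric-suc M n) (≡.trans
    (≡.cong₂ ℤ._+_ {x = 1# n} ≡.refl (*-local-< d (geometric d M) (geometric d N) n d₀≡0 λ k k<n →
      geometric-stable M N k (ℕ.<-≤-trans k<n n≤M) (ℕ.<-≤-trans k<n n≤N)))
    (≡.sym (geometric-suc N n)))

⁻¹-inverse : ∀ f → f 0 ≡ 1ℤ → f * f ⁻¹ ≗ 1#
⁻¹-inverse f f₀≡1 n = begin
  (f * f ⁻¹) n
    ≡⟨ solve 2 (λ a b → a := b :- (b :- a)) ≡.refl ((f * f ⁻¹) n) ((f ⁻¹) n) ⟩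
  (f ⁻¹) n ℤ.- ((f ⁻¹) n ℤ.- (f * f ⁻¹) n)
    ≡⟨ ≡.cong₂ ℤ._-_ f⁻¹≡ (≡.sym d*f⁻¹) ⟩
  1# n ℤ.+ (d * f ⁻¹) n ℤ.- (d * f ⁻¹) n
    ≡⟨ solve 2 (λ a b → a :+ b :- b := a) ≡.refl (1# n) ((d * f ⁻¹) n) ⟩
  1# n  ∎
  where
  open ℤSolver.+-*-Solver
  open ≡.≡-Reasoning
  d = 1# + - f
  d₀≡0 : d 0 ≡ 0ℤ
  d₀≡0 = ≡.cong (λ a → 1ℤ ℤ.- a) f₀≡1
  d*f⁻¹ : (d * f ⁻¹) n ≡ (f ⁻¹) n ℤ.- (f * f ⁻¹) n
  d*f⁻¹ = ≡.trans (*-distribʳ (f ⁻¹) 1# (- f) n) (≡.cong₂ ℤ._+_ (*-identityˡ (f ⁻¹) n)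
    (neg-* f (f ⁻¹) n))
  f⁻¹≡ : (f ⁻¹) n ≡ 1# n ℤ.+ (d * f ⁻¹) n
  -- Coefficient n comes from n + 1 terms. Their tail `geometric d n` agrees with `f ⁻¹` below n,
  -- which is as far as the factor d, without constant term, reads.
  f⁻¹≡ = ≡.trans (geometric-suc {d} d₀≡0 n n) (≡.cong₂ ℤ._+_ {x = 1# n} ≡.refl
    (*-local-< d (geometric d n) (f ⁻¹) n d₀≡0 λ k k<n → geometric-stable {d} d₀≡0 n (suc k) k k<n ℕ.≤-refl))

1-head : ∀ f → f 0 ≡ 0ℤ → (1# + - f) 0 ≡ 1ℤ
1-head f f₀≡0 = ≡.cong (λ a → 1ℤ ℤ.- a) f₀≡0

-- Multiplication by powers of q.

q*-shift : ∀ k f n → (q^ suc k * f) (suc n) ≡ (q^ k * f) n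
q*-shift k f n = ℤ.+-identityˡ _

q^0≗1 : q^ 0 ≗ 1#
q^0≗1 zero    = ≡.refl
q^0≗1 (suc n) = ≡.refl

q^0* : ∀ f → q^ 0 * f ≗ f
q^0* f n = ≡.trans (*-congʳ f q^0≗1 n) (*-identityˡ f n)

q*-suc : ∀ f n → (q^ 1 * f) (suc n) ≡ f n
q*-suc f n = ≡.trans (q*-shift 0 f n) (q^0* f n)

q^suc : ∀ n → q^ 1 * q^ n ≗ q^ suc n
q^suc n zero    = ≡.refl
q^suc n (suc k) = q*-suc (q^ n) k

q^≗ : ∀ n → (q^ 1) ^ n ≗ q^ n
q^≗ zero    k = ≡.sym (q^0≗1 k)
q^≗ (suc n) k = ≡.trans (*-congˡ (q^ 1) (q^≗ n) k) (q^suc n k)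

q^*-drop : ∀ n δ → (∀ k → k < n → δ k ≡ 0ℤ) → δ ≗ q^ n * λ k → δ (n ℕ.+ k)
q^*-drop zero    δ δ≡0 k       = ≡.sym (q^0* δ k)
q^*-drop (suc n) δ δ≡0 zero    = δ≡0 0 (s≤s z≤n)
q^*-drop (suc n) δ δ≡0 (suc k) = ≡.trans (q^*-drop n (shift δ) (λ j j<n → δ≡0 (suc j) (s≤s j<n)) k)
  (≡.sym (q*-shift n (λ j → δ (suc n ℕ.+ j)) k))

q^*-< : ∀ n f k → k < n → (q^ n * f) k ≡ 0ℤ
q^*-< (suc n) f zero    _         = ≡.refl
q^*-< (suc n) f (suc k) (s≤s k<n) = ≡.trans (q*-shift n f k) (q^*-< n f k k<n)

-- The substitutions q ↦ q² and q ↦ -q, and bisection.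

dilate : PowerSeries → PowerSeries
dilate f zero          = f 0
dilate f (suc zero)    = 0ℤ
dilate f (suc (suc n)) = dilate (shift f) n

dilate-local : ∀ n {f g} → (∀ k → k ≤ n → f k ≡ g k) → dilate f n ≡ dilate g n
dilate-local zero          f≡g = f≡g 0 z≤n
dilate-local (suc zero)    f≡g = ≡.refl
dilate-local (suc (suc n)) f≡g = dilate-local n λ k k≤n → f≡g (suc k) (s≤s (ℕ.m≤n⇒m≤1+n k≤n))

dilate-cong : ∀ {f g} → f ≗ g → dilate f ≗ dilate g
dilate-cong f≗g n = dilate-local n λ k _ → f≗g k

dilate-+ : ∀ f g → dilate (f + g) ≗ dilate f + dilate g
dilate-+ f g zero          = ≡.refl
dilate-+ f g (suc zero)    = ≡.refl
dilate-+ f g (suc (suc n)) = dilate-+ (shift f) (shift g) n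

dilate-scale : ∀ c f → dilate (λ n → c ℤ.* f n) ≗ λ n → c ℤ.* dilate f n
dilate-scale c f zero          = ≡.refl
dilate-scale c f (suc zero)    = ≡.sym (ℤ.*-zeroʳ c)
dilate-scale c f (suc (suc n)) = dilate-scale c (shift f) n

-- The odd coefficients of `dilate f` vanish, so two steps of the convolution shift f once.
dilate-*-suc² : ∀ f g n → (dilate f * g) (suc (suc n)) ≡
                f 0 ℤ.* g (suc (suc n)) ℤ.+ (dilate (shift f) * g) n
dilate-*-suc² f g n = ≡.cong₂ ℤ._+_ {x = f 0 ℤ.* g (suc (suc n))} ≡.refl (ℤ.+-identityˡ _)

dilate-* : ∀ f g → dilate (f * g) ≗ dilate f * dilate g
dilate-* f g zero          = ≡.refl
dilate-* f g (suc zero)    = ≡.sym (≡.cong₂ ℤ._+_ (ℤ.*-zeroʳ (f 0)) ≡.refl)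
dilate-* f g (suc (suc n)) = ≡.trans (dilate-+ (λ k → f 0 ℤ.* shift g k) (shift f * g) n)
  (≡.trans (≡.cong₂ ℤ._+_ (dilate-scale (f 0) (shift g) n) (dilate-* (shift f) g n))
    (≡.sym (dilate-*-suc² f (dilate g) n)))

dilate-zero : ∀ n → dilate (λ _ → 0ℤ) n ≡ 0ℤ
dilate-zero zero          = ≡.refl
dilate-zero (suc zero)    = ≡.refl
dilate-zero (suc (suc n)) = dilate-zero n

dilate-constant : ∀ c → dilate (constant c) ≗ constant c
dilate-constant c zero          = ≡.refl
dilate-constant c (suc zero)    = ≡.refl
dilate-constant c (suc (suc n)) = dilate-zero n

dilate-q^ : ∀ k → dilate (q^ k) ≗ q^ double k
dilate-q^ zero    n             = ≡.trans (dilate-cong q^0≗1 n)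
  (≡.trans (dilate-constant 1ℤ n) (≡.sym (q^0≗1 n)))
dilate-q^ (suc k) zero          = ≡.refl
dilate-q^ (suc k) (suc zero)    = ≡.refl
dilate-q^ (suc k) (suc (suc n)) = dilate-q^ k n

bisect : PowerSeries → PowerSeries
bisect f n = f (double n)

bisect-dilate* : ∀ f g → bisect (dilate f * g) ≗ f * bisect g
bisect-dilate* f g zero    = ≡.refl
bisect-dilate* f g (suc n) = ≡.trans (dilate-*-suc² f g (double n))
  (≡.cong₂ ℤ._+_ {x = f 0 ℤ.* g (double (suc n))} ≡.refl (bisect-dilate* (shift f) g n))

bisect-dilate : ∀ f → bisect (dilate f) ≗ f
bisect-dilate f zero    = ≡.refl
bisect-dilate f (suc n) = bisect-dilate (shift f) n

alternate : PowerSeries → PowerSeries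
alternate f zero    = f 0
alternate f (suc n) = ℤ.- alternate (shift f) n

alternate-cong : ∀ {f g} → f ≗ g → alternate f ≗ alternate g
alternate-cong f≗g zero    = f≗g 0
alternate-cong f≗g (suc n) = ≡.cong ℤ.-_ (alternate-cong (f≗g ∘ suc) n)

alternate-+ : ∀ f g → alternate (f + g) ≗ alternate f + alternate g
alternate-+ f g zero    = ≡.refl
alternate-+ f g (suc n) = ≡.trans (≡.cong ℤ.-_ (alternate-+ (shift f) (shift g) n))
  (ℤ.neg-distrib-+ (alternate (shift f) n) _)

alternate-scale : ∀ c f → alternate (λ n → c ℤ.* f n) ≗ λ n → c ℤ.* alternate f n
alternate-scale c f zero    = ≡.refl
alternate-scale c f (suc n) = ≡.trans (≡.cong ℤ.-_ (alternate-scale c (shift f) n))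
  (ℤ.neg-distribʳ-* c _)

alternate-* : ∀ f g → alternate (f * g) ≗ alternate f * alternate g
alternate-* f g zero    = ≡.refl
alternate-* f g (suc n) = begin
  ℤ.- alternate (λ k → f 0 ℤ.* shift g k ℤ.+ (shift f * g) k) n
    ≡⟨ ≡.cong ℤ.-_ (≡.trans (alternate-+ (λ k → f 0 ℤ.* shift g k) (shift f * g) n)
        (≡.cong₂ ℤ._+_ (alternate-scale (f 0) (shift g) n) (alternate-* (shift f) g n))) ⟩
  ℤ.- (f 0 ℤ.* alternate (shift g) n ℤ.+ (alternate (shift f) * alternate g) n)
    ≡⟨ ℤ.neg-distrib-+ (f 0 ℤ.* alternate (shift g) n) _ ⟩
  ℤ.- (f 0 ℤ.* alternate (shift g) n) ℤ.+ ℤ.- (alternate (shift f) * alternate g) n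
    ≡⟨ ≡.cong₂ ℤ._+_ (ℤ.neg-distribʳ-* (f 0) _) (≡.sym (neg-* (alternate (shift f)) (alternate g) n)) ⟩
  (alternate f * alternate g) (suc n)  ∎
  where open ≡.≡-Reasoning

alternate-zero : ∀ n → alternate (λ _ → 0ℤ) n ≡ 0ℤ
alternate-zero zero    = ≡.refl
alternate-zero (suc n) = ≡.cong ℤ.-_ (alternate-zero n)

alternate-constant : ∀ c → alternate (constant c) ≗ constant c
alternate-constant c zero    = ≡.refl
alternate-constant c (suc n) = ≡.cong ℤ.-_ (alternate-zero n)

alternate-q : alternate (q^ 1) ≗ - (q^ 1)
alternate-q zero    = ≡.refl
alternate-q (suc n) = ≡.cong ℤ.-_ (≡.trans (alternate-cong q^0≗1 n)
  (≡.trans (alternate-constant 1ℤ n) (≡.sym (q^0≗1 n))))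

alternate-dilate : ∀ f → alternate (dilate f) ≗ dilate f
alternate-dilate f zero          = ≡.refl
alternate-dilate f (suc zero)    = ≡.refl
alternate-dilate f (suc (suc n)) = ≡.trans (ℤ.neg-involutive _) (alternate-dilate (shift f) n)

-- The opaque product and the instance of the abstract ring.

infixl 7 _⊛_

-- The same product, but opaque: otherwise the conversion checker unfolds
-- eta quotients into explicit convolutions.
opaque
  _⊛_ : PowerSeries → PowerSeries → PowerSeries
  _⊛_ = _*_

  *≗⊛ : ∀ f g → f * g ≗ f ⊛ g
  *≗⊛ f g n = ≡.refl

  ⊛-isCommutativeRing : IsCommutativeRing _≗_ _+_ _⊛_ -_ 0# 1#
  ⊛-isCommutativeRing = isCommutativeRing

⊛-commutativeRing : CommutativeRing 0ℓ 0ℓ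
⊛-commutativeRing = record { isCommutativeRing = ⊛-isCommutativeRing }

open CommutativeRing ⊛-commutativeRing using ()
  renaming ( refl to ≗-refl; sym to ≗-sym; trans to ≗-trans
           ; *-cong to ⊛-cong; *-congˡ to ⊛-congˡ; *-congʳ to ⊛-congʳ
           ; *-assoc to ⊛-assoc; *-comm to ⊛-comm
           ; *-identityˡ to ⊛-identityˡ; *-identityʳ to ⊛-identityʳ )
open Exp (CommutativeRing.commutativeSemiring ⊛-commutativeRing) using ()
  renaming (_^_ to _^⊛_; ^-congˡ to ^⊛-congˡ)

^≗^⊛ : ∀ f n → f ^ n ≗ f ^⊛ n
^≗^⊛ f zero    = ≗-refl
^≗^⊛ f (suc n) = ≗-trans (*-congˡ f (^≗^⊛ f n)) (*≗⊛ f (f ^⊛ n))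

q^⊛≗ : ∀ n → (q^ 1) ^⊛ n ≗ q^ n
q^⊛≗ n = ≗-trans (≗-sym (^≗^⊛ (q^ 1) n)) (q^≗ n)

⊛⁻¹-inverse : ∀ f → f 0 ≡ 1ℤ → f ⊛ f ⁻¹ ≗ 1#
⊛⁻¹-inverse f f₀≡1 = ≗-trans (≗-sym (*≗⊛ f (f ⁻¹))) (⁻¹-inverse f f₀≡1)

opaque
  unfolding _⊛_

  constant-⊛ : ∀ a b → constant (a ℤ.* b) ≗ constant a ⊛ constant b
  constant-⊛ a b zero    = ≡.sym (constant-* a (constant b) 0)
  constant-⊛ a b (suc n) = ≡.sym (≡.trans (constant-* a (constant b) (suc n)) (ℤ.*-zeroʳ a))

  dilate-⊛ : ∀ f g → dilate (f ⊛ g) ≗ dilate f ⊛ dilate g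
  dilate-⊛ = dilate-*

  alternate-⊛ : ∀ f g → alternate (f ⊛ g) ≗ alternate f ⊛ alternate g
  alternate-⊛ = alternate-*

  bisect-dilate⊛ : ∀ f g → bisect (dilate f ⊛ g) ≗ f ⊛ bisect g
  bisect-dilate⊛ = bisect-dilate*

q⊛-head : ∀ f → (q^ 1 ⊛ f) 0 ≡ 0ℤ
q⊛-head f = ≡.sym (*≗⊛ (q^ 1) f 0)

q⊛-suc : ∀ f n → (q^ 1 ⊛ f) (suc n) ≡ f n
q⊛-suc f n = ≡.trans (≡.sym (*≗⊛ (q^ 1) f (suc n))) (q*-suc f n)

q^⊛ : ∀ n h → (q^ 1) ^⊛ n ⊛ h ≗ q^ n * h
q^⊛ n h = ≗-trans (⊛-congʳ (q^⊛≗ n)) (≗-sym (*≗⊛ (q^ n) h))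

integerPowerSeries : QSeriesRing
integerPowerSeries = record
  { Carrier = PowerSeries
  ; _≈_ = _≗_
  ; _+_ = _+_
  ; _*_ = _⊛_
  ; -_ = -_
  ; ι = constant
  ; isCommutativeRing = ⊛-isCommutativeRing
  ; ι-+ = λ { a b zero → ≡.refl ; a b (suc n) → ≡.refl }
  ; ι-* = constant-⊛
  ; ι-‿ = λ { a zero → ≡.refl ; a (suc n) → ≡.refl }
  ; q = q^ 1
  -- Coefficient n is forced to vanish by divisibility by qⁿ⁺¹.
  ; separated = λ f f∈ n → let h , eq = f∈ (suc n) in
      ≡.trans (eq n) (≡.trans (q^⊛ (suc n) h n)
        (≡.trans (q^*-< (suc n) h n ℕ.≤-refl) (≡.sym (constant-zero n))))
  ; unit = λ f → (1# + - (q^ 1 ⊛ f)) ⁻¹ ,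
      ⊛⁻¹-inverse (1# + - (q^ 1 ⊛ f)) (1-head (q^ 1 ⊛ f) (q⊛-head f))
  ; V = dilate
  ; σ = alternate
  ; U = bisect
  ; V-cong = dilate-cong
  ; V-+ = dilate-+
  ; V-* = dilate-⊛
  ; V-ι = dilate-constant
  ; V-q = λ n → ≡.trans (dilate-q^ 1 n) (≡.sym (≡.trans (≡.sym (*≗⊛ (q^ 1) (q^ 1) n)) (q^suc 1 n)))
  ; V-injective = λ {f} {g} Vf≗Vg n → ≡.trans (≡.sym (bisect-dilate f n))
      (≡.trans (Vf≗Vg (double n)) (bisect-dilate g n))
  ; σ-cong = alternate-cong
  ; σ-+ = alternate-+
  ; σ-* = alternate-⊛
  ; σ-ι = alternate-constant
  ; σ-q = alternate-q
  ; σ-V = alternate-dilate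
  ; U-cong = λ f≗g n → f≗g (double n)
  ; U-+ = λ f g n → ≡.refl
  ; U-V* = bisect-dilate⊛
  ; U-1 = λ { zero → ≡.refl ; (suc n) → ≡.refl }
  ; U-q = λ { zero → ≡.refl ; (suc n) → ≡.refl }
  }

open Theory integerPowerSeries
  using ( _≋_mod_; _by_; ≋-refl; ≋-trans; ≋-sym; ≋-*; ≋-^; ≋-V; ≋-reflexive; ≋⇒≈; V-1-; ∏; horner; euler
        ; Polynomial; Polynomial-∘; resp; gen; U²; coefficients; module EulerProduct )

-- Infinite products as limits.

≡⇒≋ : ∀ {f g n} → (∀ k → k < n → f k ≡ g k) → f ≋ g mod n
≡⇒≋ {f} {g} {n} f≡g = (λ k → δ (n ℕ.+ k)) by λ k →
  ≡.trans (split (f k) (g k)) (≡.cong₂ ℤ._+_ {x = g k} ≡.refl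
    (≡.trans (q^*-drop n δ (λ j j<n → ≡.trans (≡.cong (λ a → a ℤ.- g j) (f≡g j j<n)) (ℤ.+-inverseʳ (g j))) k)
      (≡.sym (q^⊛ n (λ j → δ (n ℕ.+ j)) k))))
  where
  δ : PowerSeries
  δ k = f k ℤ.- g k
  split : ∀ a b → a ≡ b ℤ.+ (a ℤ.- b)
  split = solve 2 (λ a b → a := b :+ (a :- b)) ≡.refl
    where open ℤSolver.+-*-Solver

≋⇒≡ : ∀ {f g n} → f ≋ g mod n → ∀ k → k < n → f k ≡ g k
≋⇒≡ {f} {g} {n} (h by eq) k k<n = ≡.trans (eq k) (≡.trans
  (≡.cong₂ ℤ._+_ {x = g k} ≡.refl (≡.trans (q^⊛ n h k) (q^*-< n h k k<n)))
  (ℤ.+-identityʳ (g k)))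

-- `product` peels off its first factor and `∏` its last; `unsnoc` moves the first factor through.
product≗∏ : ∀ (f : ℕ → PowerSeries) n → product {n} (f ∘ toℕ) ≗ ∏ f n
product≗∏ f zero    = ≗-refl
product≗∏ f (suc n) = ≗-trans (*-congˡ (f 0) (product≗∏ (f ∘ suc) n))
  (≗-trans (*≗⊛ (f 0) (∏ (f ∘ suc) n)) (unsnoc n))
  where
  unsnoc : ∀ n → f 0 ⊛ ∏ (f ∘ suc) n ≗ ∏ f n ⊛ f n
  unsnoc zero    = ⊛-comm (f 0) 1#
  unsnoc (suc n) = ≗-trans (≗-sym (⊛-assoc (f 0) (∏ (f ∘ suc) n) (f (suc n)))) (⊛-congʳ (unsnoc n))

module _ (f : ℕ → PowerSeries) (f≋1 : ∀ n → f n ≋ 1# mod suc n) where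

  -- Each factor of index m > n is 1 modulo qᵐ⁺¹, so it leaves coefficient n alone.
  ∏-stable : ∀ m n → n < m → ∏ f m n ≡ ∏ f (suc n) n
  ∏-stable (suc m) n (s≤s n≤m) with ℕ.m≤n⇒m<n∨m≡n n≤m
  ... | inj₂ ≡.refl = ≡.refl
  ... | inj₁ n<m    = ≡.trans
    (≋⇒≡ (≋-* (≋-refl {f = ∏ f m}) (f≋1 m)) n (s≤s n≤m))
    (≡.trans (⊛-identityʳ (∏ f m) n) (∏-stable m n n<m))

  ∏∞-limit : ∀ n → ∏∞ f ≋ ∏ f n mod n
  ∏∞-limit n = ≡⇒≋ λ k k<n → ≡.trans (product≗∏ f (suc k) k) (≡.sym (∏-stable n k k<n))

1-q^≋1 : ∀ m n → n < m → 1# + - q^ m ≋ 1# mod (suc n)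
1-q^≋1 m n n<m = ≡⇒≋ λ k k≤n → ≡.trans (≡.cong (λ a → 1# k ℤ.- a) (vanish m k (ℕ.<-≤-trans k≤n n<m)))
  (ℤ.+-identityʳ (1# k))
  where
  vanish : ∀ m k → k < m → (q^ m) k ≡ 0ℤ
  vanish (suc m) zero    _         = ≡.refl
  vanish (suc m) (suc k) (s≤s k<m) = vanish m k k<m

1-cong : ∀ {f g} → f ≗ g → 1# + - f ≗ 1# + - g
1-cong f≗g n = ≡.cong (λ a → 1# n ℤ.- a) (f≗g n)

1-q^-cong : ∀ {m n} → m ≡ n → 1# + - q^ m ≗ 1# + - q^ n
1-q^-cong ≡.refl = ≗-refl

E-factor : ℕ → ℕ → PowerSeries
E-factor k m = 1# + - q^ (k ℕ.+ k ℕ.* m)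

E-limit : ∀ k .{{_ : ℕ.NonZero k}} n → E k ≋ ∏ (E-factor k) n mod n
E-limit (suc k) = ∏∞-limit (E-factor (suc k)) λ n →
  1-q^≋1 _ n (s≤s (ℕ.≤-trans (ℕ.m≤m+n n (k ℕ.* n)) (ℕ.m≤n+m _ k)))

euler≗∏ : ∀ n → euler n ≗ ∏ (E-factor 1) n
euler≗∏ zero    = ≗-refl
euler≗∏ (suc n) = ⊛-cong (euler≗∏ n) (≗-trans (1-cong (q^⊛≗ (suc n)))
  (1-q^-cong (≡.cong suc (≡.sym (ℕ.+-identityʳ n)))))

E₁-limit : ∀ n → E 1 ≋ euler n mod n
E₁-limit n = ≋-trans (E-limit 1 n) (≋-reflexive (≗-sym (euler≗∏ n)))

dilate-1-q^ : ∀ n → dilate (1# + - q^ n) ≗ 1# + - q^ double n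
dilate-1-q^ n = ≗-trans (V-1- (q^ n)) (1-cong (dilate-q^ n))

dilate-E : ∀ k .{{_ : ℕ.NonZero k}} → dilate (E k) ≗ E (2 ℕ.* k)
dilate-E k@(suc k-1) = ≋⇒≈ λ n →
  ≋-trans (≋-V (E-limit k n))
    (≋-trans (≋-reflexive (finite n)) (≋-sym (E-limit (2 ℕ.* k) n)))
  where
  open ℕ.+-*-Solver
  exponent : ∀ n → double (k ℕ.+ k ℕ.* n) ≡ 2 ℕ.* k ℕ.+ 2 ℕ.* k ℕ.* n
  exponent n = ≡.trans (double≡+ (k ℕ.+ k ℕ.* n)) (solve 2 (λ k n →
    (k :+ k :* n) :+ (k :+ k :* n) := con 2 :* k :+ con 2 :* k :* n) ≡.refl k n)
  finite : ∀ n → dilate (∏ (E-factor k) n) ≗ ∏ (E-factor (2 ℕ.* k)) n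
  finite zero    = dilate-constant 1ℤ
  finite (suc n) = ≗-trans (dilate-⊛ (∏ (E-factor k) n) (E-factor k n)) (⊛-cong (finite n)
    (≗-trans (dilate-1-q^ (k ℕ.+ k ℕ.* n)) (1-q^-cong (exponent n))))

*-head-1 : ∀ f g → f 0 ≡ 1ℤ → g 0 ≡ 1ℤ → (f * g) 0 ≡ 1ℤ
*-head-1 f g f₀≡1 g₀≡1 = ≡.trans (*-head f g) (≡.cong₂ ℤ._*_ f₀≡1 g₀≡1)

^-head-1 : ∀ f n → f 0 ≡ 1ℤ → (f ^ n) 0 ≡ 1ℤ
^-head-1 f zero    f₀≡1 = ≡.refl
^-head-1 f (suc n) f₀≡1 = *-head-1 f (f ^ n) f₀≡1 (^-head-1 f n f₀≡1)

^⊛-to-^ : ∀ f g n → f ≗ g → f ^⊛ n ≗ g ^ n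
^⊛-to-^ f g n f≗g = ≗-trans (^⊛-congˡ n f≗g) (≗-sym (^≗^⊛ g n))

⊛-to-* : ∀ f f′ g g′ → f ≗ f′ → g ≗ g′ → f ⊛ g ≗ f′ * g′
⊛-to-* f f′ g g′ f≗f′ g≗g′ = ≗-trans (⊛-cong f≗f′ g≗g′) (≗-sym (*≗⊛ f′ g′))

horner≗evaluate : ∀ p f → horner f p ≗ evaluate p f
horner≗evaluate []      f = ≗-refl
horner≗evaluate (c ∷ p) f n = ≡.cong₂ ℤ._+_ {x = constant c n} ≡.refl
  (⊛-to-* f f (horner f p) (evaluate p f) (≗-refl {x = f}) (horner≗evaluate p f) n)

module _ (a b : PowerSeries) (a₀≡1 : a 0 ≡ 1ℤ) where
  open SetoidReasoning (CommutativeRing.setoid ⊛-commutativeRing)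

  quotient-⊛ : ∀ m n → b ^ m * (a ^ n) ⁻¹ ⊛ a ^⊛ n ≗ b ^⊛ m
  quotient-⊛ m n = begin
    b ^ m * (a ^ n) ⁻¹ ⊛ a ^⊛ n
      ≈⟨ ⊛-cong (*≗⊛ (b ^ m) ((a ^ n) ⁻¹)) (≗-sym (^≗^⊛ a n)) ⟩
    b ^ m ⊛ (a ^ n) ⁻¹ ⊛ a ^ n
      ≈⟨ ≗-trans (⊛-assoc (b ^ m) ((a ^ n) ⁻¹) (a ^ n)) (⊛-congˡ (⊛-comm ((a ^ n) ⁻¹) (a ^ n))) ⟩
    b ^ m ⊛ (a ^ n ⊛ (a ^ n) ⁻¹)
      ≈⟨ ⊛-congˡ (⊛⁻¹-inverse (a ^ n) (^-head-1 a n a₀≡1)) ⟩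
    b ^ m ⊛ 1#
      ≈⟨ ≗-trans (⊛-identityʳ (b ^ m)) (^≗^⊛ b m) ⟩
    b ^⊛ m  ∎

1^⊛ : ∀ n → 1# ^⊛ n ≗ 1#
1^⊛ zero    = ≗-refl
1^⊛ (suc n) = ≗-trans (⊛-identityˡ (1# ^⊛ n)) (1^⊛ n)

module _ (a b g : PowerSeries) (m n k : ℕ) (g⊛a≗b : g ⊛ a ^⊛ n ≗ b ^⊛ m)
         (a≋1 : a ≋ 1# mod k) (b≋1 : b ≋ 1# mod k) where
  -- Modulo qᵏ the equation g aⁿ = bᵐ reads g = 1, so no inverse has to be expanded.
  quotient≋1 : g ≋ 1# mod k
  quotient≋1 = ≋-trans
    (≋-trans (≋-reflexive (≗-sym (⊛-identityʳ g)))
      (≋-* (≋-refl {f = g}) (≋-sym (≋-trans (≋-^ n a≋1) (≋-reflexive (1^⊛ n))))))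
    (≋-trans (≋-reflexive g⊛a≗b) (≋-trans (≋-^ m b≋1) (≋-reflexive (1^⊛ m))))

-- The residues λ.

3λ≡1+2·4^α : ∀ α → 3 ℕ.* λ[ α ] ≡ 1 ℕ.+ 2 ℕ.* 4 ℕ.^ α
-- The divisibility witness inside `leastInverse` has quotient 2.
3λ≡1+2·4^α α = ≡.cong suc (ℕ._∣_.equality (IsLeastInverse.inverse (proj₂ (leastInverse α))))

λ-suc : ∀ α → λ[ suc α ] ≡ 2 ℕ.* 4 ℕ.^ α ℕ.+ λ[ α ]
λ-suc α = ℕ.*-cancelˡ-≡ _ _ 3 (begin
  3 ℕ.* λ[ suc α ]                         ≡⟨ 3λ≡1+2·4^α (suc α) ⟩
  1 ℕ.+ 2 ℕ.* (4 ℕ.* 4 ℕ.^ α)              ≡⟨ solve 1 (λ p → con 1 :+ con 2 :* (con 4 :* p) :=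
                                                con 6 :* p :+ (con 1 :+ con 2 :* p)) ≡.refl (4 ℕ.^ α) ⟩
  6 ℕ.* 4 ℕ.^ α ℕ.+ (1 ℕ.+ 2 ℕ.* 4 ℕ.^ α)  ≡⟨ ≡.cong (6 ℕ.* 4 ℕ.^ α ℕ.+_) (3λ≡1+2·4^α α) ⟨
  6 ℕ.* 4 ℕ.^ α ℕ.+ 3 ℕ.* λ[ α ]           ≡⟨ solve 2 (λ p l → con 6 :* p :+ con 3 :* l :=
                                                con 3 :* (con 2 :* p :+ l)) ≡.refl (4 ℕ.^ α) λ[ α ] ⟩
  3 ℕ.* (2 ℕ.* 4 ℕ.^ α ℕ.+ λ[ α ])         ∎)
  where
  open ℕ.+-*-Solver
  open ≡.≡-Reasoning

progression : PowerSeries → ℕ → PowerSeries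
progression d α n = d (4 ℕ.^ α ℕ.* n ℕ.+ λ[ α ])

double² : ∀ n → double (double n) ≡ 4 ℕ.* n
double² n = ≡.trans (double≡+ (double n)) (≡.trans (≡.cong₂ ℕ._+_ (double≡+ n) (double≡+ n))
  (solve 1 (λ n → (n :+ n) :+ (n :+ n) := con 4 :* n) ≡.refl n))
  where open ℕ.+-*-Solver

-- primForce evaluates f and g to convolutions before P receives them, so the
-- hypothesis holds by λ P z → z whenever f and g unfold to the same product.
-- Conversion of f with g would evaluate the coefficients f n and g n instead,
-- which is not feasible for powers like E 1 ^ 26.
unforce : ∀ (f g : PowerSeries) →
          (∀ (P : PowerSeries → Set) → primForce f P → primForce g P) → f ≡ g
unforce f g h = ≡.subst (λ A → A) (primForceLemma g (f ≡_))
  (h (f ≡_) (≡.subst (λ A → A) (≡.sym (primForceLemma f (f ≡_))) ≡.refl))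

-- Definitions of L and x for arbitrary series in place of the Euler products and
-- d₇; on concrete ones any conversion check would evaluate coefficients.

L-of : (E₁ E₂ E₄ d : PowerSeries) → ℕ → PowerSeries
L-of E₁ E₂ E₄ d α = E₁ ^ 26 * E₄ ^ 2 * (E₂ ^ 13) ⁻¹
    * (q^ 1 * λ n → d (4 ℕ.^ α ℕ.* n ℕ.+ λ[ α ]))

x-of : (E₁ E₂ E₄ E₈ : PowerSeries) → PowerSeries
x-of E₁ E₂ E₄ E₈ = q^ 1 * (E₂ ^ 2 * E₈ ^ 4)
    * (E₁ ^ 4 * E₄ ^ 2) ⁻¹

L-of≡ : ∀ E₁ E₂ E₄ d α → L-of E₁ E₂ E₄ d α ≡
        E₁ ^ 26 * E₄ ^ 2 * (E₂ ^ 13) ⁻¹ * (q^ 1 * progression d α)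
L-of≡ E₁ E₂ E₄ d α = unforce (L-of E₁ E₂ E₄ d α)
  (E₁ ^ 26 * E₄ ^ 2 * (E₂ ^ 13) ⁻¹ * (q^ 1 * progression d α)) λ P z → z

x-of≡ : ∀ E₁ E₂ E₄ E₈ → x-of E₁ E₂ E₄ E₈ ≡ q^ 1 * (E₂ ^ 2 * E₈ ^ 4) * (E₁ ^ 4 * E₄ ^ 2) ⁻¹
x-of≡ E₁ E₂ E₄ E₈ = unforce (x-of E₁ E₂ E₄ E₈)
  (q^ 1 * (E₂ ^ 2 * E₈ ^ 4) * (E₁ ^ 4 * E₄ ^ 2) ⁻¹) λ P z → z

-- The factors of the product for d₇.

module Factors
  (a b : ℕ → PowerSeries)
  (a≗ : ∀ k → a k ≗ 1# + - q^ suc k)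
  (b≗ : ∀ k → b k ≗ 1# + - q^ double (suc k))
  where

  factor : ℕ → PowerSeries
  factor k = b k ^ 7 * (a k ^ 22) ⁻¹

  factor-⊛ : ∀ k → factor k ⊛ a k ^⊛ 22 ≗ b k ^⊛ 7
  factor-⊛ k = quotient-⊛ (a k) (b k) (a≗ k 0) 7 22

  factor≋1 : ∀ k → factor k ≋ 1# mod suc k
  factor≋1 k = quotient≋1 (a k) (b k) (factor k) 7 22 (suc k) (factor-⊛ k)
    (≋-trans (≋-reflexive (a≗ k)) (1-q^≋1 (suc k) k ℕ.≤-refl))
    (≋-trans (≋-reflexive (b≗ k)) (1-q^≋1 (double (suc k)) k
      (≡.subst (suc k ≤_) (≡.sym (double≡+ (suc k))) (ℕ.m≤m+n (suc k) (suc k)))))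

  a≗′ : ∀ k → a k ≗ 1# + - ((q^ 1) ^⊛ suc k)
  a≗′ k = ≗-trans (a≗ k) (1-cong (≗-sym (q^⊛≗ (suc k))))

  factor-power : ∀ k → factor k ⊛ (1# + - ((q^ 1) ^⊛ suc k)) ^⊛ 22 ≗
                       dilate (1# + - ((q^ 1) ^⊛ suc k)) ^⊛ 7
  factor-power k = ≗-trans (⊛-congˡ {factor k} (^⊛-congˡ 22 (≗-sym (a≗′ k))))
    (≗-trans (factor-⊛ k) (^⊛-congˡ 7 (≗-trans (b≗ k)
      (≗-trans (≗-sym (dilate-1-q^ (suc k))) (dilate-cong (≗-trans (≗-sym (a≗ k)) (a≗′ k)))))))

-- The theorem for variables in place of the Euler products.

module Divisibility
  (E₁ E₂ E₄ E₈ : PowerSeries)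
  (E₁-limit : ∀ n → E₁ ≋ euler n mod n)
  (E₂≗ : dilate E₁ ≗ E₂)
  (E₄≗ : dilate E₂ ≗ E₄)
  (E₈≗ : dilate E₄ ≗ E₈)
  (d : PowerSeries)
  (factor : ℕ → PowerSeries)
  (factor-power : ∀ k → factor k ⊛ (1# + - ((q^ 1) ^⊛ suc k)) ^⊛ 22 ≗
                         dilate (1# + - ((q^ 1) ^⊛ suc k)) ^⊛ 7)
  (d-limit : ∀ n → d ≋ ∏ factor n mod n)
  where

  open EulerProduct E₁ E₁-limit
    using (e₂; e₄; P; D; t; T; initial; step; t*-polynomial; P-product; x-product; D-product)
    renaming (x to x′)

  e₄≗E₄ : e₄ ≗ E₄
  e₄≗E₄ = ≗-trans (dilate-cong E₂≗) E₄≗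

  e₈≗E₈ : dilate e₄ ≗ E₈
  e₈≗E₈ = ≗-trans (dilate-cong e₄≗E₄) E₈≗

  E₁-head : E₁ 0 ≡ 1ℤ
  E₁-head = ≡.trans (≋⇒≡ (E₁-limit 1) 0 (s≤s z≤n)) (≡.trans (⊛-identityˡ (1# + - (q^ 1 ⊛ 1#)) 0)
    (1-head (q^ 1 ⊛ 1#) (q⊛-head 1#)))

  E₂-head : E₂ 0 ≡ 1ℤ
  E₂-head = ≡.trans (≡.sym (E₂≗ 0)) E₁-head

  E₄-head : E₄ 0 ≡ 1ℤ
  E₄-head = ≡.trans (≡.sym (E₄≗ 0)) E₂-head

  P≗ : E₁ ^ 26 * E₄ ^ 2 * (E₂ ^ 13) ⁻¹ ≗ P
  P≗ = ≗-trans
    (≗-sym (⊛-to-* (E₁ ^⊛ 26 ⊛ e₄ ^⊛ 2) (E₁ ^ 26 * E₄ ^ 2) i i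
      (⊛-to-* (E₁ ^⊛ 26) (E₁ ^ 26) (e₄ ^⊛ 2) (E₄ ^ 2)
        (^⊛-to-^ E₁ E₁ 26 ≗-refl) (^⊛-to-^ e₄ E₄ 2 e₄≗E₄)) (≗-refl {x = i})))
    (P-product {i} (≗-trans (⊛-congʳ {i} (^⊛-to-^ e₂ E₂ 13 E₂≗))
      (⊛⁻¹-inverse (E₂ ^ 13) (^-head-1 E₂ 13 E₂-head))))
    where i = (E₂ ^ 13) ⁻¹

  x≗ : q^ 1 * (E₂ ^ 2 * E₈ ^ 4) * (E₁ ^ 4 * E₄ ^ 2) ⁻¹ ≗ x′
  x≗ = ≗-trans
    (≗-sym (⊛-to-* (q^ 1 ⊛ (e₂ ^⊛ 2 ⊛ dilate e₄ ^⊛ 4)) (q^ 1 * (E₂ ^ 2 * E₈ ^ 4)) i i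
      (⊛-to-* (q^ 1) (q^ 1) (e₂ ^⊛ 2 ⊛ dilate e₄ ^⊛ 4) (E₂ ^ 2 * E₈ ^ 4) (≗-refl {x = q^ 1})
        (⊛-to-* (e₂ ^⊛ 2) (E₂ ^ 2) (dilate e₄ ^⊛ 4) (E₈ ^ 4)
          (^⊛-to-^ e₂ E₂ 2 E₂≗) (^⊛-to-^ (dilate e₄) E₈ 4 e₈≗E₈))) (≗-refl {x = i})))
    (x-product {i} (≗-trans (⊛-congʳ {i} (⊛-to-* (E₁ ^⊛ 4) (E₁ ^ 4) (e₄ ^⊛ 2) (E₄ ^ 2)
        (^⊛-to-^ E₁ E₁ 4 ≗-refl) (^⊛-to-^ e₄ E₄ 2 e₄≗E₄)))
      (⊛⁻¹-inverse (E₁ ^ 4 * E₄ ^ 2)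
        (*-head-1 (E₁ ^ 4) (E₄ ^ 2) (^-head-1 E₁ 4 E₁-head) (^-head-1 E₄ 2 E₄-head)))))
    where i = (E₁ ^ 4 * E₄ ^ 2) ⁻¹

  d≗D : d ≗ D
  d≗D = D-product {d} factor factor-power d-limit

  -- The progression for α + 1 sits at the indices 4n + 2 of the one for α; two factors q move it to
  -- 4(n + 1).
  U²-progression : ∀ α → U² (q^ 1 ⊛ (q^ 1 ⊛ progression d α)) ≗ q^ 1 ⊛ progression d (suc α)
  U²-progression α zero    = ≡.trans (q⊛-head _) (≡.sym (q⊛-head (progression d (suc α))))
  U²-progression α (suc n) = begin
    (q^ 1 ⊛ (q^ 1 ⊛ progression d α)) (4 ℕ.+ double (double n))
      ≡⟨ q⊛-suc _ (3 ℕ.+ double (double n)) ⟩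
    (q^ 1 ⊛ progression d α) (3 ℕ.+ double (double n))
      ≡⟨ q⊛-suc (progression d α) (2 ℕ.+ double (double n)) ⟩
    d (4 ℕ.^ α ℕ.* (2 ℕ.+ double (double n)) ℕ.+ λ[ α ])
      ≡⟨ ≡.cong d index ⟩
    progression d (suc α) n
      ≡⟨ q⊛-suc (progression d (suc α)) n ⟨
    (q^ 1 ⊛ progression d (suc α)) (suc n)  ∎
    where
    open ≡.≡-Reasoning
    index : 4 ℕ.^ α ℕ.* (2 ℕ.+ double (double n)) ℕ.+ λ[ α ] ≡ 4 ℕ.^ suc α ℕ.* n ℕ.+ λ[ suc α ]
    index = ≡.trans
      (≡.cong (λ k → 4 ℕ.^ α ℕ.* (2 ℕ.+ k) ℕ.+ λ[ α ]) (double² n))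
      (≡.trans (solve 3 (λ p n l → p :* (con 2 :+ con 4 :* n) :+ l :=
          con 4 :* p :* n :+ (con 2 :* p :+ l)) ≡.refl (4 ℕ.^ α) n λ[ α ])
        (≡.cong (4 ℕ.^ suc α ℕ.* n ℕ.+_) (≡.sym (λ-suc α))))
      where open ℕ.+-*-Solver

  -- λ₁ = 3, so a single factor q moves the indices 4n + 3 to 4(n + 1).
  U²-d : U² (q^ 1 ⊛ d) ≗ q^ 1 ⊛ progression d 1
  U²-d zero    = ≡.trans (q⊛-head d) (≡.sym (q⊛-head (progression d 1)))
  U²-d (suc n) = ≡.trans (q⊛-suc d (3 ℕ.+ double (double n)))
    (≡.trans (≡.cong d (≡.trans (≡.cong (3 ℕ.+_) (double² n)) (ℕ.+-comm 3 (4 ℕ.* n))))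
      (≡.sym (q⊛-suc (progression d 1) n)))

  -- The factor t is kept apart from g because `step` draws its second factor y from it.
  L-polynomial : ∀ α → ∃ λ g → Polynomial T g ×
    P ⊛ (q^ 1 ⊛ progression d (suc α)) ≗ constant (+ (8 ℕ.^ suc α)) ⊛ (t ⊛ g)
  L-polynomial zero    =
    let g , g∈ , eq = initial
    in g , g∈ , ≗-trans (⊛-congˡ {P} (≗-trans (≗-sym U²-d)
         (λ n → ⊛-congˡ {q^ 1} d≗D (double (double n))))) eq
  L-polynomial (suc α) =
    let g , g∈ , eq = L-polynomial α
        g′ , g′∈ , eq′ = step {q^ 1 ⊛ progression d (suc α)} (+ (8 ℕ.^ suc α)) g∈ eq
    in g′ , g′∈ , ≗-trans (⊛-congˡ {P} (≗-sym (U²-progression (suc α))))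
         (≗-trans eq′ (⊛-congʳ {t ⊛ g′} λ n → ≡.cong (λ a → constant a n)
           (≡.trans (≡.sym (ℤ.pos-* (8 ℕ.^ suc α) 8)) (≡.cong +_ (ℕ.*-comm (8 ℕ.^ suc α) 8)))))

  L-of-polynomial : ∀ α → ∃ λ p → ∀ n →
    (E₁ ^ 26 * E₄ ^ 2 * (E₂ ^ 13) ⁻¹ * (q^ 1 * progression d (suc α))) n ≡
    + (8 ℕ.^ suc α) ℤ.* evaluate p (q^ 1 * (E₂ ^ 2 * E₈ ^ 4) * (E₁ ^ 4 * E₄ ^ 2) ⁻¹) n
  L-of-polynomial α =
    let g , g∈ , Pf≗ = L-polynomial α
        p , tg≗      = coefficients (Polynomial-∘ (resp x≗ gen) (t*-polynomial g∈))
    in p , λ n → ≡.trans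
      (≗-sym (⊛-to-* P (E₁ ^ 26 * E₄ ^ 2 * (E₂ ^ 13) ⁻¹) (q^ 1 ⊛ progression d (suc α))
        (q^ 1 * progression d (suc α))
        (≗-sym P≗) (≗-sym (*≗⊛ (q^ 1) (progression d (suc α))))) n)
      (≡.trans (Pf≗ n) (≡.trans (≡.sym (*≗⊛ (constant (+ (8 ℕ.^ suc α))) (t ⊛ g) n))
        (≡.trans (constant-* (+ (8 ℕ.^ suc α)) (t ⊛ g) n)
          (≡.cong (+ (8 ℕ.^ suc α) ℤ.*_) (≡.trans (tg≗ n) (horner≗evaluate p _ n))))))

  divisibility : ∀ α → ∃ λ p → ∀ n →
    L-of E₁ E₂ E₄ d (suc α) n ≡ + (8 ℕ.^ suc α) ℤ.* evaluate p (x-of E₁ E₂ E₄ E₈) n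
  divisibility α = let p , eq = L-of-polynomial α in p , λ n → ≡.trans
    (≡.cong (λ f → f n) (L-of≡ E₁ E₂ E₄ d (suc α)))
    (≡.trans (eq n) (≡.cong (λ f → + (8 ℕ.^ suc α) ℤ.* evaluate p f n) (≡.sym (x-of≡ E₁ E₂ E₄ E₈))))

-- Instantiation at the concrete series.

dilate-E≡ : ∀ k k′ .{{_ : ℕ.NonZero k}} → 2 ℕ.* k ≡ k′ → dilate (E k) ≗ E k′
dilate-E≡ k k′ ≡.refl = dilate-E k

module d₇-Factors = Factors (λ k → 1# + - q^ suc k) (λ k → 1# + - q^ (2 ℕ.* suc k))
  (λ k n → ≡.refl) (λ k → 1-q^-cong (≡.sym (≡.trans (double≡+ (suc k))
    (≡.cong (suc k ℕ.+_) (≡.sym (ℕ.+-identityʳ (suc k)))))))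

d₇-product : PowerSeries
d₇-product = ∏∞ d₇-Factors.factor

d₇≡ : d₇ ≡ d₇-product
d₇≡ = ≡.refl

d₇-limit : ∀ n → d₇ ≋ ∏ d₇-Factors.factor n mod n
d₇-limit n = ≡.subst (λ d → d ≋ ∏ d₇-Factors.factor n mod n) (≡.sym d₇≡)
  (∏∞-limit d₇-Factors.factor d₇-Factors.factor≋1 n)

module Concrete = Divisibility (E 1) (E 2) (E 4) (E 8) E₁-limit
  (dilate-E≡ 1 2 ≡.refl) (dilate-E≡ 2 4 ≡.refl) (dilate-E≡ 4 8 ≡.refl)
  d₇ d₇-Factors.factor d₇-Factors.factor-power d₇-limit

L≡ : ∀ α → L α ≡ L-of (E 1) (E 2) (E 4) d₇ α
L≡ α = unforce (L α) (L-of (E 1) (E 2) (E 4) d₇ α) λ P z → z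

x≡ : x ≡ x-of (E 1) (E 2) (E 4) (E 8)
x≡ = unforce x (x-of (E 1) (E 2) (E 4) (E 8)) λ P z → z

-- Cross multiplication of unnormalised fractions, which normalisation respects.
a/k≡b/1 : ∀ k .{{_ : ℕ.NonZero k}} {a b} → a ≡ + k ℤ.* b → a ℚ./ k ≡ b ℚ./ 1
a/k≡b/1 k@(suc k-1) {b = b} ≡.refl =
  ℚ.fromℚᵘ-cong {ℚᵘ.mkℚᵘ (+ k ℤ.* b) k-1} {ℚᵘ.mkℚᵘ b 0}
    (ℚᵘ.*≡* (≡.trans (ℤ.*-identityʳ (+ k ℤ.* b)) (ℤ.*-comm (+ k) b)))

divide : ∀ {f f′ g g′} α → f ≡ f′ → g ≡ g′ →
  (∃ λ p → ∀ n → f′ n ≡ + (8 ℕ.^ α) ℤ.* evaluate p g′ n) → 1/8^ α · f ∈ℤ[ g ]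
divide α ≡.refl ≡.refl (p , eq) = p , λ n → a/k≡b/1 (8 ℕ.^ α) {{ℕ.m^n≢0 8 α}} (eq n)

theorem1p2 : ∀ α → 1 ≤ α → 1/8^ α · L α ∈ℤ[ x ]
theorem1p2 (suc α) _ =
  divide {L (suc α)} {L-of (E 1) (E 2) (E 4) d₇ (suc α)} {x} {x-of (E 1) (E 2) (E 4) (E 8)}
    (suc α) (L≡ (suc α)) x≡ (Concrete.divisibility α)
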